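{- Let $D$ be a northwest diagram and $r$ a row index such that the set of columns occupied by row $r$ of $D$ is contained in the set of columns occupied by row $r+1$. Suppose the Kohnert crystals decompose into Demazure crystals as $\mathrm{KD}(s_rD)\cong\bigsqcup_{i=1}^s\mathcal{B}^{u^{(i)}}_{\mu^{(i)}}$ and $\mathrm{KD}(D)\cong\bigsqcup_{i=1}^t\mathcal{B}^{v^{(i)}}_{\nu^{(i)}}$, where each permutation $u^{(i)},v^{(i)}$ is of minimal length among permutations giving the same Demazure crystal. Then $s=t$, and (with the components indexed compatibly) for all $i$ we have $\mu^{(i)}=\nu^{(i)}$ and $u^{(i)}\preceq v^{(i)}$ in Bruhat order.
   Context: A diagram is a finite set of cells $(i,j)\in\mathbb{Z}_{>0}^2$ ($i$ row, $j$ column), rows numbered top to bottom. $D$ is northwest if whenever $(j,k),(i,l)\in D$ with $i<j$, $k<l$, then $(i,k)\in D$. $s_rD$ is $D$ with rows $r$ and $r+1$ exchanged. A Kohnert move selects the rightmost cell of a row and moves it up (toward row 1) within its column to the first empty position above it, jumping over cells, if one exists; $\mathrm{KD}(D)$ is the set of diagrams reachable from $D$ by Kohnert moves (including $D$). Kohnert raising operators: for $i\ge1$, $i$-pair cells in rows $i,i+1$ iteratively by pairing an unpaired cell in row $i+1$ with an unpaired cell in row $i$ weakly to its left whenever all cells in rows $i,i+1$ lying between them are already paired; $e_i(T)=0$ if all cells of row $i+1$ are paired, else $e_i$ moves the rightmost unpaired cell of row $i+1$ to row $i$. The weight of a diagram is its vector of row counts. For $D$ northwest, $\mathrm{KD}(D)$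 is closed under the $e_i$ (when nonzero), and the Kohnert crystal on $D$ is $\mathrm{KD}(D)$ with these operators; it is known to be isomorphic (via a weight-preserving bijection commuting with all $e_i$) to a disjoint union of Demazure crystals. For a partition $\lambda$, $\mathcal{B}_\lambda$ is the $GL_n$ (type $A_{n-1}$) crystal of highest weight $\lambda$ with highest weight element $u_\lambda$; for a subset $X$, $\mathfrak{D}_i(X)=\{b\in\mathcal{B}_\lambda: e_i^k(b)\in X\text{ for some }k\ge0\}$, $\mathfrak{D}_w=\mathfrak{D}_{i_m}\cdots\mathfrak{D}_{i_1}$ for an expression $w=s_{i_m}\cdots s_{i_1}$, and the Demazure crystal is $\mathcal{B}^w_\lambda=\mathfrak{D}_w(\{u_\lambda\})$. -}

module Defs where

-- Conventions: everything is 0-based internally.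
-- Rows 0..n-1 (paper's row i+1 is our row i), columns 0..m-1,
-- tableau letters 0..n-1 (paper's letter k+1 is our letter k),
-- crystal operator e_i (paper's e_{i+1}) acts on rows/letters i, i+1.

open import Data.Nat using (ℕ; zero; suc; _+_; _≤_; _<_; _≡ᵇ_; _<ᵇ_)
open import Data.Nat.ListAction using (sum)
open import Data.Bool using (Bool; true; false; if_then_else_)
open import Data.Fin using (Fin; toℕ)
open import Data.Vec as V using (Vec; []; _∷_)
open import Data.List as L using (List; []; _∷_; _++_; length; concat; replicate)
open import Data.List.Relation.Unary.All using (All)
open import Data.List.Relation.Unary.Linked using (Linked)
open import Data.List.Relation.Binary.Sublist.Propositional using (_⊆_)
open import Data.Maybe using (Maybe; just; nothing)
import Data.Maybe as M
open import Data.Product using (Σ; ∃; _×_; _,_; proj₁; proj₂)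
open import Relation.Binary.PropositionalEquality using (_≡_)
open import Relation.Binary.Construct.Closure.ReflexiveTransitive using (Star)
open import Function.Bundles using (_⇔_)

at : {A : Set} → A → List A → ℕ → A
at d [] _ = d
at d (x ∷ xs) zero = x
at d (x ∷ xs) (suc k) = at d xs k

atV : {A : Set} {k : ℕ} → A → Vec A k → ℕ → A
atV d xs j = at d (V.toList xs) j

updL : {A : Set} → List A → ℕ → A → List A
updL [] _ _ = []
updL (x ∷ xs) zero a = a ∷ xs
updL (x ∷ xs) (suc k) a = x ∷ updL xs k a

updV : {A : Set} {k : ℕ} → Vec A k → ℕ → (A → A) → Vec A k
updV [] _ f = []
updV (x ∷ xs) zero f = f x ∷ xs
updV (x ∷ xs) (suc j) f = x ∷ updV xs j f

nTrue : {k : ℕ} → Vec Bool k → ℕ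
nTrue [] = 0
nTrue (true ∷ xs) = suc (nTrue xs)
nTrue (false ∷ xs) = nTrue xs

occ : ℕ → List ℕ → ℕ
occ x [] = 0
occ x (y ∷ ys) = if x ≡ᵇ y then suc (occ x ys) else occ x ys

lastL : {A : Set} → List A → Maybe A
lastL [] = nothing
lastL (x ∷ []) = just x
lastL (x ∷ y ∷ ys) = lastL (y ∷ ys)

data Sym : Set where
  opn  : ℕ → Sym   -- "(" tagged with a position
  cls  : ℕ → Sym   -- ")" tagged with a position
  skip : Sym

-- returns (unmatched opens, most recent first ; unmatched closes, most recent first)
scan : List Sym → List ℕ → List ℕ → List ℕ × List ℕ
scan [] st cl = st , cl
scan (opn p ∷ xs) st cl = scan xs (p ∷ st) cl
scan (cls p ∷ xs) [] cl = scan xs [] (p ∷ cl)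
scan (cls p ∷ xs) (_ ∷ st) cl = scan xs st cl
scan (skip ∷ xs) st cl = scan xs st cl

-- Diagrams inside an n × m grid: D[row][col] = true iff the cell is in D.

Diagram : ℕ → ℕ → Set
Diagram n m = Vec (Vec Bool m) n

cell : {n m : ℕ} → Diagram n m → ℕ → ℕ → Bool
cell D i c = atV false (atV (V.replicate _ false) D i) c

setCell : {n m : ℕ} → Diagram n m → ℕ → ℕ → Bool → Diagram n m
setCell D i c b = updV D i (λ row → updV row c (λ _ → b))

rowAt : {n m : ℕ} → Diagram n m → ℕ → Vec Bool m
rowAt D j = atV (V.replicate _ false) D j

swapRows : {n m : ℕ} → ℕ → Diagram n m → Diagram n m
swapRows r D = V.tabulate λ k →
  if toℕ k ≡ᵇ r then rowAt D (suc r)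
  else if toℕ k ≡ᵇ suc r then rowAt D r
  else rowAt D (toℕ k)

Northwest : {n m : ℕ} → Diagram n m → Set
Northwest D = ∀ i j k l → i < j → k < l →
  cell D j k ≡ true → cell D i l ≡ true → cell D i k ≡ true

wtD : {n m : ℕ} → Diagram n m → Vec ℕ n
wtD D = V.map nTrue D

KMove : {n m : ℕ} → Diagram n m → Diagram n m → Set
KMove D D' = Σ ℕ λ i → Σ ℕ λ c → Σ ℕ λ i' →
  cell D i c ≡ true ×
  (∀ c' → c < c' → cell D i c' ≡ false) ×
  i' < i × cell D i' c ≡ false ×
  (∀ j → i' < j → j < i → cell D j c ≡ true) ×
  D' ≡ setCell (setCell D i c false) i' c true

KD : {n m : ℕ} → Diagram n m → Diagram n m → Set
KD D T = Star KMove D T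

kSyms : {n m : ℕ} → ℕ → Diagram n m → List Sym
kSyms {m = m} i D = concat (L.map (λ c →
    (if cell D i c then opn c ∷ [] else []) ++
    (if cell D (suc i) c then cls c ∷ [] else [])) (L.upTo m))

eK : {n m : ℕ} → ℕ → Diagram n m → Maybe (Diagram n m)
eK i D with proj₂ (scan (kSyms i D) [] [])
... | [] = nothing
... | c ∷ _ = just (setCell (setCell D (suc i) c false) i c true)

-- The GL_n crystal B_λ realised on semistandard Young tableaux.
-- A tableau is given by its rows (top to bottom), entries in 0..n-1.

Tab : ℕ → Set
Tab n = Vec (List ℕ) n

IsPartition : {n : ℕ} → Vec ℕ n → Set
IsPartition {n} λ′ = ∀ k → suc k < n → atV 0 λ′ (suc k) ≤ atV 0 λ′ k

SSYT : {n : ℕ} → Vec ℕ n → Tab n → Set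
SSYT {n} λ′ T =
  (∀ k → length (atV [] T k) ≡ atV 0 λ′ k) ×
  (∀ k → All (_< n) (atV [] T k)) ×
  (∀ k → Linked _≤_ (atV [] T k)) ×
  (∀ k c → suc k < n → c < length (atV [] T (suc k)) →
     at 0 (atV [] T k) c < at 0 (atV [] T (suc k)) c)

hw : {n : ℕ} → Vec ℕ n → Tab n
hw λ′ = V.tabulate λ k → replicate (V.lookup λ′ k) (toℕ k)

wtB : {n : ℕ} → Tab n → Vec ℕ n
wtB T = V.tabulate λ k → sum (L.map (occ (toℕ k)) (V.toList T))

readWord : {n : ℕ} → Tab n → List ℕ
readWord T = concat (V.toList (V.reverse T))

splitBy : {k : ℕ} → Vec ℕ k → List ℕ → Vec (List ℕ) k
splitBy [] w = []
splitBy (l ∷ ls) w = L.take l w ∷ splitBy ls (L.drop l w)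

unread : {n : ℕ} → Tab n → List ℕ → Tab n
unread T w = V.reverse (splitBy (V.reverse (V.map length T)) w)

tSyms : ℕ → List ℕ → List Sym
tSyms i w = L.zipWith (λ p x →
  if x ≡ᵇ suc i then opn p else if x ≡ᵇ i then cls p else skip)
  (L.upTo (length w)) w

-- tableau crystal operator e_i (signature rule): letter i+1 = "(", letter i = ")";
-- the leftmost unmatched i+1 is changed to i.
eB : {n : ℕ} → ℕ → Tab n → Maybe (Tab n)
eB i T with lastL (proj₁ (scan (tSyms i (readWord T)) [] []))
... | nothing = nothing
... | just p = just (unread T (updL (readWord T) p i))

-- e_i^k (nothing = 0)
eBpow : {n : ℕ} → ℕ → ℕ → Tab n → Maybe (Tab n)
eBpow i zero T = just T
eBpow i (suc k) T = M._>>=_ (eBpow i k T) (eB i)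

-- Permutations of {0,…,n-1} in one-line notation

Perm : ℕ → Set
Perm n = Vec ℕ n

IsPerm : (n : ℕ) → Perm n → Set
IsPerm n w = (∀ k → k < n → atV 0 w k < n) ×
  (∀ k l → k < n → l < n → atV 0 w k ≡ atV 0 w l → k ≡ l)

idPerm : (n : ℕ) → Perm n
idPerm n = V.tabulate toℕ

swapVal : ℕ → ℕ → ℕ
swapVal i x = if x ≡ᵇ i then suc i else if x ≡ᵇ suc i then i else x

-- product of a word i_m … i_1 (listed left to right) : s_{i_m} ⋯ s_{i_1}
prodW : (n : ℕ) → List ℕ → Perm n
prodW n [] = idPerm n
prodW n (i ∷ a) = V.map (swapVal i) (prodW n a)

invs : {n : ℕ} → Perm n → ℕ
invs {n} w = sum (L.map (λ p → sum (L.map (λ q →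
    if atV 0 w q <ᵇ atV 0 w p then 1 else 0) (L.drop (suc p) (L.upTo n))))
  (L.upTo n))

Reduced : (n : ℕ) → List ℕ → Perm n → Set
Reduced n a w = All (λ i → suc i < n) a × prodW n a ≡ w × length a ≡ invs w

-- Bruhat order (subword property)
Bruhat : (n : ℕ) → Perm n → Perm n → Set
Bruhat n u v = Σ (List ℕ) λ a → Σ (List ℕ) λ b →
  Reduced n a v × b ⊆ a × Reduced n b u

-- 𝔇_{i_m} ⋯ 𝔇_{i_1} ({u_λ}) for the word i_m … i_1
DemW : {n : ℕ} → Vec ℕ n → List ℕ → Tab n → Set
DemW λ′ [] b = b ≡ hw λ′
DemW λ′ (i ∷ a) b = SSYT λ′ b × Σ ℕ λ k → Σ _ λ x → eBpow i k b ≡ just x × DemW λ′ a x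

Dem : {n : ℕ} → Vec ℕ n → Perm n → Tab n → Set
Dem {n} λ′ w b = Σ (List ℕ) λ a → Reduced n a w × DemW λ′ a b

MinimalFor : {n : ℕ} → Vec ℕ n → Perm n → Set
MinimalFor {n} λ′ w = ∀ w' → IsPerm n w' → (∀ b → Dem λ′ w' b ⇔ Dem λ′ w b) → invs w ≤ invs w'

record KohnertDecomp {n m : ℕ} (D : Diagram n m) (s : ℕ)
    (λs : Fin s → Vec ℕ n) (ws : Fin s → Perm n) : Set where
  field
    φ     : Diagram n m → Fin s × Tab n
    into  : ∀ T → KD D T → Dem (λs (proj₁ (φ T))) (ws (proj₁ (φ T))) (proj₂ (φ T))
    inj   : ∀ T T' → KD D T → KD D T' → φ T ≡ φ T' → T ≡ T'
    surj  : ∀ k b → Dem (λs k) (ws k) b → Σ (Diagram n m) λ T → KD D T × φ T ≡ (k , b)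
    wt    : ∀ T → KD D T → wtD T ≡ wtB (proj₂ (φ T))
    comm  : ∀ i → suc i < n → ∀ T → KD D T →
              M.map φ (eK i T) ≡ M.map (λ b → (proj₁ (φ T) , b)) (eB i (proj₂ (φ T)))

{-# OPTIONS --safe #-}
-- Write E for s_r D. Every Kohnert diagram of E is one of D, and sources of Kohnert crystals correspond to
-- components, so everything is read off the inclusion KD(E) ⊆ KD(D): it is a morphism of crystals because
-- KD(E) is closed under the e_i, and it is onto on highest weight elements.
--
-- Both facts come from one description. Call a sequence of column sets standard for a flag w if it is read off
-- a Bruhat-decreasing chain of flags below w (a defining chain of standard monomial theory), where northwest
-- diagrams prescribe the heights and, for each step of the orthodontia of the diagram, one level at which the
-- chain may go up. Such sets S(w) are stable under the e_i, under Kohnert moves (which act on whole flags), and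
-- an element of S(s_i w) killed by e_i lies in S(w) if w < s_i w. One gets KD(D) ⊆ S, and conversely S ⊆ KD(D)
-- because KD(D) is closed under lowering all lone cells of an initially empty row in the first t columns.
--
-- Semistandard tableaux, read column by column from the right, are handled by the same chains: the Demazure
-- crystal of w is S(w) for the order that compares flags at the column heights of the shape. The tableau of
-- extremal weight then turns an inclusion of Demazure crystals into the Bruhat order, minimality of u being
-- used to pass from the column heights to all levels.
module Submission where

open import Defs
open import Data.Nat using (ℕ; zero; suc; _+_; _∸_; _⊓_; _≤_; _<_; _≡ᵇ_; _<ᵇ_; z≤n; s≤s; _≤?_; _<?_; _≟_)
open import Data.Nat.Properties
open import Data.Nat.Induction using (<-rec)
open import Data.Nat.ListAction using (sum)
open import Data.Bool using (Bool; true; false; if_then_else_; _∧_; _∨_; not)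
import Data.Bool.Properties as Bool
open import Data.Fin using (Fin; toℕ)
open import Data.Fin.Permutation using (↔⇒≡)
open import Data.Vec as V using (Vec; []; _∷_)
import Data.Vec.Properties as V
open import Data.List as L using (List; []; _∷_; _++_; length; concat; replicate)
open import Data.List.Properties using (∷-injective; ++-assoc; concat-++; ++-identityʳ; length-++; length-replicate; length-applyUpTo; map-applyUpTo)
open import Data.List.Relation.Unary.All using (All; []; _∷_)
open import Data.List.Relation.Unary.Linked using (Linked; []; [-]; _∷_)
open import Data.List.Relation.Binary.Sublist.Propositional using (_⊆_; []; _∷_; _∷ʳ_)
open import Data.Maybe using (just; nothing)
import Data.Maybe as M
open import Data.Unit using (⊤; tt)
open import Data.Product using (Σ; _×_; _,_; proj₁; proj₂)
open import Data.Sum using (_⊎_; inj₁; inj₂; [_,_]′)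
open import Data.Empty using (⊥; ⊥-elim)
open import Relation.Nullary using (¬_; Dec; yes; no)
open import Relation.Binary.Definitions using (tri<; tri≈; tri>)
open import Relation.Binary.PropositionalEquality using (_≡_; _≢_; refl; sym; trans; cong; cong₂; subst; subst₂; module ≡-Reasoning)
open import Relation.Binary.Construct.Closure.ReflexiveTransitive using (ε; _◅_; _◅◅_)
open import Function using (_∘_; id)
open import Function.Bundles using (_↔_; Inverse; _⇔_; mk⇔; mk↔ₛ′)

-- Finite sets and the Gale order

-- Three maps on sets carry the proof: `dn i`, `up i` and `κ a`. Each is monotone for inclusion and
-- for the Gale order, so it acts on all levels of a flag and on a whole tail of a chain at once. An
-- operator that changes one column is imitated by transforming a tail of the chain. The remaining
-- columns of that tail survive because the map fixes them, or because a column of opposite sign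
-- stops the transformation. The obstacle is the inclusion of `S` in `KD(D)`. Orthodontia gets
-- simpler only after some columns have been raised, and this must be undone by lowering cells,
-- which in general leaves a Kohnert crystal. Lowering in all of the first `t` columns together
-- stays inside, and the bound `t` has to vary along the induction. The two given decompositions are
-- unrelated bijections. They are tied together at the sources, and from there down the crystal by
-- injectivity of `e_i` on tableaux of one shape.

ISet : Set
ISet = ℕ → Bool

infix 4 _≗_ _≼_

_≗_ : ISet → ISet → Set
X ≗ Y = ∀ x → X x ≡ Y x

bit : Bool → ℕ
bit true = 1
bit false = 0

cnt : ISet → ℕ → ℕ
cnt X zero = 0
cnt X (suc q) = bit (X q) + cnt X q

-- The Gale order: the k-th smallest element of X is at most that of Y.
_≼_ : ISet → ISet → Set
X ≼ Y = ∀ q → cnt Y q ≤ cnt X q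

≡ᵇ-refl : ∀ m → (m ≡ᵇ m) ≡ true
≡ᵇ-refl zero = refl
≡ᵇ-refl (suc m) = ≡ᵇ-refl m

≢⇒≡ᵇ : ∀ m n → m ≢ n → (m ≡ᵇ n) ≡ false
≢⇒≡ᵇ zero zero h = ⊥-elim (h refl)
≢⇒≡ᵇ zero (suc n) h = refl
≢⇒≡ᵇ (suc m) zero h = refl
≢⇒≡ᵇ (suc m) (suc n) h = ≢⇒≡ᵇ m n (λ e → h (cong suc e))

≡ᵇ-true : ∀ m n → (m ≡ᵇ n) ≡ true → m ≡ n
≡ᵇ-true zero zero h = refl
≡ᵇ-true (suc m) (suc n) h = cong suc (≡ᵇ-true m n h)

bool-absurd : ∀ {b} {A : Set} → b ≡ true → b ≡ false → A
bool-absurd refl ()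

bool? : ∀ b → b ≡ true ⊎ b ≡ false
bool? true = inj₁ refl
bool? false = inj₂ refl

<ᵇ-true : ∀ m n → m < n → (m <ᵇ n) ≡ true
<ᵇ-true zero (suc n) h = refl
<ᵇ-true (suc m) (suc n) (s≤s h) = <ᵇ-true m n h

<ᵇ-false : ∀ m n → n ≤ m → (m <ᵇ n) ≡ false
<ᵇ-false m zero h = refl
<ᵇ-false (suc m) (suc n) (s≤s h) = <ᵇ-false m n h

<ᵇ-true⁻ : ∀ m n → (m <ᵇ n) ≡ true → m < n
<ᵇ-true⁻ zero (suc n) h = s≤s z≤n
<ᵇ-true⁻ (suc m) (suc n) h = s≤s (<ᵇ-true⁻ m n h)

<ᵇ-false⁻ : ∀ m n → (m <ᵇ n) ≡ false → n ≤ m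
<ᵇ-false⁻ m zero h = z≤n
<ᵇ-false⁻ (suc m) (suc n) h = s≤s (<ᵇ-false⁻ m n h)

bool-iff : ∀ {a b : Bool} → (a ≡ true → b ≡ true) → (b ≡ true → a ≡ true) → a ≡ b
bool-iff {true} f g = sym (f refl)
bool-iff {false} {true} f g = g refl
bool-iff {false} {false} f g = refl

cnt-cong-< : ∀ {X Y} q → (∀ x → x < q → X x ≡ Y x) → cnt X q ≡ cnt Y q
cnt-cong-< zero h = refl
cnt-cong-< (suc q) h = cong₂ _+_ (cong bit (h q ≤-refl)) (cnt-cong-< q (λ x l → h x (m<n⇒m<1+n l)))

cnt-cong : ∀ {X Y} → X ≗ Y → ∀ q → cnt X q ≡ cnt Y q
cnt-cong h q = cnt-cong-< q (λ x _ → h x)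

bit≤1 : ∀ b → bit b ≤ 1
bit≤1 true = ≤-refl
bit≤1 false = z≤n

bit-mono : ∀ {a b} → (a ≡ true → b ≡ true) → bit a ≤ bit b
bit-mono {true} h rewrite h refl = ≤-refl
bit-mono {false} h = z≤n

_⊑_ : ISet → ISet → Set
X ⊑ Y = ∀ x → X x ≡ true → Y x ≡ true

cnt-⊑ : ∀ {X Y} → X ⊑ Y → ∀ q → cnt X q ≤ cnt Y q
cnt-⊑ h zero = z≤n
cnt-⊑ h (suc q) = +-mono-≤ (bit-mono (h q)) (cnt-⊑ h q)

cnt-≤ : ∀ X q → cnt X q ≤ q
cnt-≤ X zero = z≤n
cnt-≤ X (suc q) = +-mono-≤ (bit≤1 (X q)) (cnt-≤ X q)

cnt-suc≤ : ∀ X q → cnt X (suc q) ≤ suc (cnt X q)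
cnt-suc≤ X q = +-monoˡ-≤ (cnt X q) (bit≤1 (X q))

cnt-mono : ∀ X {p q} → p ≤ q → cnt X p ≤ cnt X q
cnt-mono X {p} {zero} z≤n = z≤n
cnt-mono X {p} {suc q} h with m≤n⇒m<n∨m≡n h
... | inj₁ (s≤s l) = ≤-trans (cnt-mono X l) (m≤n+m (cnt X q) (bit (X q)))
... | inj₂ refl = ≤-refl

cnt-full : ∀ X q → q ≤ cnt X q → ∀ x → x < q → X x ≡ true
cnt-full X (suc q) h x l with X q in eq
... | false = ⊥-elim (1+n≰n (≤-trans h (cnt-≤ X q)))
cnt-full X (suc q) (s≤s h) x l | true with m≤n⇒m<n∨m≡n l
... | inj₁ (s≤s l') = cnt-full X q h x l'
... | inj₂ refl = eq

cnt-stop : ∀ X {p n} → p ≤ n → cnt X n ≤ cnt X p → ∀ x → p ≤ x → x < n → X x ≡ false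
cnt-stop X {p} {suc n} h e x l1 l2 with m≤n⇒m<n∨m≡n l2
cnt-stop X {p} {suc n} h e x l1 l2 | inj₁ (s≤s l3) =
  cnt-stop X (≤-trans l1 (<⇒≤ l3)) (≤-trans (m≤n+m (cnt X n) (bit (X n))) e) x l1 l3
cnt-stop X {p} {suc n} h e x l1 l2 | inj₂ refl with X x in eq
... | false = refl
... | true = ⊥-elim (1+n≰n (≤-trans e (cnt-mono X l1)))

cnt-all : ∀ X q → (∀ x → x < q → X x ≡ true) → cnt X q ≡ q
cnt-all X zero h = refl
cnt-all X (suc q) h rewrite h q ≤-refl = cong suc (cnt-all X q (λ x l → h x (m<n⇒m<1+n l)))

cnt-flat : ∀ X {p q} → p ≤ q → (∀ x → p ≤ x → x < q → X x ≡ false) → cnt X q ≡ cnt X p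
cnt-flat X {p} {zero} z≤n h = refl
cnt-flat X {p} {suc q} l h with m≤n⇒m<n∨m≡n l
... | inj₂ refl = refl
... | inj₁ (s≤s l') rewrite h q l' ≤-refl = cnt-flat X l' (λ x a b → h x a (m<n⇒m<1+n b))

cnt-none : ∀ X p q → (∀ x → p ≤ x → x < q → X x ≡ false) → cnt X q ≤ p
cnt-none X p q h with p ≤? q
... | yes l = ≤-trans (≤-reflexive (cnt-flat X l h)) (cnt-≤ X p)
... | no l = ≤-trans (cnt-≤ X q) (<⇒≤ (≰⇒> l))

≼-refl : ∀ {X} → X ≼ X
≼-refl q = ≤-refl

≼-trans : ∀ {X Y Z} → X ≼ Y → Y ≼ Z → X ≼ Z
≼-trans h k q = ≤-trans (k q) (h q)

≗⇒≼ : ∀ {X Y} → X ≗ Y → X ≼ Y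
≗⇒≼ h q = ≤-reflexive (sym (cnt-cong h q))

-- dn i turns a lone i + 1 into i, and up i turns a lone i into i + 1.
dn up : ℕ → ISet → ISet
dn i X x = if x ≡ᵇ i then X i ∨ X (suc i) else if x ≡ᵇ suc i then X i ∧ X (suc i) else X x
up i X x = if x ≡ᵇ i then X i ∧ X (suc i) else if x ≡ᵇ suc i then X i ∨ X (suc i) else X x

data Near (i x : ℕ) : Set where
  low  : x ≡ i → Near i x
  high : x ≡ suc i → Near i x
  far  : x ≢ i → x ≢ suc i → Near i x

near : ∀ i x → Near i x
near i x with x ≟ i | x ≟ suc i
... | yes e | _ = low e
... | no _ | yes e = high e
... | no a | no b = far a b

suc-≡ᵇ : ∀ i → (suc i ≡ᵇ i) ≡ false
suc-≡ᵇ i = ≢⇒≡ᵇ (suc i) i (λ ())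

module _ (i : ℕ) (X : ISet) where
  dn-low : dn i X i ≡ X i ∨ X (suc i)
  dn-low rewrite ≡ᵇ-refl i = refl
  dn-high : dn i X (suc i) ≡ X i ∧ X (suc i)
  dn-high rewrite suc-≡ᵇ i | ≡ᵇ-refl i = refl
  dn-far : ∀ {x} → x ≢ i → x ≢ suc i → dn i X x ≡ X x
  dn-far {x} a b rewrite ≢⇒≡ᵇ x i a | ≢⇒≡ᵇ x (suc i) b = refl
  up-low : up i X i ≡ X i ∧ X (suc i)
  up-low rewrite ≡ᵇ-refl i = refl
  up-high : up i X (suc i) ≡ X i ∨ X (suc i)
  up-high rewrite suc-≡ᵇ i | ≡ᵇ-refl i = refl
  up-far : ∀ {x} → x ≢ i → x ≢ suc i → up i X x ≡ X x
  up-far {x} a b rewrite ≢⇒≡ᵇ x i a | ≢⇒≡ᵇ x (suc i) b = refl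

dn-cong : ∀ i {X Y} → X ≗ Y → dn i X ≗ dn i Y
dn-cong i h x rewrite h i | h (suc i) | h x = refl

up-cong : ∀ i {X Y} → X ≗ Y → up i X ≗ up i Y
up-cong i h x rewrite h i | h (suc i) | h x = refl

∨-mono : ∀ {a b c d} → (a ≡ true → c ≡ true) → (b ≡ true → d ≡ true) → a ∨ b ≡ true → c ∨ d ≡ true
∨-mono {true} f g h rewrite f refl = refl
∨-mono {false} {true} {c} f g h rewrite g refl = Bool.∨-zeroʳ c

∧-mono : ∀ {a b c d} → (a ≡ true → c ≡ true) → (b ≡ true → d ≡ true) → a ∧ b ≡ true → c ∧ d ≡ true
∧-mono {true} {true} f g h rewrite f refl | g refl = refl

dn-⊑ : ∀ i {X Y} → X ⊑ Y → dn i X ⊑ dn i Y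
dn-⊑ i {X} {Y} h x t with near i x
... | low refl = trans (dn-low i Y) (∨-mono (h i) (h (suc i)) (trans (sym (dn-low i X)) t))
... | high refl = trans (dn-high i Y) (∧-mono (h i) (h (suc i)) (trans (sym (dn-high i X)) t))
... | far a b = trans (dn-far i Y a b) (h x (trans (sym (dn-far i X a b)) t))

up-⊑ : ∀ i {X Y} → X ⊑ Y → up i X ⊑ up i Y
up-⊑ i {X} {Y} h x t with near i x
... | low refl = trans (up-low i Y) (∧-mono (h i) (h (suc i)) (trans (sym (up-low i X)) t))
... | high refl = trans (up-high i Y) (∨-mono (h i) (h (suc i)) (trans (sym (up-high i X)) t))
... | far a b = trans (up-far i Y a b) (h x (trans (sym (up-far i X a b)) t))

∨∧-bits : ∀ a b c → bit (a ∧ b) + (bit (a ∨ b) + c) ≡ bit b + (bit a + c)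
∨∧-bits true true c = refl
∨∧-bits true false c = refl
∨∧-bits false true c = refl
∨∧-bits false false c = refl

∧∨-bits : ∀ a b c → bit (a ∨ b) + (bit (a ∧ b) + c) ≡ bit b + (bit a + c)
∧∨-bits true true c = refl
∧∨-bits true false c = refl
∧∨-bits false true c = refl
∧∨-bits false false c = refl

cnt-past : ∀ {X Y} p → cnt X p ≡ cnt Y p → (∀ x → p ≤ x → X x ≡ Y x) → ∀ q → p ≤ q → cnt X q ≡ cnt Y q
cnt-past {X} {Y} p e h q l with m≤n⇒m<n∨m≡n l
... | inj₂ refl = e
cnt-past p e h (suc q) l | inj₁ (s≤s l') = cong₂ _+_ (cong bit (h q l')) (cnt-past p e h q l')

low≢ : ∀ {x i} → x < i → x ≢ suc i
low≢ l refl = 1+n≰n (<⇒≤ l)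

cnt-dn-below : ∀ i X q → q ≤ i → cnt (dn i X) q ≡ cnt X q
cnt-dn-below i X q l = cnt-cong-< q (λ x l' → dn-far i X (<⇒≢ (<-≤-trans l' l)) (low≢ (<-≤-trans l' l)))

cnt-up-below : ∀ i X q → q ≤ i → cnt (up i X) q ≡ cnt X q
cnt-up-below i X q l = cnt-cong-< q (λ x l' → up-far i X (<⇒≢ (<-≤-trans l' l)) (low≢ (<-≤-trans l' l)))

cnt-dn-mid : ∀ i X → cnt (dn i X) (suc i) ≡ bit (X i ∨ X (suc i)) + cnt X i
cnt-dn-mid i X = cong₂ _+_ (cong bit (dn-low i X)) (cnt-dn-below i X i ≤-refl)

cnt-up-mid : ∀ i X → cnt (up i X) (suc i) ≡ bit (X i ∧ X (suc i)) + cnt X i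
cnt-up-mid i X = cong₂ _+_ (cong bit (up-low i X)) (cnt-up-below i X i ≤-refl)

cnt-dn : ∀ i X q → q ≢ suc i → cnt (dn i X) q ≡ cnt X q
cnt-dn i X q ne with q ≤? i
... | yes l = cnt-dn-below i X q l
... | no g = cnt-past (suc (suc i)) base rest q (≤∧≢⇒< (≰⇒> g) (ne ∘ sym))
  where
  base : cnt (dn i X) (suc (suc i)) ≡ cnt X (suc (suc i))
  base = trans (cong₂ _+_ (cong bit (dn-high i X)) (cnt-dn-mid i X)) (∨∧-bits (X i) (X (suc i)) (cnt X i))
  rest : ∀ x → suc (suc i) ≤ x → dn i X x ≡ X x
  rest x l = dn-far i X (>⇒≢ (<⇒≤ l)) (>⇒≢ l)

cnt-up : ∀ i X q → q ≢ suc i → cnt (up i X) q ≡ cnt X q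
cnt-up i X q ne with q ≤? i
... | yes l = cnt-up-below i X q l
... | no g = cnt-past (suc (suc i)) base rest q (≤∧≢⇒< (≰⇒> g) (ne ∘ sym))
  where
  base : cnt (up i X) (suc (suc i)) ≡ cnt X (suc (suc i))
  base = trans (cong₂ _+_ (cong bit (up-high i X)) (cnt-up-mid i X)) (∧∨-bits (X i) (X (suc i)) (cnt X i))
  rest : ∀ x → suc (suc i) ≤ x → up i X x ≡ X x
  rest x l = up-far i X (>⇒≢ (<⇒≤ l)) (>⇒≢ l)

-- `dn i` changes only the count at `suc i`. The new count `bit (a ∨ b) + c` is the minimum of
-- `c + 1` and `c + bit a + bit b`, hence monotone in the two neighbouring counts, which do not
-- change.
∨-lift : ∀ a b c a' b' c' → c' ≤ c → bit b' + (bit a' + c') ≤ bit b + (bit a + c) →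
  bit (a' ∨ b') + c' ≤ bit (a ∨ b) + c
∨-lift a b c false false c' h k = ≤-trans h (m≤n+m c (bit (a ∨ b)))
∨-lift true b c true b' c' h k = s≤s h
∨-lift false true c true b' c' h k = s≤s h
∨-lift false false c true b' c' h k = ≤-trans (m≤n+m (suc c') (bit b')) k
∨-lift true b c false true c' h k = s≤s h
∨-lift false true c false true c' h k = s≤s h
∨-lift false false c false true c' h k = k

-- Dually, `bit (a ∧ b) + c` is the maximum of `c` and `c + bit a + bit b - 1`.
∧-lift : ∀ a b c a' b' c' → c' ≤ c → bit b' + (bit a' + c') ≤ bit b + (bit a + c) →
  bit (a' ∧ b') + c' ≤ bit (a ∧ b) + c
∧-lift a b c false b' c' h k = ≤-trans h (m≤n+m c (bit (a ∧ b)))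
∧-lift a b c true false c' h k = ≤-trans h (m≤n+m c (bit (a ∧ b)))
∧-lift true true c true true c' h k = s≤s h
∧-lift true false c true true c' h k = ≤-pred k
∧-lift false true c true true c' h k = ≤-pred k
∧-lift false false c true true c' h k = <⇒≤ k

dn-≼ : ∀ i {X Y} → X ≼ Y → dn i X ≼ dn i Y
dn-≼ i {X} {Y} h q with q ≟ suc i
... | no ne = subst₂ _≤_ (sym (cnt-dn i Y q ne)) (sym (cnt-dn i X q ne)) (h q)
... | yes refl = subst₂ _≤_ (sym (cnt-dn-mid i Y)) (sym (cnt-dn-mid i X))
      (∨-lift (X i) (X (suc i)) _ (Y i) (Y (suc i)) _ (h i) (h (suc (suc i))))

up-≼ : ∀ i {X Y} → X ≼ Y → up i X ≼ up i Y
up-≼ i {X} {Y} h q with q ≟ suc i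
... | no ne = subst₂ _≤_ (sym (cnt-up i Y q ne)) (sym (cnt-up i X q ne)) (h q)
... | yes refl = subst₂ _≤_ (sym (cnt-up-mid i Y)) (sym (cnt-up-mid i X))
      (∧-lift (X i) (X (suc i)) _ (Y i) (Y (suc i)) _ (h i) (h (suc (suc i))))

bit-∨ : ∀ a b → bit a ≤ bit (a ∨ b)
bit-∨ true b = ≤-refl
bit-∨ false b = z≤n

bit-∧ : ∀ a b → bit (a ∧ b) ≤ bit a
bit-∧ true b = bit≤1 b
bit-∧ false b = z≤n

dn-dec : ∀ i X → dn i X ≼ X
dn-dec i X q with q ≟ suc i
... | no ne = ≤-reflexive (sym (cnt-dn i X q ne))
... | yes refl = ≤-trans (+-monoˡ-≤ (cnt X i) (bit-∨ (X i) (X (suc i)))) (≤-reflexive (sym (cnt-dn-mid i X)))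

up-inc : ∀ i X → X ≼ up i X
up-inc i X q with q ≟ suc i
... | no ne = ≤-reflexive (cnt-up i X q ne)
... | yes refl = ≤-trans (≤-reflexive (cnt-up-mid i X)) (+-monoˡ-≤ (cnt X i) (bit-∧ (X i) (X (suc i))))

Plus Minus : ℕ → ISet → Set
Plus i X = X i ≡ true × X (suc i) ≡ false
Minus i X = X i ≡ false × X (suc i) ≡ true

plus? : ∀ i X → Dec (Plus i X)
plus? i X with X i | X (suc i)
... | true | false = yes (refl , refl)
... | true | true = no (λ { (_ , ()) })
... | false | _ = no (λ { (() , _) })

minus? : ∀ i X → Dec (Minus i X)
minus? i X with X i | X (suc i)
... | false | true = yes (refl , refl)
... | false | false = no (λ { (_ , ()) })
... | true | _ = no (λ { (() , _) })

∨-fix : ∀ a b → ¬ (a ≡ false × b ≡ true) → a ∨ b ≡ a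
∨-fix true b h = refl
∨-fix false true h = ⊥-elim (h (refl , refl))
∨-fix false false h = refl

∧-fix : ∀ a b → ¬ (a ≡ false × b ≡ true) → a ∧ b ≡ b
∧-fix true b h = refl
∧-fix false true h = ⊥-elim (h (refl , refl))
∧-fix false false h = refl

∨-fix′ : ∀ a b → ¬ (a ≡ true × b ≡ false) → a ∨ b ≡ b
∨-fix′ true true h = refl
∨-fix′ true false h = ⊥-elim (h (refl , refl))
∨-fix′ false b h = refl

∧-fix′ : ∀ a b → ¬ (a ≡ true × b ≡ false) → a ∧ b ≡ a
∧-fix′ true true h = refl
∧-fix′ true false h = ⊥-elim (h (refl , refl))
∧-fix′ false b h = refl

dn-fix : ∀ i X → ¬ Minus i X → dn i X ≗ X
dn-fix i X nm x with near i x
... | far a b = dn-far i X a b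
... | low refl = trans (dn-low i X) (∨-fix (X i) (X (suc i)) nm)
... | high refl = trans (dn-high i X) (∧-fix (X i) (X (suc i)) nm)

up-fix : ∀ i X → ¬ Plus i X → up i X ≗ X
up-fix i X nm x with near i x
... | far a b = up-far i X a b
... | low refl = trans (up-low i X) (∧-fix′ (X i) (X (suc i)) nm)
... | high refl = trans (up-high i X) (∨-fix′ (X i) (X (suc i)) nm)

up-dn : ∀ i X → up i (dn i X) ≗ up i X
up-dn i X x with near i x
... | far a b = trans (up-far i (dn i X) a b) (trans (dn-far i X a b) (sym (up-far i X a b)))
... | low refl rewrite up-low i (dn i X) | up-low i X | dn-low i X | dn-high i X with X i | X (suc i)
...   | true | true = refl
...   | true | false = refl
...   | false | true = refl
...   | false | false = refl
up-dn i X x | high refl rewrite up-high i (dn i X) | up-high i X | dn-low i X | dn-high i X with X i | X (suc i)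
...   | true | true = refl
...   | true | false = refl
...   | false | true = refl
...   | false | false = refl

dn-up : ∀ i X → dn i (up i X) ≗ dn i X
dn-up i X x with near i x
... | far a b = trans (dn-far i (up i X) a b) (trans (up-far i X a b) (sym (dn-far i X a b)))
... | low refl rewrite dn-low i (up i X) | up-low i X | dn-low i X | up-high i X with X i | X (suc i)
...   | true | true = refl
...   | true | false = refl
...   | false | true = refl
...   | false | false = refl
dn-up i X x | high refl rewrite dn-high i (up i X) | up-high i X | dn-high i X | up-low i X with X i | X (suc i)
...   | true | true = refl
...   | true | false = refl
...   | false | true = refl
...   | false | false = refl

up-up : ∀ i X → up i (up i X) ≗ up i X
up-up i X x with near i x
... | far a b = up-far i (up i X) a b
... | low refl rewrite up-low i (up i X) | up-low i X | up-high i X with X i | X (suc i)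
...   | true | true = refl
...   | true | false = refl
...   | false | true = refl
...   | false | false = refl
up-up i X x | high refl rewrite up-high i (up i X) | up-low i X | up-high i X with X i | X (suc i)
...   | true | true = refl
...   | true | false = refl
...   | false | true = refl
...   | false | false = refl

-- Kohnert's move of the element a on one set: a jumps to the first gap above it, if there is one.

κ : ℕ → ISet → ISet
κ zero X = X
κ (suc i) X = if X (suc i) then dn i (κ i X) else X

κ-above : ∀ a X x → a < x → κ a X x ≡ X x
κ-above zero X x l = refl
κ-above (suc i) X x l with X (suc i)
... | false = refl
... | true = trans (dn-far i (κ i X) (>⇒≢ (<⇒≤ l)) (>⇒≢ l)) (κ-above i X x (<⇒≤ l))

κ-fix : ∀ a X → X a ≡ false → κ a X ≗ X
κ-fix zero X h x = refl
κ-fix (suc i) X h x rewrite h = refl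

κ-cong : ∀ a {X Y} → X ≗ Y → κ a X ≗ κ a Y
κ-cong zero h = h
κ-cong (suc i) {X} {Y} h x rewrite h (suc i) with Y (suc i)
... | true = dn-cong i (κ-cong i h) x
... | false = h x

κ-keeps : ∀ a X x → x ≢ a → X x ≡ true → κ a X x ≡ true
κ-keeps zero X x ne h = h
κ-keeps (suc i) X x ne h with X (suc i) in e
... | false = h
... | true with near i x
...   | high p = ⊥-elim (ne p)
...   | far p q = trans (dn-far i (κ i X) p q) (κ-keeps i X x p h)
...   | low refl = trans (dn-low i (κ i X))
          (trans (cong (κ i X i ∨_) (trans (κ-above i X (suc i) ≤-refl) e)) (Bool.∨-zeroʳ (κ i X i)))

-- The critical case is a moving element that lies in `Y` but not in `X`: the move removes nothing
-- else from `Y`, so `X` stays inside. This is what lets a Kohnert move act on a flag.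
κ-⊑ : ∀ a {X Y} → X ⊑ Y → κ a X ⊑ κ a Y
κ-⊑ zero h = h
κ-⊑ (suc i) {X} {Y} h x t with X (suc i) in e
... | true rewrite h (suc i) e = dn-⊑ i (κ-⊑ i h) x t
... | false with Y (suc i) in e'
...   | false = h x t
...   | true = subst (λ b → (if b then dn i (κ i Y) else Y) x ≡ true) e'
          (κ-keeps (suc i) Y x (λ { refl → bool-absurd t e }) (h x t))

cnt-κ-past : ∀ a X q → a < q → cnt (κ a X) q ≡ cnt X q
cnt-κ-past zero X q l = refl
cnt-κ-past (suc i) X q l with X (suc i)
... | false = refl
... | true = trans (cnt-dn i (κ i X) q (>⇒≢ l)) (cnt-κ-past i X q (<⇒≤ l))

κ-dec : ∀ a X → κ a X ≼ X
κ-dec zero X = ≼-refl {X}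
κ-dec (suc i) X with X (suc i)
... | false = ≼-refl {X}
... | true = ≼-trans {dn i (κ i X)} {κ i X} {X} (dn-dec i (κ i X)) (κ-dec i X)

dn-ahead : ∀ i {X Y} → X ≼ Y → suc (cnt Y (suc i)) ≤ cnt X (suc i) → X ≼ dn i Y
dn-ahead i {X} {Y} h k q with q ≟ suc i
... | no ne = ≤-trans (≤-reflexive (cnt-dn i Y q ne)) (h q)
... | yes refl = ≤-trans (≤-reflexive (cnt-dn-mid i Y)) (≤-trans (aux (Y i) (Y (suc i))) k)
  where
  aux : ∀ a b → bit (a ∨ b) + cnt Y i ≤ suc (bit a + cnt Y i)
  aux true b = n≤1+n _
  aux false true = ≤-refl
  aux false false = n≤1+n _

-- The jump is a cascade of slides `dn i` through consecutive elements of `Y`. Passing one of them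
-- downwards lowers the count of `Y` by one and that of `X` by at most one, so the lead of `X`
-- persists at every level where the cascade may increase a count of `Y`.
κ-ahead : ∀ a {X Y} → X ≼ Y → suc (cnt Y (suc a)) ≤ cnt X (suc a) → X ≼ κ a Y
κ-ahead zero h k = h
κ-ahead (suc i) {X} {Y} h k with Y (suc i) in e
... | false = h
... | true = dn-ahead i {X} {κ i Y} (κ-ahead i h k') (≤-trans (s≤s (≤-reflexive (cnt-κ-past i Y (suc i) ≤-refl))) k')
  where
  k' : suc (cnt Y (suc i)) ≤ cnt X (suc i)
  k' = ≤-pred (≤-trans k (cnt-suc≤ X (suc i)))

-- If `Y` contains `a` and `X` does not, comparing the counts up to and including `a` gives `X` a
-- lead of one below `a`, and `κ-ahead` takes over.
κ-above-gap : ∀ a {X Y} → X ≼ Y → X a ≡ false → X ≼ κ a Y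
κ-above-gap zero h e = h
κ-above-gap (suc i) {X} {Y} h e with Y (suc i) in e'
... | false = h
... | true = dn-ahead i {X} {κ i Y} (κ-ahead i h k) (≤-trans (s≤s (≤-reflexive (cnt-κ-past i Y (suc i) ≤-refl))) k)
  where
  k : suc (cnt Y (suc i)) ≤ cnt X (suc i)
  k = subst₂ _≤_ (cong (λ b → bit b + cnt Y (suc i)) e') (cong (λ b → bit b + cnt X (suc i)) e) (h (suc (suc i)))

κ-≼ : ∀ a {X Y} → X ≼ Y → κ a X ≼ κ a Y
κ-≼ zero h = h
κ-≼ (suc i) {X} {Y} h with X (suc i) in e
... | false = κ-above-gap (suc i) h e
... | true with Y (suc i)
...   | true = dn-≼ i {κ i X} {κ i Y} (κ-≼ i h)
...   | false = ≼-trans {dn i (κ i X)} {κ i X} {Y} (dn-dec i (κ i X))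
                (≼-trans {κ i X} {X} {Y} (κ-dec i X) h)

κ-move : ∀ a b X Y → b < a → X a ≡ true → X b ≡ false → (∀ j → b < j → j < a → X j ≡ true) →
  Y a ≡ false → Y b ≡ true → (∀ x → x ≢ a → x ≢ b → Y x ≡ X x) → κ a X ≗ Y
κ-move (suc i) b X Y l ta fb mid ya yb yo x rewrite ta with m≤n⇒m<n∨m≡n (≤-pred l)
κ-move (suc i) b X Y l ta fb mid ya yb yo x | inj₂ refl = go
  where
  K : κ i X ≗ X
  K = κ-fix i X fb
  go : dn i (κ i X) x ≡ Y x
  go with near i x
  ... | low refl = trans (dn-low i (κ i X)) (trans (cong₂ _∨_ (trans (K i) fb) (trans (K (suc i)) ta)) (sym yb))
  ... | high refl = trans (dn-high i (κ i X)) (trans (cong₂ _∧_ (trans (K i) fb) (trans (K (suc i)) ta)) (sym ya))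
  ... | far p q = trans (dn-far i (κ i X) p q) (trans (K x) (sym (yo x q p)))
κ-move (suc i) b X Y l ta fb mid ya yb yo x | inj₁ l' = go
  where
  -- `Z` is the result when the element `i`, one above the moving one, jumps into `b` instead; the
  -- slide of `suc i` into the vacated `i` completes the jump.
  Z : ISet
  Z x = if x ≡ᵇ i then false else if x ≡ᵇ b then true else X x
  Zo : ∀ x → x ≢ i → x ≢ b → Z x ≡ X x
  Zo x p q rewrite ≢⇒≡ᵇ x i p | ≢⇒≡ᵇ x b q = refl
  Zi : Z i ≡ false
  Zi rewrite ≡ᵇ-refl i = refl
  Zb : Z b ≡ true
  Zb rewrite ≢⇒≡ᵇ b i (<⇒≢ l') | ≡ᵇ-refl b = refl
  K : κ i X ≗ Z
  K = κ-move i b X Z l' (mid i l' ≤-refl) fb (λ j p q → mid j p (m<n⇒m<1+n q)) Zi Zb Zo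
  Ki : κ i X i ≡ false
  Ki = trans (K i) Zi
  Ks : κ i X (suc i) ≡ true
  Ks = trans (κ-above i X (suc i) ≤-refl) ta
  go : dn i (κ i X) x ≡ Y x
  go with near i x
  ... | low refl = trans (dn-low i (κ i X)) (trans (cong₂ _∨_ Ki Ks)
          (sym (trans (yo i (λ ()) (>⇒≢ l')) (mid i l' ≤-refl))))
  ... | high refl = trans (dn-high i (κ i X)) (trans (cong₂ _∧_ Ki Ks) (sym ya))
  ... | far p q with x ≟ b
  ...   | yes refl = trans (dn-far i (κ i X) p q) (trans (K b) (trans Zb (sym yb)))
  ...   | no r = trans (dn-far i (κ i X) p q) (trans (K x) (trans (Zo x p r) (sym (yo x q r))))

-- Flags, defining chains, and their stability under raising, lowering and Kohnert moves

module Flags (n : ℕ) where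

  record Flag : Set where
    constructor flag
    field
      lv   : ℕ → ISet
      mono : ∀ p → lv p ⊑ lv (suc p)
      card : ∀ p → p ≤ n → cnt (lv p) n ≡ p
  open Flag public

  mono* : ∀ w {p q} → p ≤ q → lv w p ⊑ lv w q
  mono* w {p} {zero} z≤n x h = h
  mono* w {p} {suc q} l x h with m≤n⇒m<n∨m≡n l
  ... | inj₂ refl = h
  ... | inj₁ (s≤s l') = mono w q x (mono* w l' x h)

  dnF : ∀ i → suc i < n → Flag → Flag
  dnF i l w = flag (dn i ∘ lv w) (λ p → dn-⊑ i (mono w p))
    (λ p h → trans (cnt-dn i (lv w p) n (>⇒≢ l)) (card w p h))

  upF : ∀ i → suc i < n → Flag → Flag
  upF i l w = flag (up i ∘ lv w) (λ p → up-⊑ i (mono w p))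
    (λ p h → trans (cnt-up i (lv w p) n (>⇒≢ l)) (card w p h))

  κF : ∀ a → a < n → Flag → Flag
  κF a l w = flag (κ a ∘ lv w) (λ p → κ-⊑ a (mono w p))
    (λ p h → trans (cnt-κ-past a (lv w p) n l) (card w p h))

  _≤[_]_ : Flag → (ℕ → Bool) → Flag → Set
  v ≤[ Q ] w = ∀ p → Q p ≡ true → lv v p ≼ lv w p

  _≤F_ : Flag → Flag → Set
  v ≤F w = ∀ p → lv v p ≼ lv w p

  ≤[]-trans : ∀ {u v w Q} → u ≤[ Q ] v → v ≤[ Q ] w → u ≤[ Q ] w
  ≤[]-trans {u} {v} {w} h k p q = ≼-trans {lv u p} {lv v p} {lv w p} (h p q) (k p q)

  everywhere : ℕ → Bool
  everywhere _ = true

  -- Diagrams and tableaux are two programs for the same chains: diagrams compare at all levels or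
  -- at all but one, tableaux at the column heights. Each stability result is thus proved once for
  -- both crystals.
  data Prog : Set where
    nil : Prog
    col : (ℕ → Bool) → ℕ → Prog → Prog
    rel : (ℕ → Bool) → Prog → Prog

  width : Prog → ℕ
  width nil = 0
  width (col _ _ P) = suc (width P)
  width (rel _ P) = width P

  -- Defining chains below w; P lists the column heights and the levels compared in each step.
  S : Flag → Prog → (ℕ → ISet) → Set
  S w nil T = ⊤
  S w (col Q h P) T = Σ Flag λ v → v ≤[ Q ] w × T 0 ≗ lv v h × S v P (T ∘ suc)
  S w (rel Q P) T = Σ Flag λ v → v ≤[ Q ] w × S v P T

  S-mono : ∀ {v w} → v ≤F w → ∀ P T → S v P T → S w P T
  S-mono h nil T s = tt
  S-mono {v} {w} h (col Q k P) T (v' , o , e , s) = v' , ≤[]-trans {v'} {v} {w} o (λ p _ → h p) , e , s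
  S-mono {v} {w} h (rel Q P) T (v' , o , s) = v' , ≤[]-trans {v'} {v} {w} o (λ p _ → h p) , s

  S-cong : ∀ w P {T T'} → (∀ c → c < width P → T c ≗ T' c) → S w P T → S w P T'
  S-cong w nil h s = tt
  S-cong w (col Q k P) h (v , o , e , s) =
    v , o , (λ x → trans (sym (h 0 (s≤s z≤n) x)) (e x)) , S-cong v P (λ c l → h (suc c) (s≤s l)) s
  S-cong w (rel Q P) h (v , o , s) = v , o , S-cong v P h s

  -- Nestedness makes the sign of a flag at (i, i+1) consistent along its levels.
  plus-no-minus : ∀ i w h → Plus i (lv w h) → ∀ p → ¬ Minus i (lv w p)
  plus-no-minus i w h (a , b) p (c , d) with ≤-total h p
  ... | inj₁ l = bool-absurd (mono* w l i a) c
  ... | inj₂ l = bool-absurd (mono* w l (suc i) d) b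

  module _ (i : ℕ) (li : suc i < n) where

    -- Up to the first plus column `dn i` is applied to every flag. At a plus column the flag `v`
    -- has no minus sign at any level, so `dn i` fixes it; hence `v` lies below the lowered `w`, and
    -- the chain continues unchanged from there.
    raise : ∀ w P Z Z' → S w P Z →
      (∀ c → c < width P → (∀ c₁ → c₁ ≤ c → ¬ Plus i (Z c₁)) → Z' c ≗ dn i (Z c)) →
      (∀ c c₁ → c < width P → c₁ ≤ c → Plus i (Z c₁) → Z' c ≗ Z c) →
      S (dnF i li w) P Z'
    raise w nil Z Z' s H₁ H₂ = tt
    raise w (rel Q P) Z Z' (v , o , s) H₁ H₂ =
      dnF i li v , (λ p q → dn-≼ i {lv v p} {lv w p} (o p q)) , raise v P Z Z' s H₁ H₂
    raise w (col Q h P) Z Z' (v , o , e , s) H₁ H₂ with plus? i (Z 0)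
    ... | yes pl = v , below , (λ x → trans (H₂ 0 0 (s≤s z≤n) z≤n pl x) (e x)) ,
          S-cong v P (λ c l x → sym (H₂ (suc c) 0 (s≤s l) z≤n pl x)) s
      where
      pl' : Plus i (lv v h)
      pl' = trans (sym (e i)) (proj₁ pl) , trans (sym (e (suc i))) (proj₂ pl)
      below : v ≤[ Q ] dnF i li w
      below p q = ≼-trans {lv v p} {dn i (lv v p)} {dn i (lv w p)}
        (≗⇒≼ (λ x → sym (dn-fix i (lv v p) (plus-no-minus i v h pl' p) x))) (dn-≼ i {lv v p} {lv w p} (o p q))
    ... | no np = dnF i li v , (λ p q → dn-≼ i {lv v p} {lv w p} (o p q)) ,
          (λ x → trans (H₁ 0 (s≤s z≤n) (λ { _ z≤n → np }) x) (dn-cong i e x)) ,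
          raise v P (Z ∘ suc) (Z' ∘ suc) s
            (λ c l k → H₁ (suc c) (s≤s l) (λ { zero _ → np ; (suc c₁) (s≤s m) → k c₁ m }))
            (λ c c₁ l m → H₂ (suc c) (suc c₁) (s≤s l) (s≤s m))

    -- The case of `raise` in which no column changes: a column of minus sign occurs only after a
    -- plus column. Elements killed by `e_i` are of this kind.
    lower-flag : ∀ w P T → S w P T →
      (∀ c → c < width P → Minus i (T c) → Σ ℕ λ c₁ → c₁ < c × Plus i (T c₁)) → S (dnF i li w) P T
    lower-flag w P T s h = raise w P T T s
      (λ c l k x → sym (dn-fix i (T c) (λ mi → let (c₁ , l₁ , pl) = h c l mi in k c₁ (<⇒≤ l₁) pl) x))
      (λ c c₁ l m pl x → refl)

    -- Lowering the flag of column `c₀` keeps it below its predecessor. The later columns must then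
    -- fit under a smaller flag, and `lower-flag` says that they do, because no unmatched minus
    -- follows `c₀`.
    raise-at : ∀ w P T T' c₀ → S w P T → c₀ < width P →
      (∀ c → c ≢ c₀ → T' c ≗ T c) → T' c₀ ≗ dn i (T c₀) →
      (∀ c → c < width P → c₀ < c → Minus i (T c) → Σ ℕ λ c₁ → c₀ < c₁ × c₁ < c × Plus i (T c₁)) →
      S w P T'
    raise-at w (rel Q P) T T' c₀ (v , o , s) l e₁ e₂ h = v , o , raise-at v P T T' c₀ s l e₁ e₂ h
    raise-at w (col Q k P) T T' zero (v , o , e , s) l e₁ e₂ h =
      dnF i li v , (λ p q → ≼-trans {dn i (lv v p)} {lv v p} {lv w p} (dn-dec i (lv v p)) (o p q)) ,
      (λ x → trans (e₂ x) (dn-cong i e x)) ,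
      S-cong (dnF i li v) P (λ c _ x → sym (e₁ (suc c) (λ ()) x))
        (lower-flag v P (T ∘ suc) s (λ c l' mi → shift (h (suc c) (s≤s l') (s≤s z≤n) mi)))
      where
      shift : ∀ {c} → (Σ ℕ λ c₁ → 0 < c₁ × c₁ < suc c × Plus i (T c₁)) → Σ ℕ λ c₁ → c₁ < c × Plus i (T (suc c₁))
      shift (suc c₁ , _ , s≤s l₂ , pl) = c₁ , l₂ , pl
    raise-at w (col Q k P) T T' (suc c₀) (v , o , e , s) (s≤s l) e₁ e₂ h =
      v , o , (λ x → trans (e₁ 0 (λ ()) x) (e x)) ,
      raise-at v P (T ∘ suc) (T' ∘ suc) c₀ s l (λ c ne → e₁ (suc c) (λ { refl → ne refl })) e₂
        (λ c l₁ l₂ mi → shift (h (suc c) (s≤s l₁) (s≤s l₂) mi))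
      where
      shift : ∀ {c} → (Σ ℕ λ c₁ → suc c₀ < c₁ × c₁ < suc c × Plus i (T c₁)) →
        Σ ℕ λ c₁ → c₀ < c₁ × c₁ < c × Plus i (T (suc c₁))
      shift (suc c₁ , s≤s l₁ , s≤s l₂ , pl) = c₁ , l₁ , l₂ , pl

    -- In the next three lemmas T arises from T' by lowering in column c₀.

    lower-at-first : ∀ w P T T' c₀ → S w P T' → c₀ < width P →
      (∀ c → c ≢ c₀ → T c ≗ T' c) → T c₀ ≗ up i (T' c₀) →
      (∀ c → c < c₀ → ¬ Plus i (T' c)) → S (upF i li w) P T
    lower-at-first w (rel Q P) T T' c₀ (v , o , s) l e₁ e₂ h =
      upF i li v , (λ p q → up-≼ i {lv v p} {lv w p} (o p q)) , lower-at-first v P T T' c₀ s l e₁ e₂ h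
    lower-at-first w (col Q k P) T T' zero (v , o , e , s) l e₁ e₂ h =
      upF i li v , (λ p q → up-≼ i {lv v p} {lv w p} (o p q)) , (λ x → trans (e₂ x) (up-cong i e x)) ,
      -- The columns after `c₀` keep their old chain, which lies below `v` and hence below the
      -- larger flag.
      S-mono {v} {upF i li v} (λ p → up-inc i (lv v p)) P (T ∘ suc)
        (S-cong v P (λ c _ x → sym (e₁ (suc c) (λ ()) x)) s)
    lower-at-first w (col Q k P) T T' (suc c₀) (v , o , e , s) (s≤s l) e₁ e₂ h =
      upF i li v , (λ p q → up-≼ i {lv v p} {lv w p} (o p q)) ,
      (λ x → trans (e₁ 0 (λ ()) x) (trans (sym (up-fix i (T' 0) (h 0 (s≤s z≤n)) x)) (up-cong i e x))) ,
      lower-at-first v P (T ∘ suc) (T' ∘ suc) c₀ s l (λ c ne → e₁ (suc c) (λ { refl → ne refl })) e₂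
        (λ c l₁ → h (suc c) (s≤s l₁))

    lower-at-after-minus : ∀ w P T T' c₀ c₁ → S w P T' → c₀ < width P →
      (∀ c → c ≢ c₀ → T c ≗ T' c) → T c₀ ≗ up i (T' c₀) →
      c₁ < c₀ → Minus i (T' c₁) → (∀ c → c₁ < c → c < c₀ → ¬ Plus i (T' c)) → S w P T
    lower-at-after-minus w (rel Q P) T T' c₀ c₁ (v , o , s) l e₁ e₂ l₁ mi h =
      v , o , lower-at-after-minus v P T T' c₀ c₁ s l e₁ e₂ l₁ mi h
    lower-at-after-minus w (col Q k P) T T' (suc c₀) zero (v , o , e , s) (s≤s l) e₁ e₂ l₁ mi h =
      v , o , (λ x → trans (e₁ 0 (λ ()) x) (e x)) ,
      S-mono {upF i li v} {v} same P (T ∘ suc)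
        (lower-at-first v P (T ∘ suc) (T' ∘ suc) c₀ s l (λ c ne → e₁ (suc c) (λ { refl → ne refl })) e₂
          (λ c l₂ → h (suc c) (s≤s z≤n) (s≤s l₂)))
      where
      mi' : Minus i (lv v k)
      mi' = trans (sym (e i)) (proj₁ mi) , trans (sym (e (suc i))) (proj₂ mi)
      -- A minus sign at one level excludes plus signs at all levels, so `up i` fixes `v`, and the
      -- enlargement needed further on ends at this column.
      same : upF i li v ≤F v
      same p = ≗⇒≼ (up-fix i (lv v p) (λ pl → plus-no-minus i v p pl k mi'))
    lower-at-after-minus w (col Q k P) T T' (suc c₀) (suc c₁) (v , o , e , s) (s≤s l) e₁ e₂ (s≤s l₁) mi h =
      v , o , (λ x → trans (e₁ 0 (λ ()) x) (e x)) ,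
      lower-at-after-minus v P (T ∘ suc) (T' ∘ suc) c₀ c₁ s l (λ c ne → e₁ (suc c) (λ { refl → ne refl })) e₂ l₁ mi
        (λ c l₂ l₃ → h (suc c) (s≤s l₂) (s≤s l₃))

    lower-at : ∀ w P T T' c₀ → S w P T' → c₀ < width P →
      (∀ c → c ≢ c₀ → T c ≗ T' c) → T c₀ ≗ up i (T' c₀) →
      (∀ c → c < c₀ → Plus i (T' c) → Σ ℕ λ c₁ → c < c₁ × c₁ < c₀ × Minus i (T' c₁)) →
      S (upF i li w) P T
    lower-at w P T T' c₀ s l e₁ e₂ h = search c₀ ≤-refl (λ c l₁ l₂ → ⊥-elim (<⇒≱ l₂ l₁))
      where
      -- The search is for the last plus column before `c₀`. If it exists, the minus column
      -- following it absorbs the change and even `w` suffices; otherwise `up i` is applied to the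
      -- whole beginning of the chain.
      search : ∀ k → k ≤ c₀ → (∀ c → k ≤ c → c < c₀ → ¬ Plus i (T' c)) → S (upF i li w) P T
      search zero _ np = lower-at-first w P T T' c₀ s l e₁ e₂ (λ c l₁ → np c z≤n l₁)
      search (suc k) lk np with plus? i (T' k)
      ... | no npk = search k (<⇒≤ lk) np'
        where
        np' : ∀ c → k ≤ c → c < c₀ → ¬ Plus i (T' c)
        np' c l₁ l₂ with m≤n⇒m<n∨m≡n l₁
        ... | inj₁ l₃ = np c l₃ l₂
        ... | inj₂ refl = npk
      ... | yes pl with h k lk pl
      ...   | c₁ , l₁ , l₂ , mi = S-mono {w} {upF i li w} (λ p → up-inc i (lv w p)) P T
              (lower-at-after-minus w P T T' c₀ c₁ s l e₁ e₂ l₂ mi (λ c l₃ l₄ → np c (≤-trans l₁ (<⇒≤ l₃)) l₄))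

  module _ (a : ℕ) (la : a < n) where

    κ-flag : ∀ w P T → (∀ c → c < width P → T c a ≡ false) → S w P T → S (κF a la w) P T
    κ-flag w nil T h s = tt
    κ-flag w (rel Q P) T h (v , o , s) =
      κF a la v , (λ p q → κ-≼ a {lv v p} {lv w p} (o p q)) , κ-flag v P T h s
    κ-flag w (col Q k P) T h (v , o , e , s) =
      κF a la v , (λ p q → κ-≼ a {lv v p} {lv w p} (o p q)) ,
      (λ x → trans (e x) (sym (κ-fix a (lv v k) (trans (sym (e a)) (h 0 (s≤s z≤n))) x))) ,
      κ-flag v P (T ∘ suc) (λ c l → h (suc c) (s≤s l)) s

    -- The moved cell is the last one of its row, so every later column lacks `a` and is fixed by
    -- `κ a`. Therefore `κ a` may be applied to all flags from column `c` on.
    S-move : ∀ w P T T' c b → S w P T → c < width P → b < a →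
      T c a ≡ true → T c b ≡ false → (∀ j → b < j → j < a → T c j ≡ true) →
      (∀ c' → c' < width P → c < c' → T c' a ≡ false) →
      T' c a ≡ false → T' c b ≡ true → (∀ x → x ≢ a → x ≢ b → T' c x ≡ T c x) →
      (∀ c' → c' ≢ c → T' c' ≗ T c') → S w P T'
    S-move w (rel Q P) T T' c b (v , o , s) l ba ta fb mid cl ya yb yo rest =
      v , o , S-move v P T T' c b s l ba ta fb mid cl ya yb yo rest
    S-move w (col Q k P) T T' zero b (v , o , e , s) l ba ta fb mid cl ya yb yo rest =
      κF a la v , (λ p q → ≼-trans {κ a (lv v p)} {lv v p} {lv w p} (κ-dec a (lv v p)) (o p q)) ,
      (λ x → trans (sym (κ-move a b (T 0) (T' 0) ba ta fb mid ya yb yo x)) (κ-cong a e x)) ,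
      S-cong (κF a la v) P (λ c' _ x → sym (rest (suc c') (λ ()) x))
        (κ-flag v P (T ∘ suc) (λ c' l' → cl (suc c') (s≤s l') (s≤s z≤n)) s)
    S-move w (col Q k P) T T' (suc c) b (v , o , e , s) (s≤s l) ba ta fb mid cl ya yb yo rest =
      v , o , (λ x → trans (rest 0 (λ ()) x) (e x)) ,
      S-move v P (T ∘ suc) (T' ∘ suc) c b s l ba ta fb mid (λ c' l₁ l₂ → cl (suc c') (s≤s l₁) (s≤s l₂)) ya yb yo
        (λ c' ne → rest (suc c') (λ { refl → ne refl }))

-- Kohnert moves on column sets, and closure under lowering a row

module Moves (n : ℕ) where
  open Flags n

  -- D c is the set of rows occupied in column c.
  Dg : Set
  Dg = ℕ → ISet

  record ColMove (a b : ℕ) (X Y : ISet) : Set where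
    constructor colMove
    field
      b<a  : b < a
      at-a : X a ≡ true
      at-b : X b ≡ false
      mid  : ∀ j → b < j → j < a → X j ≡ true
      to-a : Y a ≡ false
      to-b : Y b ≡ true
      rest : ∀ x → x ≢ a → x ≢ b → Y x ≡ X x

  record Move (m : ℕ) (G G' : Dg) : Set where
    constructor move
    field
      {a b c} : ℕ
      c<m   : c < m
      a<n   : a < n
      clear : ∀ c' → c < c' → G c' a ≡ false
      cm    : ColMove a b (G c) (G' c)
      other : ∀ c' → c' ≢ c → G' c' ≗ G c'

  colMove-cong : ∀ {a b X Y X' Y'} → X ≗ X' → Y ≗ Y' → ColMove a b X Y → ColMove a b X' Y'
  colMove-cong {a} {b} p q (colMove l ta fb md fa tb rs) =
    colMove l (trans (sym (p a)) ta) (trans (sym (p b)) fb) (λ j x y → trans (sym (p j)) (md j x y))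
      (trans (sym (q a)) fa) (trans (sym (q b)) tb) (λ x ne ne' → trans (sym (q x)) (trans (rs x ne ne') (p x)))

  move-cong : ∀ {m G H G' H'} → (∀ c → G c ≗ G' c) → (∀ c → H c ≗ H' c) → Move m G H → Move m G' H'
  move-cong p q (move {a} {b} {c} lc la cl cm o) =
    move lc la (λ c' l → trans (sym (p c' a)) (cl c' l)) (colMove-cong (p c) (q c) cm)
      (λ c' ne x → trans (sym (q c' x)) (trans (o c' ne x) (p c' x)))

  data Reach (m : ℕ) (D : Dg) : Dg → Set where
    here : ∀ {G} → (∀ c → D c ≗ G c) → Reach m D G
    _▷_  : ∀ {G H} → Reach m D G → Move m G H → Reach m D H

  reach-cong : ∀ {m D G H} → (∀ c → G c ≗ H c) → Reach m D G → Reach m D H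
  reach-cong e (here p) = here (λ c x → trans (p c x) (e c x))
  reach-cong e (r ▷ s) = r ▷ move-cong (λ c x → refl) e s

  reach-trans : ∀ {m D G H} → Reach m D G → Reach m G H → Reach m D H
  reach-trans r (here e) = reach-cong e r
  reach-trans r (q ▷ s) = reach-trans r q ▷ s

  Supp : ℕ → Dg → Set
  Supp m D = ∀ c x → m ≤ c → D c x ≡ false

  reach-supp : ∀ {m D G} → Supp m D → Reach m D G → Supp m G
  reach-supp h (here e) c x l = trans (sym (e c x)) (h c x l)
  reach-supp h (r ▷ move {c = c₀} lc la cl cm o) c x l =
    trans (o c (λ { refl → <⇒≱ lc l }) x) (reach-supp h r c x l)

  -- Columns from t on get their single cells in row r + 1 moved up, from right to left.
  sweep : ∀ {m} r → suc r < n → ∀ G →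
    (∀ c → m ≤ c → ¬ Minus r (G c)) → ∀ d t H → t + d ≡ m →
    (∀ c c' → t ≤ c → c < c' → Minus r (G c) → G c' r ∧ G c' (suc r) ≡ false) →
    (∀ c → t ≤ c → H c ≗ dn r (G c)) → (∀ c → c < t → H c ≗ G c) → Reach m G H
  sweep r lr G nm zero t H e cl h₁ h₂ = here go
    where
    go : ∀ c → G c ≗ H c
    go c x with t ≤? c
    ... | yes l = sym (trans (h₁ c l x) (dn-fix r (G c) (nm c (subst (_≤ c) (trans (sym (+-identityʳ t)) e) l)) x))
    ... | no l = sym (h₂ c (≰⇒> l) x)
  sweep {m} r lr G nm (suc d) t H e cl h₁ h₂ = fin
    where
    H' : Dg
    H' c = if t <ᵇ c then dn r (G c) else G c
    hi : ∀ c → suc t ≤ c → H' c ≗ dn r (G c)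
    hi c l x rewrite <ᵇ-true t c l = refl
    lo : ∀ c → c < suc t → H' c ≗ G c
    lo c l x rewrite <ᵇ-false t c (≤-pred l) = refl
    R : Reach m G H'
    R = sweep r lr G nm d (suc t) H' (trans (sym (+-suc t d)) e) (λ c c' l → cl c c' (<⇒≤ l)) hi lo
    off : ∀ c → c ≢ t → H c ≗ H' c
    off c ne x with <-cmp c t
    ... | tri< l _ _ = trans (h₂ c l x) (sym (lo c (m<n⇒m<1+n l) x))
    ... | tri≈ _ p _ = ⊥-elim (ne p)
    ... | tri> _ _ l = trans (h₁ c (<⇒≤ l) x) (sym (hi c l x))
    tm : t < m
    tm = subst (t <_) e (m<m+n t (s≤s z≤n))
    Ht : H t ≗ dn r (G t)
    Ht = h₁ t ≤-refl
    fin : Reach m G H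
    fin with minus? r (G t)
    ... | no no' = reach-cong (λ c → same c) R
      where
      same : ∀ c → H' c ≗ H c
      same c x with c ≟ t
      ... | no ne = sym (off c ne x)
      ... | yes refl = sym (trans (Ht x) (trans (dn-fix r (G t) no' x) (sym (lo t ≤-refl x))))
    ... | yes mi = R ▷ move tm lr
        (λ c' l → trans (hi c' l (suc r)) (trans (dn-high r (G c')) (cl t c' ≤-refl l mi)))
        (colMove ≤-refl (trans (lo t ≤-refl (suc r)) (proj₂ mi)) (trans (lo t ≤-refl r) (proj₁ mi))
          (λ j l₁ l₂ → ⊥-elim (<⇒≱ l₁ (≤-pred l₂)))
          (trans (Ht (suc r)) (trans (dn-high r (G t)) (cong₂ _∧_ (proj₁ mi) (proj₂ mi))))
          (trans (Ht r) (trans (dn-low r (G t)) (cong₂ _∨_ (proj₁ mi) (proj₂ mi))))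
          (λ x ne ne' → trans (Ht x) (trans (dn-far r (G t) ne' ne) (sym (lo t ≤-refl x)))))
        off

  down : ℕ → ℕ → Dg → Dg
  down r t G c = if c <ᵇ t then up r (G c) else G c

  down-in : ∀ r t G c → c < t → down r t G c ≗ up r (G c)
  down-in r t G c l x rewrite <ᵇ-true c t l = refl

  down-out : ∀ r t G c → t ≤ c → down r t G c ≗ G c
  down-out r t G c l x rewrite <ᵇ-false c t l = refl

  -- Pushing a lone cell from row `r` to `suc r` can change only the landing row: a cell that would
  -- have landed in `suc r` below an occupied `r` now finds its gap in `r`.
  up-colMove : ∀ r {a b X Y} → a ≢ r → a ≢ suc r → ColMove a b X Y → Σ ℕ λ b' → ColMove a b' (up r X) (up r Y)
  up-colMove r {a} {b} {X} {Y} ar as (colMove l ta fb md fa tb rs) with near r b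
  ... | far br bs = b , colMove l (trans (up-far r X ar as) ta) (trans (up-far r X br bs) fb) md'
        (trans (up-far r Y ar as) fa) (trans (up-far r Y br bs) tb) rs'
    where
    er : Y r ≡ X r
    er = rs r (ar ∘ sym) (br ∘ sym)
    es : Y (suc r) ≡ X (suc r)
    es = rs (suc r) (as ∘ sym) (bs ∘ sym)
    rs' : ∀ x → x ≢ a → x ≢ b → up r Y x ≡ up r X x
    rs' x p q with near r x
    ... | low refl = trans (up-low r Y) (trans (cong₂ _∧_ er es) (sym (up-low r X)))
    ... | high refl = trans (up-high r Y) (trans (cong₂ _∨_ er es) (sym (up-high r X)))
    ... | far u v = trans (up-far r Y u v) (trans (rs x p q) (sym (up-far r X u v)))
    md' : ∀ j → b < j → j < a → up r X j ≡ true
    md' j p q with near r j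
    ... | low refl = trans (up-low r X) (cong₂ _∧_ (md r p q) (md (suc r) (m<n⇒m<1+n p) (≤∧≢⇒< q (as ∘ sym))))
    ... | high refl = trans (up-high r X) (cong (_∨ X (suc r)) (md r (≤∧≢⇒< (≤-pred p) br) (<⇒≤ q)))
    ... | far u v = trans (up-far r X u v) (md j p q)
  ... | low refl = b , colMove l (trans (up-far r X ar as) ta) (trans (up-low r X) (cong₂ _∧_ fb ts)) md'
        (trans (up-far r Y ar as) fa) (trans (up-low r Y) (cong₂ _∧_ tb ts')) rs'
    where
    ts : X (suc r) ≡ true
    ts = md (suc r) ≤-refl (≤∧≢⇒< l (as ∘ sym))
    ts' : Y (suc r) ≡ true
    ts' = trans (rs (suc r) (as ∘ sym) (λ ())) ts
    rs' : ∀ x → x ≢ a → x ≢ b → up r Y x ≡ up r X x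
    rs' x p q with near r x
    ... | low refl = ⊥-elim (q refl)
    ... | high refl = trans (up-high r Y) (trans (cong₂ _∨_ tb ts') (sym (trans (up-high r X) (cong₂ _∨_ fb ts))))
    ... | far u v = trans (up-far r Y u v) (trans (rs x p q) (sym (up-far r X u v)))
    md' : ∀ j → b < j → j < a → up r X j ≡ true
    md' j p q with near r j
    ... | low refl = ⊥-elim (<-irrefl refl p)
    ... | high refl = trans (up-high r X) (cong₂ _∨_ fb ts)
    ... | far u v = trans (up-far r X u v) (md j p q)
  ... | high refl with bool? (X r)
  ...   | inj₂ er = b , colMove l (trans (up-far r X ar as) ta) (trans (up-high r X) (cong₂ _∨_ er fb)) md'
        (trans (up-far r Y ar as) fa) (trans (up-high r Y) (cong₂ _∨_ er' tb)) rs'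
    where
    er' : Y r ≡ false
    er' = trans (rs r (ar ∘ sym) (λ ())) er
    rs' : ∀ x → x ≢ a → x ≢ b → up r Y x ≡ up r X x
    rs' x p q with near r x
    ... | low refl = trans (up-low r Y) (trans (cong₂ _∧_ er' tb) (sym (trans (up-low r X) (cong₂ _∧_ er fb))))
    ... | high refl = ⊥-elim (q refl)
    ... | far u v = trans (up-far r Y u v) (trans (rs x p q) (sym (up-far r X u v)))
    md' : ∀ j → b < j → j < a → up r X j ≡ true
    md' j p q with near r j
    ... | low refl = ⊥-elim (1+n≰n (<⇒≤ p))
    ... | high refl = ⊥-elim (<-irrefl refl p)
    ... | far u v = trans (up-far r X u v) (md j p q)
  ...   | inj₁ er = r , colMove (<⇒≤ l) (trans (up-far r X ar as) ta) (trans (up-low r X) (cong₂ _∧_ er fb)) md'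
        (trans (up-far r Y ar as) fa) (trans (up-low r Y) (cong₂ _∧_ er' tb)) rs'
    where
    er' : Y r ≡ true
    er' = trans (rs r (ar ∘ sym) (λ ())) er
    rs' : ∀ x → x ≢ a → x ≢ r → up r Y x ≡ up r X x
    rs' x p q with near r x
    ... | low refl = ⊥-elim (q refl)
    ... | high refl = trans (up-high r Y) (trans (cong₂ _∨_ er' tb) (sym (trans (up-high r X) (cong₂ _∨_ er fb))))
    ... | far u v = trans (up-far r Y u v) (trans (rs x p v) (sym (up-far r X u v)))
    md' : ∀ j → r < j → j < a → up r X j ≡ true
    md' j p q with near r j
    ... | low refl = ⊥-elim (<-irrefl refl p)
    ... | high refl = trans (up-high r X) (cong₂ _∨_ er fb)
    ... | far u v = trans (up-far r X u v) (md j (≤∧≢⇒< p (v ∘ sym)) q)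

  module _ {m : ℕ} (r : ℕ) (lr : suc r < n) (D : Dg) (np : ∀ c → ¬ Plus r (D c)) (sD : Supp m D) where

    same-move : ∀ {a b b' c} t G H → c < m → a < n → t ≤ c ⊎ (c < t × ColMove a b' (up r (G c)) (up r (H c))) →
      (∀ c' → c < c' → down r t G c' a ≡ false) → ColMove a b (G c) (H c) → (∀ c' → c' ≢ c → H c' ≗ G c') →
      Move m (down r t G) (down r t H)
    same-move {c = c} t G H lc la alt cl cm o = go alt
      where
      oth : ∀ c' → c' ≢ c → down r t H c' ≗ down r t G c'
      oth c' ne x with c' <ᵇ t
      ... | true = up-cong r (o c' ne) x
      ... | false = o c' ne x
      go : t ≤ c ⊎ (c < t × ColMove _ _ (up r (G c)) (up r (H c))) → Move m (down r t G) (down r t H)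
      go (inj₁ l) = move lc la cl
        (colMove-cong (λ x → sym (down-out r t G c l x)) (λ x → sym (down-out r t H c l x)) cm) oth
      go (inj₂ (l , cm')) = move lc la cl
        (colMove-cong (λ x → sym (down-in r t G c l x)) (λ x → sym (down-in r t H c l x)) cm') oth

    -- Induction on the path to `G`, for all `t` together: when the last move starts in row `r` or
    -- `suc r` left of `t`, lowering and moving do not commute, and the hypothesis is needed with
    -- another bound. The base case is where `D` must have no plus column.
    down-closed : ∀ {G} → Reach m D G → ∀ t → Reach m D (down r t G)
    down-closed {G} (here e) t = here (λ c x → trans (e c x) (sym (fix c x)))
      where
      fix : ∀ c → down r t G c ≗ G c
      fix c x with c <ᵇ t
      ... | false = refl
      ... | true = up-fix r (G c) (λ (p , q) → np c (trans (e c r) p , trans (e c (suc r)) q)) x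
    down-closed {H} (_▷_ {G} R (move {a} {b} {c} lc la cl cm o)) t with near r a | t ≤? c
    ... | far ar as | dec = down-closed R t ▷ same-move t G H lc la alt cl' cm o
      where
      cl' : ∀ c' → c < c' → down r t G c' a ≡ false
      cl' c' l with c' <ᵇ t
      ... | true = trans (up-far r (G c') ar as) (cl c' l)
      ... | false = cl c' l
      ucm = up-colMove r ar as cm
      alt : t ≤ c ⊎ (c < t × ColMove a (proj₁ ucm) (up r (G c)) (up r (H c)))
      alt with t ≤? c
      ... | yes l = inj₁ l
      ... | no l = inj₂ (≰⇒> l , proj₂ ucm)
    ... | low refl | yes l = down-closed R t ▷ same-move {b' = b} t G H lc la (inj₁ l)
            (λ c' l' → trans (down-out r t G c' (≤-trans l (<⇒≤ l')) r) (cl c' l')) cm o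
    ... | high refl | yes l = down-closed R t ▷ same-move {b' = b} t G H lc la (inj₁ l)
            (λ c' l' → trans (down-out r t G c' (≤-trans l (<⇒≤ l')) (suc r)) (cl c' l')) cm o
    ... | low refl | no l with bool? (G c (suc r))
    ...   | inj₁ es = down-closed R t ▷ same-move t G H lc la (inj₂ (≰⇒> l , cm')) cl' cm o
      where
      open ColMove cm
      cl' : ∀ c' → c < c' → down r t G c' r ≡ false
      cl' c' l with c' <ᵇ t
      ... | true = trans (up-low r (G c')) (cong (_∧ G c' (suc r)) (cl c' l))
      ... | false = cl c' l
      s≢ : suc r ≢ r
      s≢ ()
      es' : H c (suc r) ≡ true
      es' = trans (rest (suc r) s≢ (>⇒≢ (m<n⇒m<1+n b<a))) es
      cm' : ColMove r b (up r (G c)) (up r (H c))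
      cm' = colMove-cong (λ x → sym (up-fix r (G c) (λ (_ , f) → bool-absurd es f) x))
                         (λ x → sym (up-fix r (H c) (λ (_ , f) → bool-absurd es' f) x)) cm
    -- The cell leaving row `r` is alone, so column `c` of `H` needs no lowering, and columns to its
    -- right have no cell in row `r`. Lowering before column `c` is therefore all that is left of
    -- the bound `t`.
    ...   | inj₂ es = down-closed R c ▷ move lc la (λ c' l' → trans (down-out r c G c' (<⇒≤ l') r) (cl c' l'))
              (colMove-cong (λ x → sym (down-out r c G c ≤-refl x))
                (λ x → sym (trans (down-in r t H c (≰⇒> l) x) (up-fix r (H c) (λ (p , _) → bool-absurd p to-a) x))) cm)
              oth
      where
      open ColMove cm
      oth : ∀ c' → c' ≢ c → down r t H c' ≗ down r c G c'
      oth c' ne x with c' <? c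
      ... | yes l' = trans (down-in r t H c' (<-trans l' (≰⇒> l)) x)
                      (trans (up-cong r (o c' ne) x) (sym (down-in r c G c' l' x)))
      ... | no l' = trans stay (trans (o c' ne x) (sym (down-out r c G c' (≮⇒≥ l') x)))
        where
        stay : down r t H c' x ≡ H c' x
        stay with c' <ᵇ t
        ... | false = refl
        ... | true = up-fix r (H c') (λ (p , _) →
                bool-absurd (trans (sym (o c' ne r)) p) (cl c' (≤∧≢⇒< (≮⇒≥ l') (ne ∘ sym)))) x
    down-closed {H} (_▷_ {G} R (move {a} {b} {c} lc la cl cm o)) t | high refl | no l with b ≟ r
    -- The move goes from `suc r` to `r`, and lowering takes it back.
    ... | yes refl = reach-cong same (down-closed R t)
      where
      open ColMove cm
      ct : c < t
      ct = ≰⇒> l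
      eq : up r (G c) ≗ up r (H c)
      eq x with near r x
      ... | low refl = trans (up-low r (G c)) (trans (cong₂ _∧_ at-b at-a)
              (sym (trans (up-low r (H c)) (cong₂ _∧_ to-b to-a))))
      ... | high refl = trans (up-high r (G c)) (trans (cong₂ _∨_ at-b at-a)
              (sym (trans (up-high r (H c)) (cong₂ _∨_ to-b to-a))))
      ... | far p q = trans (up-far r (G c) p q) (trans (sym (rest x q p)) (sym (up-far r (H c) p q)))
      same : ∀ c' → down r t G c' ≗ down r t H c'
      same c' x with c' ≟ c
      ... | yes refl = trans (down-in r t G c ct x) (trans (eq x) (sym (down-in r t H c ct x)))
      ... | no ne with c' <ᵇ t
      ...   | true = up-cong r (λ y → sym (o c' ne y)) x
      ...   | false = sym (o c' ne x)
    -- Here column c has both cells, of which the lower one jumps above the upper one. Instead all single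
    -- cells of row r go down first, then the cell in row r moves, and a sweep restores the columns from t on.
    ... | no b≢ = reach-trans (down-closed R m ▷ move {c = c} lc (<⇒≤ la) cl' cm' Hoff)
                    (sweep r lr K nm (m ∸ t₀) t₀ (down r t H) (m+[n∸m]≡n (m⊓n≤n t m)) cond hi lo)
      where
      open ColMove cm
      -- `t` may exceed the number of columns, whereas `sweep` has to start within them.
      t₀ = t ⊓ m
      ct : c < t
      ct = ≰⇒> l
      br : b < r
      br = ≤∧≢⇒< (≤-pred b<a) b≢
      sG : Supp m G
      sG = reach-supp sD R
      Gr : G c r ≡ true
      Gr = mid r br ≤-refl
      Hr : H c r ≡ true
      Hr = trans (rest r (λ ()) (>⇒≢ br)) Gr
      K : Dg
      K c' = if c' ≡ᵇ c then up r (H c) else down r m G c'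
      K-c : K c ≗ up r (H c)
      K-c x rewrite ≡ᵇ-refl c = refl
      Hoff : ∀ c' → c' ≢ c → K c' ≗ down r m G c'
      Hoff c' ne x rewrite ≢⇒≡ᵇ c' c ne = refl
      cl' : ∀ c' → c < c' → down r m G c' r ≡ false
      cl' c' l' with c' <? m
      ... | yes l'' = trans (down-in r m G c' l'' r) (trans (up-low r (G c'))
              (trans (cong (G c' r ∧_) (cl c' l')) (Bool.∧-zeroʳ (G c' r))))
      ... | no l'' = trans (down-out r m G c' (≮⇒≥ l'') r) (sG c' r (≮⇒≥ l''))
      both : down r m G c ≗ G c
      both x = trans (down-in r m G c lc x) (up-fix r (G c) (λ (_ , f) → bool-absurd at-a f) x)
      cm' : ColMove r b (down r m G c) (K c)
      cm' = colMove br (trans (both r) Gr) (trans (both b) at-b)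
        (λ j p q → trans (both j) (mid j p (m<n⇒m<1+n q)))
        (trans (K-c r) (trans (up-low r (H c)) (cong₂ _∧_ Hr to-a)))
        (trans (K-c b) (trans (up-far r (H c) b≢ (<⇒≢ b<a)) to-b)) rest'
        where
        rest' : ∀ x → x ≢ r → x ≢ b → K c x ≡ down r m G c x
        rest' x p q with near r x
        ... | low refl = ⊥-elim (p refl)
        ... | high refl = trans (K-c x) (trans (up-high r (H c)) (trans (cong (_∨ H c (suc r)) Hr) (sym (trans (both x) at-a))))
        ... | far u v = trans (K-c x) (trans (up-far r (H c) u v) (trans (rest x v q) (sym (both x))))
      right : ∀ c' → t₀ ≤ c' → c < c'
      right c' l' = <-≤-trans (⊓-pres-m< ct lc) l'
      out : ∀ c' → m ≤ c' → K c' ≗ G c'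
      out c' l' x = trans (Hoff c' (>⇒≢ (<-≤-trans lc l')) x) (down-out r m G c' l' x)
      nm : ∀ c' → m ≤ c' → ¬ Minus r (K c')
      nm c' l' (_ , q) = bool-absurd (trans (sym (out c' l' (suc r))) q) (sG c' (suc r) l')
      cond : ∀ c₁ c' → t₀ ≤ c₁ → c₁ < c' → Minus r (K c₁) → K c' r ∧ K c' (suc r) ≡ false
      cond c₁ c' l₁ l₂ _ = cong (_∧ K c' (suc r))
        (trans (Hoff c' (>⇒≢ (<-trans (right c₁ l₁) l₂)) r) (cl' c' (<-trans (right c₁ l₁) l₂)))
      noM : ∀ c' → c < c' → dn r (G c') ≗ G c'
      noM c' l' = dn-fix r (G c') (λ (_ , q) → bool-absurd q (cl c' l'))
      hi : ∀ c' → t₀ ≤ c' → down r t H c' ≗ dn r (K c')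
      hi c' l' x with c' <? m
      ... | yes l'' = trans (down-out r t H c' tc x) (trans (o c' ne x) (sym (trans
              (dn-cong r (λ y → trans (Hoff c' ne y) (down-in r m G c' l'' y)) x)
              (trans (dn-up r (G c') x) (noM c' (right c' l') x)))))
        where
        ne : c' ≢ c
        ne = >⇒≢ (right c' l')
        tc : t ≤ c'
        tc with ≤-total t m
        ... | inj₁ k = subst (_≤ c') (m≤n⇒m⊓n≡m k) l'
        ... | inj₂ k = ⊥-elim (<⇒≱ l'' (subst (_≤ c') (m≥n⇒m⊓n≡n k) l'))
      ... | no l'' = trans stay (trans (o c' ne x) (sym (trans (dn-cong r (out c' (≮⇒≥ l'')) x) (noM c' (right c' l') x))))
        where
        ne : c' ≢ c
        ne = >⇒≢ (right c' l')
        stay : down r t H c' x ≡ H c' x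
        stay with c' <ᵇ t
        ... | false = refl
        ... | true = up-fix r (H c') (λ (p , _) → bool-absurd (trans (sym (o c' ne r)) p) (sG c' r (≮⇒≥ l''))) x
      lo : ∀ c' → c' < t₀ → down r t H c' ≗ K c'
      lo c' l' x with c' ≟ c
      ... | yes refl = trans (down-in r t H c ct x) (sym (K-c x))
      ... | no ne = trans (down-in r t H c' (m<n⊓o⇒m<n t m l') x) (trans (up-cong r (o c' ne) x)
              (sym (trans (Hoff c' ne x) (down-in r m G c' (m<n⊓o⇒m<o t m l') x))))

-- Orthodontia, and Kohnert diagrams as defining chains

module Orthodontia (n : ℕ) where
  open Flags n
  open Moves n

  swap-low : ∀ i → swapVal i i ≡ suc i
  swap-low i rewrite ≡ᵇ-refl i = refl

  swap-high : ∀ i → swapVal i (suc i) ≡ i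
  swap-high i rewrite suc-≡ᵇ i | ≡ᵇ-refl i = refl

  swap-far : ∀ i {x} → x ≢ i → x ≢ suc i → swapVal i x ≡ x
  swap-far i {x} p q rewrite ≢⇒≡ᵇ x i p | ≢⇒≡ᵇ x (suc i) q = refl

  swap-swap : ∀ i x → swapVal i (swapVal i x) ≡ x
  swap-swap i x with near i x
  ... | low refl = trans (cong (swapVal i) (swap-low i)) (swap-high i)
  ... | high refl = trans (cong (swapVal i) (swap-high i)) (swap-low i)
  ... | far p q = trans (cong (swapVal i) (swap-far i p q)) (swap-far i p q)

  swap-<ᵇ : ∀ r y p → p ≢ suc r → (swapVal r y <ᵇ p) ≡ (y <ᵇ p)
  swap-<ᵇ r y p ne with near r y
  ... | far a b = cong (_<ᵇ p) (swap-far r a b)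
  ... | low refl = trans (cong (_<ᵇ p) (swap-low r)) (bool-iff
          (λ h → <ᵇ-true r p (<⇒≤ (<ᵇ-true⁻ (suc r) p h)))
          (λ h → <ᵇ-true (suc r) p (≤∧≢⇒< (<ᵇ-true⁻ r p h) (ne ∘ sym))))
  ... | high refl = trans (cong (_<ᵇ p) (swap-high r)) (bool-iff
          (λ h → <ᵇ-true (suc r) p (≤∧≢⇒< (<ᵇ-true⁻ r p h) (ne ∘ sym)))
          (λ h → <ᵇ-true r p (<⇒≤ (<ᵇ-true⁻ (suc r) p h))))

  bits-swap : ∀ r y → bit (swapVal r y <ᵇ suc r) + bit (y <ᵇ suc r) ≡ bit (y <ᵇ r) + bit (y <ᵇ suc (suc r))
  bits-swap r y with near r y
  ... | low refl rewrite swap-low r | <ᵇ-false (suc r) (suc r) ≤-refl | <ᵇ-true r (suc r) ≤-refl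
          | <ᵇ-true r (suc (suc r)) (n≤1+n _) = refl
  ... | high refl rewrite swap-high r | <ᵇ-true r (suc r) ≤-refl | <ᵇ-false (suc r) (suc r) ≤-refl
          | <ᵇ-false (suc r) r (n≤1+n r) = refl
  ... | far a b rewrite swap-far r a b with <-cmp y r
  ...   | tri≈ _ p _ = ⊥-elim (a p)
  ...   | tri< l _ _ rewrite <ᵇ-true y (suc r) (m<n⇒m<1+n l) | <ᵇ-true y r l
            | <ᵇ-true y (suc (suc r)) (m<n⇒m<1+n (m<n⇒m<1+n l)) = refl
  ...   | tri> _ _ l rewrite <ᵇ-false y (suc r) l | <ᵇ-false y r (<⇒≤ l)
            | <ᵇ-false y (suc (suc r)) (≤∧≢⇒< l (b ∘ sym)) = refl

  cnt-add : ∀ {A B C D} → (∀ x → bit (A x) + bit (B x) ≡ bit (C x) + bit (D x)) →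
    ∀ q → cnt A q + cnt B q ≡ cnt C q + cnt D q
  cnt-add h zero = refl
  cnt-add {A} {B} {C} {D} h (suc q) = begin
    (bit (A q) + cnt A q) + (bit (B q) + cnt B q) ≡⟨ swp (bit (A q)) _ _ _ ⟩
    (bit (A q) + bit (B q)) + (cnt A q + cnt B q) ≡⟨ cong₂ _+_ (h q) (cnt-add h q) ⟩
    (bit (C q) + bit (D q)) + (cnt C q + cnt D q) ≡⟨ swp (bit (C q)) _ _ _ ⟨
    (bit (C q) + cnt C q) + (bit (D q) + cnt D q) ∎
    where
    open ≡-Reasoning
    swp : ∀ a b c d → (a + b) + (c + d) ≡ (a + c) + (b + d)
    swp a b c d = trans (+-assoc a b (c + d)) (trans (cong (a +_)
      (trans (sym (+-assoc b c d)) (trans (cong (_+ d) (+-comm b c)) (+-assoc c b d)))) (sym (+-assoc a c (b + d))))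

  -- Bijectivity of `γ` on the rows below `n`, in the form that `card` asks for.
  Levels : (ℕ → ℕ) → Set
  Levels γ = ∀ p → p ≤ n → cnt (λ x → γ x <ᵇ p) n ≡ p

  -- γ is the inverse of the permutation whose flag this is.
  gflag : (γ : ℕ → ℕ) → Levels γ → Flag
  gflag γ l = flag (λ p x → γ x <ᵇ p) (λ p x h → <ᵇ-true (γ x) (suc p) (m<n⇒m<1+n (<ᵇ-true⁻ (γ x) p h))) l

  cnt-initial : ∀ p q → q ≤ p → cnt (λ x → x <ᵇ p) q ≡ q
  cnt-initial p zero l = refl
  cnt-initial p (suc q) l rewrite <ᵇ-true q p l = cong suc (cnt-initial p q (<⇒≤ l))

  cnt-initial-past : ∀ p q → p ≤ q → cnt (λ x → x <ᵇ p) q ≡ p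
  cnt-initial-past p zero z≤n = refl
  cnt-initial-past p (suc q) l with m≤n⇒m<n∨m≡n l
  ... | inj₂ refl = cnt-initial (suc q) (suc q) ≤-refl
  ... | inj₁ (s≤s l') rewrite <ᵇ-false q p l' = cnt-initial-past p q l'

  id-levels : Levels id
  id-levels p l = cnt-initial-past p n l

  swap-levels : ∀ r → suc r < n → ∀ γ → Levels γ → Levels (swapVal r ∘ γ)
  swap-levels r lr γ h p l with p ≟ suc r
  ... | no ne = trans (cnt-cong (λ x → swap-<ᵇ r (γ x) p ne) n) (h p l)
  ... | yes refl = +-cancelʳ-≡ (suc r) _ (suc r) (begin
    cnt (λ x → swapVal r (γ x) <ᵇ suc r) n + suc r
      ≡⟨ cong (cnt (λ x → swapVal r (γ x) <ᵇ suc r) n +_) (h (suc r) (<⇒≤ lr)) ⟨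
    cnt (λ x → swapVal r (γ x) <ᵇ suc r) n + cnt (λ x → γ x <ᵇ suc r) n
      ≡⟨ cnt-add (λ x → bits-swap r (γ x)) n ⟩
    cnt (λ x → γ x <ᵇ r) n + cnt (λ x → γ x <ᵇ suc (suc r)) n
      ≡⟨ cong₂ _+_ (h r (≤-trans (n≤1+n r) (<⇒≤ lr))) (h (suc (suc r)) lr) ⟩
    r + suc (suc r) ≡⟨ +-suc r (suc r) ⟩
    suc r + suc r ∎)
    where open ≡-Reasoning

  idF : Flag
  idF = gflag id id-levels

  sw : ℕ → Dg → Dg
  sw r D c x = D c (swapVal r x)

  -- Orthodontia: a northwest diagram is built from the empty one by adding initial-segment
  -- columns on the left and moving rows down into empty rows.
  data Orth : ℕ → Dg → Set where
    nil   : ∀ {D} → Orth 0 D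
    strip : ∀ {m D} h → h ≤ n → D 0 ≗ (_<ᵇ h) → Orth m (D ∘ suc) → Orth (suc m) D
    swap  : ∀ {m D} r → suc r < n → (∀ c → D c r ≡ false) → Orth m (sw r D) → Orth m D

  except : ℕ → ℕ → Bool
  except p q = not (p ≡ᵇ q)

  except-≢ : ∀ p q → except p q ≡ true → q ≢ p
  except-≢ p q h refl rewrite ≡ᵇ-refl p = bool-absurd h refl

  -- A step v ≤ w at all levels other than r + 1 amounts to v ≤ w * s_r for the Demazure product.
  prog : ∀ {m D} → Orth m D → Prog
  prog nil = nil
  prog (strip h _ _ o) = col everywhere h (prog o)
  prog (swap r _ _ o) = rel (except (suc r)) (prog o)

  prog-width : ∀ {m D} (o : Orth m D) → width (prog o) ≡ m
  prog-width nil = refl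
  prog-width (strip h _ _ o) = cong suc (prog-width o)
  prog-width (swap r _ _ o) = prog-width o

  -- The chain is constant along columns and changes by `swapVal r` at each row exchange, which is
  -- invisible at the levels other than `suc r`. All `γ` are needed, since these exchanges
  -- accumulate.
  contains : ∀ {m D} (o : Orth m D) γ (l : Levels γ) → S (gflag γ l) (prog o) (λ c x → D c (γ x))
  contains nil γ l = tt
  contains (strip h _ e o) γ l = gflag γ l , (λ p _ q → ≤-refl) , (λ x → e (γ x)) , contains o γ l
  contains {m} {D} (swap r lr e o) γ l = gflag γ' l' ,
    (λ p h → ≗⇒≼ (λ x → swap-<ᵇ r (γ x) p (except-≢ (suc r) p h))) ,
    S-cong (gflag γ' l') (prog o) (λ c _ x → cong (D c) (swap-swap r (γ x))) (contains o γ' l')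
    where
    γ' = swapVal r ∘ γ
    l' = swap-levels r lr γ l

  S-reach : ∀ {m D} (o : Orth m D) w {G H} → S w (prog o) G → Reach m G H → S w (prog o) H
  S-reach o w s (here e) = S-cong w (prog o) (λ c _ → e c) s
  S-reach o w s (R ▷ move {a} {b} {c} lc la cl (colMove l ta fb md fa tb rs) oth) =
    S-move a la w (prog o) _ _ c b (S-reach o w s R) (subst (c <_) (sym (prog-width o)) lc) l ta fb md
      (λ c' _ → cl c') fa tb rs oth

  first-plus : ∀ r (Z : Dg) m → Σ ℕ λ t → t ≤ m × (∀ c → c < t → ¬ Plus r (Z c)) × (t ≡ m ⊎ Plus r (Z t))
  first-plus r Z zero = 0 , z≤n , (λ c ()) , inj₁ refl
  first-plus r Z (suc m) with first-plus r Z m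
  ... | t , l , np , inj₂ pl = t , m≤n⇒m≤1+n l , np , inj₂ pl
  ... | t , l , np , inj₁ refl with plus? r (Z t)
  ...   | yes pl = t , n≤1+n t , np , inj₂ pl
  ...   | no npl = suc t , ≤-refl , np' , inj₁ refl
    where
    np' : ∀ c → c < suc t → ¬ Plus r (Z c)
    np' c (s≤s k) with m≤n⇒m<n∨m≡n k
    ... | inj₁ k' = np c k'
    ... | inj₂ refl = npl

  Rows : Dg → Set
  Rows T = ∀ c x → n ≤ x → T c x ≡ false

  consD : ISet → Dg → Dg
  consD X G zero = X
  consD X G (suc c) = G c

  reach-cons : ∀ {m} X {G H} → Reach m G H → Reach (suc m) (consD X G) (consD X H)
  reach-cons X (here e) = here (λ { zero x → refl ; (suc c) → e c })
  reach-cons X (R ▷ move lc la cl cm o) = reach-cons X R ▷ move (s≤s lc) la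
    (λ { (suc c') (s≤s l) → cl c' l }) cm (λ { zero ne x → refl ; (suc c') ne → o c' (ne ∘ cong suc) })

  below-id : ∀ (v : Flag) h → h ≤ n → lv v h ≼ (_<ᵇ h) → ∀ x → x < n → lv v h x ≡ (x <ᵇ h)
  below-id v h lh o x lx with x <? h
  ... | yes l = trans (cnt-full (lv v h) h (≤-trans (≤-reflexive (sym (cnt-initial h h ≤-refl))) (o h)) x l)
                  (sym (<ᵇ-true x h l))
  ... | no l = trans (cnt-stop (lv v h) lh (≤-trans (≤-reflexive (card v h lh))
                    (≤-trans (≤-reflexive (sym (cnt-initial h h ≤-refl))) (o h))) x (≮⇒≥ l) lx)
                  (sym (<ᵇ-false x h (≮⇒≥ l)))

  -- The levels `r` and `suc (suc r)` of `v` are forced to be initial segments, so level `suc r`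
  -- adds either `r` or `suc r` to the first `r` rows. In the second case `dn r` corrects it.
  dn-below-id : ∀ r (lr : suc r < n) v → v ≤[ except (suc r) ] idF → dnF r lr v ≤F idF
  dn-below-id r lr v o p q with p ≟ suc r
  ... | no ne = ≼-trans {dn r (lv v p)} {lv v p} {_<ᵇ p} (dn-dec r (lv v p))
          (o p (cong not (≢⇒≡ᵇ (suc r) p (ne ∘ sym)))) q
  ... | yes refl with q ≤? r
  ...   | yes l = ≤-trans (cnt-≤ _ q) (≤-trans (≤-reflexive (sym (cnt-initial r q l)))
            (≤-trans (o r (cong not (≢⇒≡ᵇ (suc r) r (λ ()))) q) (≤-trans (cnt-⊑ (mono v r) q) (dn-dec r (lv v (suc r)) q))))
  ...   | no g = ≤-trans (cnt-none _ (suc r) q (λ x l _ → <ᵇ-false x (suc r) l)) (≤-trans big (cnt-mono (dn r (lv v (suc r))) (≰⇒> g)))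
    where
    V = lv v (suc r)
    r∙ : cnt V r ≡ r
    r∙ = ≤-antisym (cnt-≤ V r) (≤-trans (≤-reflexive (sym (cnt-initial r r ≤-refl)))
           (≤-trans (o r (cong not (≢⇒≡ᵇ (suc r) r (λ ()))) r) (cnt-⊑ (mono v r) r)))
    o2 : lv v (suc (suc r)) ≼ (_<ᵇ suc (suc r))
    o2 = o (suc (suc r)) (cong not (≢⇒≡ᵇ (suc r) (suc (suc r)) (λ ())))
    none : ∀ x → suc (suc r) ≤ x → x < n → V x ≡ false
    none x l₁ l₂ with bool? (V x)
    ... | inj₂ f = f
    ... | inj₁ t = ⊥-elim (bool-absurd (mono v (suc r) x t)
            (trans (below-id v (suc (suc r)) lr o2 x l₂) (<ᵇ-false x (suc (suc r)) l₁)))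
    two : cnt V (suc (suc r)) ≡ suc r
    two = trans (sym (cnt-flat V lr none)) (card v (suc r) (<⇒≤ lr))
    big : suc r ≤ cnt (dn r V) (suc r)
    big = ≤-trans (aux (V r) (V (suc r)) (subst (λ k → bit (V (suc r)) + (bit (V r) + k) ≡ suc r) r∙ two))
            (≤-reflexive (sym (trans (cnt-dn-mid r V) (cong (bit (V r ∨ V (suc r)) +_) r∙))))
      where
      aux : ∀ a b → bit b + (bit a + r) ≡ suc r → suc r ≤ bit (a ∨ b) + r
      aux true b e = ≤-refl
      aux false true e = ≤-refl
      aux false false e = ⊥-elim (1+n≰n (≤-reflexive (sym e)))

  -- At a row exchange, `Z` is raised in all columns before its first plus column. By `raise` the
  -- result `T` lies under the identity, so it is reachable from the exchanged diagram, which in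
  -- turn is reachable from `D`. As none of the raised columns is plus in `Z`, lowering them gives
  -- `Z` back, and `down-closed` applies because row `r` of `D` is empty.
  S⇒Reach : ∀ {m D} (o : Orth m D) → Supp m D → ∀ T → Supp m T → Rows T → S idF (prog o) T → Reach m D T
  S⇒Reach nil sD T sT rT s = here (λ c x → trans (sD c x z≤n) (sym (sT c x z≤n)))
  S⇒Reach {suc m} {D} (strip h lh e o) sD T sT rT (v , ov , e₀ , s) =
    reach-cong (λ { zero x → trans (e x) (sym (T₀ x)) ; (suc c) x → refl })
      (reach-trans (here (λ { zero x → refl ; (suc c) x → refl }))
        (reach-cons (D 0) (S⇒Reach o (λ c x l → sD (suc c) x (s≤s l)) (T ∘ suc) (λ c x l → sT (suc c) x (s≤s l))
          (λ c → rT (suc c)) (S-mono {v} {idF} (λ p → ov p refl) (prog o) (T ∘ suc) s))))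
    where
    T₀ : T 0 ≗ (_<ᵇ h)
    T₀ x with x <? n
    ... | yes l = trans (e₀ x) (below-id v h lh (ov h refl) x l)
    ... | no l = trans (rT 0 x (≮⇒≥ l)) (sym (<ᵇ-false x h (≤-trans lh (≮⇒≥ l))))
  S⇒Reach {m} {D} (swap r lr emp o) sD Z sZ rZ (v , ov , s) with first-plus r Z m
  ... | t , tm , np , stop = reach-cong back (down-closed r lr D (λ c (p , _) → bool-absurd p (emp c)) sD R t)
    where
    T : Dg
    T c = if c <ᵇ t then dn r (Z c) else Z c
    T-in : ∀ c → c < t → T c ≗ dn r (Z c)
    T-in c l x rewrite <ᵇ-true c t l = refl
    T-out : ∀ c → t ≤ c → T c ≗ Z c
    T-out c l x rewrite <ᵇ-false c t l = refl
    sT : Supp m T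
    sT c x l = trans (T-out c (≤-trans tm l) x) (sZ c x l)
    rT : Rows T
    rT c x l with c <? t
    ... | yes l' = trans (T-in c l' x) (trans (dn-far r (Z c) (>⇒≢ (<-trans ≤-refl (<-≤-trans lr l))) (>⇒≢ (<-≤-trans lr l))) (rZ c x l))
    ... | no l' = trans (T-out c (≮⇒≥ l') x) (rZ c x l)
    sT' : S idF (prog o) T
    sT' = S-mono {dnF r lr v} {idF} (dn-below-id r lr v ov) (prog o) T
            (raise r lr v (prog o) Z T s
              (λ c lc k → T-in c (lt c (subst (c <_) (prog-width o) lc) k))
              (λ c c₁ lc l pl → T-out c (≮⇒≥ (λ l' → np c₁ (≤-<-trans l l') pl))))
      where
      lt : ∀ c → c < m → (∀ c₁ → c₁ ≤ c → ¬ Plus r (Z c₁)) → c < t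
      lt c lc k with c <? t
      ... | yes l = l
      ... | no l = [ (λ e → subst (c <_) (sym e) lc) , (λ pl → ⊥-elim (k t (≮⇒≥ l) pl)) ]′ stop
    X : Dg
    X = sw r D
    sX : Supp m X
    sX c x l = sD c (swapVal r x) l
    -- With row `r` empty, the whole of row `suc r` can be swept into it, which is the exchange of
    -- the two rows.
    DX : Reach m D X
    DX = sweep r lr D (λ c l (_ , q) → bool-absurd q (sD c (suc r) l)) m 0 X refl
           (λ c c' _ _ _ → cong (_∧ D c' (suc r)) (emp c')) (λ c _ → eq c) (λ c ())
      where
      eq : ∀ c → X c ≗ dn r (D c)
      eq c x with near r x
      ... | low refl = trans (cong (D c) (swap-low r)) (sym (trans (dn-low r (D c)) (cong (_∨ D c (suc r)) (emp c))))
      ... | high refl = trans (cong (D c) (swap-high r)) (trans (emp c) (sym (trans (dn-high r (D c)) (cong (_∧ D c (suc r)) (emp c)))))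
      ... | far p q = trans (cong (D c) (swap-far r p q)) (sym (dn-far r (D c) p q))
    R : Reach m D T
    R = reach-trans DX (S⇒Reach o sX T sT rT sT')
    back : ∀ c → down r t T c ≗ Z c
    back c x with c <? t
    ... | yes l = trans (down-in r t T c l x) (trans (up-cong r (T-in c l) x)
                    (trans (up-dn r (Z c) x) (up-fix r (Z c) (np c l) x)))
    ... | no l = trans (down-out r t T c (≮⇒≥ l) x) (T-out c (≮⇒≥ l) x)

  NWf : Dg → Set
  NWf D = ∀ i j k l → i < j → k < l → D k j ≡ true → D l i ≡ true → D k i ≡ true

  swap-< : ∀ r i j → i < j → swapVal r i < swapVal r j ⊎ (i ≡ r × j ≡ suc r)
  swap-< r i j l with near r i | near r j
  ... | low refl | low refl = ⊥-elim (<-irrefl refl l)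
  ... | low refl | high refl = inj₂ (refl , refl)
  ... | low refl | far p q = inj₁ (subst₂ _<_ (sym (swap-low r)) (sym (swap-far r p q)) (≤∧≢⇒< l (q ∘ sym)))
  ... | high refl | low refl = ⊥-elim (1+n≰n (<⇒≤ l))
  ... | high refl | high refl = ⊥-elim (<-irrefl refl l)
  ... | high refl | far p q = inj₁ (subst₂ _<_ (sym (swap-high r)) (sym (swap-far r p q)) (<⇒≤ l))
  ... | far p q | low refl = inj₁ (subst₂ _<_ (sym (swap-far r p q)) (sym (swap-low r)) (m<n⇒m<1+n l))
  ... | far p q | high refl = inj₁ (subst₂ _<_ (sym (swap-far r p q)) (sym (swap-high r)) (≤∧≢⇒< (≤-pred l) p))
  ... | far p q | far p' q' = inj₁ (subst₂ _<_ (sym (swap-far r p q)) (sym (swap-far r p' q')) l)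

  -- The exchange keeps the order of every pair of rows except `r` and `suc r`, and for this pair
  -- the inclusion of the rows supplies the corner cell.
  NWf-swap : ∀ r D → NWf D → (∀ c → D c r ≡ true → D c (suc r) ≡ true) → NWf (sw r D)
  NWf-swap r D nw sub i j k l ij kl a b with swap-< r i j ij
  ... | inj₁ lt = nw _ _ k l lt kl a b
  ... | inj₂ (refl , refl) = trans (cong (D k) (swap-low r)) (sub k (trans (cong (D k) (sym (swap-high r))) a))

  scan-initial : ∀ X q → (Σ ℕ λ r → suc r < q × Minus r X) ⊎ (Σ ℕ λ h → h ≤ q × (∀ x → x < q → X x ≡ (x <ᵇ h)))
  scan-initial X zero = inj₂ (0 , z≤n , λ x ())
  scan-initial X (suc q) with scan-initial X q
  ... | inj₁ (r , l , mi) = inj₁ (r , m<n⇒m<1+n l , mi)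
  ... | inj₂ (h , l , e) with bool? (X q)
  ...   | inj₂ f = inj₂ (h , m≤n⇒m≤1+n l , e')
    where
    e' : ∀ x → x < suc q → X x ≡ (x <ᵇ h)
    e' x (s≤s k) with m≤n⇒m<n∨m≡n k
    ... | inj₁ k' = e x k'
    ... | inj₂ refl = trans f (sym (<ᵇ-false q h l))
  ...   | inj₁ t with m≤n⇒m<n∨m≡n l
  ...     | inj₂ refl = inj₂ (suc q , ≤-refl , e')
    where
    e' : ∀ x → x < suc q → X x ≡ (x <ᵇ suc q)
    e' x (s≤s k) with m≤n⇒m<n∨m≡n k
    ... | inj₁ k' = trans (e x k') (trans (<ᵇ-true x q k') (sym (<ᵇ-true x (suc q) (s≤s k))))
    ... | inj₂ refl = trans t (sym (<ᵇ-true q (suc q) ≤-refl))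
  ...     | inj₁ (s≤s {n = q'} k) = inj₁ (q' , ≤-refl , trans (e q' ≤-refl) (<ᵇ-false q' h k) , t)

  -- The sum of the elements. For the first column it drops with every exchange of rows, which makes
  -- orthodontia terminate.
  wsum : ISet → ℕ → ℕ
  wsum X zero = 0
  wsum X (suc q) = (if X q then q else 0) + wsum X q

  wsum-cong : ∀ {X Y} q → (∀ x → x < q → X x ≡ Y x) → wsum X q ≡ wsum Y q
  wsum-cong zero h = refl
  wsum-cong (suc q) h = cong₂ _+_ (cong (λ b → if b then q else 0) (h q ≤-refl)) (wsum-cong q (λ x l → h x (m<n⇒m<1+n l)))

  wsum-swap : ∀ r X q → suc r < q → Minus r X → wsum (X ∘ swapVal r) q < wsum X q
  wsum-swap r X (suc q) l (f , t) with m≤n⇒m<n∨m≡n (≤-pred l)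
  ... | inj₂ refl rewrite swap-high r | swap-low r | f | t =
          s≤s (+-monoʳ-≤ r (≤-reflexive (wsum-cong r (λ x l' → cong X (swap-far r (<⇒≢ l') (low≢ l'))))))
  ... | inj₁ l' rewrite swap-far r {q} (>⇒≢ (<⇒≤ l')) (>⇒≢ l') =
          +-monoʳ-< (if X q then q else 0) (wsum-swap r X q l' (f , t))

  -- If the first column has a gap in row `r` directly above a cell, then row `r` is entirely empty:
  -- a cell further right in it would, by the northwest property, fill the gap. So rows are
  -- exchanged until the first column is an initial segment, which is then stripped.
  orth : ∀ m D → NWf D → Rows D → Orth m D
  orth zero D nw rw = nil
  orth (suc m) D nw rw = go (wsum (D 0) n) D ≤-refl nw rw
    where
    go : ∀ N D → wsum (D 0) n ≤ N → NWf D → Rows D → Orth (suc m) D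
    go N D lN nw rw with scan-initial (D 0) n
    ... | inj₂ (h , lh , e) = strip h lh e' (orth m (D ∘ suc) (λ i j k l ij kl → nw i j (suc k) (suc l) ij (s≤s kl)) (λ c → rw (suc c)))
      where
      e' : D 0 ≗ (_<ᵇ h)
      e' x with x <? n
      ... | yes l = e x l
      ... | no l = trans (rw 0 x (≮⇒≥ l)) (sym (<ᵇ-false x h (≤-trans lh (≮⇒≥ l))))
    go N D lN nw rw | inj₁ (r , lr , mi) = use N (<-≤-trans (wsum-swap r (D 0) n lr mi) lN)
      where
      emp : ∀ c → D c r ≡ false
      emp zero = proj₁ mi
      emp (suc c) with bool? (D (suc c) r)
      ... | inj₂ f = f
      ... | inj₁ t = ⊥-elim (bool-absurd (nw r (suc r) 0 (suc c) ≤-refl (s≤s z≤n) (proj₂ mi) t) (proj₁ mi))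
      rw' : Rows (sw r D)
      rw' c x l = trans (cong (D c) (swap-far r (>⇒≢ (<-trans ≤-refl (<-≤-trans lr l))) (>⇒≢ (<-≤-trans lr l)))) (rw c x l)
      use : ∀ N → wsum (sw r D 0) n < N → Orth (suc m) D
      use (suc N) (s≤s l) = swap r lr emp (go N (sw r D) l (NWf-swap r D nw (λ c t → bool-absurd t (emp c))) rw')

-- Kohnert diagrams

atV-out : ∀ {A : Set} {k} (d : A) (xs : Vec A k) j → k ≤ j → atV d xs j ≡ d
atV-out d [] j l = refl
atV-out d (x ∷ xs) (suc j) (s≤s l) = atV-out d xs j l

atV-ext : ∀ {A : Set} {k} (d : A) (xs ys : Vec A k) → (∀ j → j < k → atV d xs j ≡ atV d ys j) → xs ≡ ys
atV-ext d [] [] h = refl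
atV-ext d (x ∷ xs) (y ∷ ys) h = cong₂ _∷_ (h 0 (s≤s z≤n)) (atV-ext d xs ys (λ j l → h (suc j) (s≤s l)))

atV-upd : ∀ {A : Set} {k} (d : A) (xs : Vec A k) j f → j < k → atV d (updV xs j f) j ≡ f (atV d xs j)
atV-upd d (x ∷ xs) zero f l = refl
atV-upd d (x ∷ xs) (suc j) f (s≤s l) = atV-upd d xs j f l

atV-upd-≢ : ∀ {A : Set} {k} (d : A) (xs : Vec A k) j f i → i ≢ j → atV d (updV xs j f) i ≡ atV d xs i
atV-upd-≢ d [] j f i ne = refl
atV-upd-≢ d (x ∷ xs) zero f zero ne = ⊥-elim (ne refl)
atV-upd-≢ d (x ∷ xs) zero f (suc i) ne = refl
atV-upd-≢ d (x ∷ xs) (suc j) f zero ne = refl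
atV-upd-≢ d (x ∷ xs) (suc j) f (suc i) ne = atV-upd-≢ d xs j f i (ne ∘ cong suc)

atV-tab : ∀ {A : Set} {k} (d : A) (g : ℕ → A) j → j < k → atV d (V.tabulate {n = k} (g ∘ toℕ)) j ≡ g j
atV-tab {k = suc k} d g zero l = refl
atV-tab {k = suc k} d g (suc j) (s≤s l) = atV-tab {k = k} d (g ∘ suc) j l

atV-replicate : ∀ {A : Set} k (d : A) j → atV d (V.replicate k d) j ≡ d
atV-replicate zero d j = refl
atV-replicate (suc k) d zero = refl
atV-replicate (suc k) d (suc j) = atV-replicate k d j

module _ {n m : ℕ} where
  open Flags n
  open Moves n
  open Orthodontia n

  columns : Diagram n m → Dg
  columns D c x = cell D x c

  columns-supp : ∀ (D : Diagram n m) → Supp m (columns D)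
  columns-supp D c x l = atV-out false (atV (V.replicate m false) D x) c l

  columns-rows : ∀ (D : Diagram n m) → Rows (columns D)
  columns-rows D c x l = trans (cong (λ r → atV false r c) (atV-out (V.replicate m false) D x l)) (atV-replicate m false c)

  cell-row< : ∀ (D : Diagram n m) x c → cell D x c ≡ true → x < n
  cell-row< D x c h with x <? n
  ... | yes l = l
  ... | no l = ⊥-elim (bool-absurd h (columns-rows D c x (≮⇒≥ l)))

  cell-col< : ∀ (D : Diagram n m) x c → cell D x c ≡ true → c < m
  cell-col< D x c h with c <? m
  ... | yes l = l
  ... | no l = ⊥-elim (bool-absurd h (columns-supp D c x (≮⇒≥ l)))

  columns-ext : ∀ (D D' : Diagram n m) → (∀ c → columns D c ≗ columns D' c) → D ≡ D'
  columns-ext D D' h = atV-ext (V.replicate m false) D D' (λ x _ → atV-ext false _ _ (λ c _ → h c x))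

  cell-set : ∀ (D : Diagram n m) i c b → i < n → c < m → cell (setCell D i c b) i c ≡ b
  cell-set D i c b li lc = trans (cong (λ r → atV false r c) (atV-upd (V.replicate m false) D i (λ row → updV row c (λ _ → b)) li))
    (atV-upd false (atV (V.replicate m false) D i) c (λ _ → b) lc)

  cell-set-row : ∀ (D : Diagram n m) i c b x y → x ≢ i → cell (setCell D i c b) x y ≡ cell D x y
  cell-set-row D i c b x y ne = cong (λ r → atV false r y) (atV-upd-≢ (V.replicate m false) D i (λ row → updV row c (λ _ → b)) x ne)

  cell-set-col : ∀ (D : Diagram n m) i c b x y → y ≢ c → cell (setCell D i c b) x y ≡ cell D x y
  cell-set-col D i c b x y ne with x ≟ i
  ... | no ne' = cell-set-row D i c b x y ne'
  ... | yes refl with x <? n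
  ...   | yes l = trans (cong (λ r → atV false r y) (atV-upd (V.replicate m false) D x (λ row → updV row c (λ _ → b)) l))
            (atV-upd-≢ false (atV (V.replicate m false) D x) c (λ _ → b) y ne)
  ...   | no l = trans (columns-rows (setCell D x c b) y x (≮⇒≥ l)) (sym (columns-rows D y x (≮⇒≥ l)))

  shift : Diagram n m → ℕ → ℕ → ℕ → Diagram n m
  shift D a c b = setCell (setCell D a c false) b c true

  module _ (D : Diagram n m) (a c b : ℕ) (la : a < n) (lb : b < n) (lc : c < m) (ne : a ≢ b) where
    shift-from : cell (shift D a c b) a c ≡ false
    shift-from = trans (cell-set-row (setCell D a c false) b c true a c ne) (cell-set D a c false la lc)
    shift-to : cell (shift D a c b) b c ≡ true
    shift-to = cell-set (setCell D a c false) b c true lb lc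
    shift-rest : ∀ x → x ≢ a → x ≢ b → cell (shift D a c b) x c ≡ cell D x c
    shift-rest x p q = trans (cell-set-row (setCell D a c false) b c true x c q) (cell-set-row D a c false x c p)
    shift-other : ∀ c' → c' ≢ c → columns (shift D a c b) c' ≗ columns D c'
    shift-other c' p x = trans (cell-set-col (setCell D a c false) b c true x c' p) (cell-set-col D a c false x c' p)

  kmove⇒move : ∀ {D D'} → KMove D D' → Move m (columns D) (columns D')
  kmove⇒move {D} (a , c , b , ta , cl , ba , fb , md , refl) =
    move lc la cl (colMove ba ta fb md (shift-from D a c b la lb lc ne) (shift-to D a c b la lb lc ne)
      (shift-rest D a c b la lb lc ne)) (shift-other D a c b la lb lc ne)
    where
    la = cell-row< D a c ta
    lc = cell-col< D a c ta
    lb = <-trans ba la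
    ne = >⇒≢ ba

  KD⇒reach : ∀ {D T} → KD D T → Reach m (columns D) (columns T)
  KD⇒reach {D} {T} ε = here (λ c x → refl)
  KD⇒reach {D} (s ◅ p) = reach-trans (here (λ c x → refl) ▷ kmove⇒move s) (KD⇒reach p)

  reach⇒KD′ : ∀ {D G} → Reach m (columns D) G → Σ (Diagram n m) λ T → KD D T × (∀ c → columns T c ≗ G c)
  reach⇒KD′ {D} (here e) = D , ε , e
  reach⇒KD′ {D} (_▷_ {G} {H} R (move {a} {b} {c} lc la cl (colMove ba ta fb md fa tb rs) o)) with reach⇒KD′ R
  ... | T , p , e = shift T a c b , p ◅◅ ((a , c , b , trans (e c a) ta , (λ c' l → trans (e c' a) (cl c' l)) , ba ,
            trans (e c b) fb , (λ j p q → trans (e c j) (md j p q)) , refl) ◅ ε) , eq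
    where
    lb = <-trans ba la
    ne = >⇒≢ ba
    eq : ∀ c' → columns (shift T a c b) c' ≗ H c'
    eq c' x with c' ≟ c
    ... | no nc = trans (shift-other T a c b la lb lc ne c' nc x) (trans (e c' x) (sym (o c' nc x)))
    ... | yes refl with x ≟ a | x ≟ b
    ...   | yes refl | _ = trans (shift-from T a c b la lb lc ne) (sym fa)
    ...   | no _ | yes refl = trans (shift-to T a c b la lb lc ne) (sym tb)
    ...   | no p | no q = trans (shift-rest T a c b la lb lc ne x p q) (trans (e c x) (sym (rs x p q)))

  reach⇒KD : ∀ {D T} → Reach m (columns D) (columns T) → KD D T
  reach⇒KD {D} {T} R with reach⇒KD′ R
  ... | T' , p , e = subst (KD D) (columns-ext T' T e) p

  module _ (i : ℕ) (D : Diagram n m) where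
    syms : ℕ → List Sym
    syms c = (if cell D i c then opn c ∷ [] else []) ++ (if cell D (suc i) c then cls c ∷ [] else [])

    -- Weaker than being fully matched, but it is the hypothesis of `lower-flag`. The enumeration
    -- `f` replaces the identity because the scan shifts the list of columns at every step.
    Balanced : (ℕ → ℕ) → ℕ → Set
    Balanced f k = ∀ j → j < k → Minus i (columns D (f j)) → Σ ℕ λ j₁ → j₁ < j × Plus i (columns D (f j₁))

    -- What `raise-at` requires of the column of the rightmost unmatched cell.
    Last : (ℕ → ℕ) → ℕ → ℕ → Set
    Last f k c₀ = Σ ℕ λ j₀ → j₀ < k × f j₀ ≡ c₀ × Minus i (columns D (f j₀)) ×
      (∀ j → j < k → j₀ < j → Minus i (columns D (f j)) → Σ ℕ λ j₁ → j₀ < j₁ × j₁ < j × Plus i (columns D (f j₁)))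

    last-suc : ∀ {f k c₀} → Last (f ∘ suc) k c₀ → Last f (suc k) c₀
    last-suc {f} (j₀ , l , e , mi , h) = suc j₀ , s≤s l , e , mi , h'
      where
      h' : ∀ j → j < _ → suc j₀ < j → Minus i (columns D (f j)) → Σ ℕ λ j₁ → suc j₀ < j₁ × j₁ < j × Plus i (columns D (f j₁))
      h' (suc j) (s≤s p) (s≤s q) mi' with h j p q mi'
      ... | j₁ , a , b , pl = suc j₁ , s≤s a , s≤s b , pl

    balanced-suc : ∀ {f k} → ¬ Minus i (columns D (f 0)) → Balanced (f ∘ suc) k → Balanced f (suc k)
    balanced-suc nm h zero l mi = ⊥-elim (nm mi)
    balanced-suc nm h (suc j) (s≤s l) mi with h j l mi
    ... | j₁ , p , pl = suc j₁ , s≤s p , pl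

    balanced-plus : ∀ {f k} → Plus i (columns D (f 0)) → Balanced f k
    balanced-plus (p , q) zero l (p' , _) = ⊥-elim (bool-absurd p p')
    balanced-plus pl (suc j) l mi = 0 , s≤s z≤n , pl

    balanced-last : ∀ {f k} → Minus i (columns D (f 0)) → Balanced (f ∘ suc) k → Last f (suc k) (f 0)
    balanced-last {f} mi h = 0 , s≤s z≤n , refl , mi , h'
      where
      h' : ∀ j → j < _ → 0 < j → Minus i (columns D (f j)) → Σ ℕ λ j₁ → 0 < j₁ × j₁ < j × Plus i (columns D (f j₁))
      h' (suc j) (s≤s p) _ mi' with h j p mi'
      ... | j₁ , a , pl = suc j₁ , s≤s z≤n , s≤s a , pl

    scan-none : ∀ xs st cl → proj₂ (scan xs st cl) ≡ [] → cl ≡ []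
    scan-none [] st cl e = e
    scan-none (opn p ∷ xs) st cl e = scan-none xs (p ∷ st) cl e
    scan-none (cls p ∷ xs) (_ ∷ st) cl e = scan-none xs st cl e
    scan-none (skip ∷ xs) st cl e = scan-none xs st cl e
    scan-none (cls p ∷ xs) [] cl e with scan-none xs [] (p ∷ cl) e
    ... | ()

    scan-nothing : ∀ k f st cl → proj₂ (scan (concat (L.map syms (L.applyUpTo f k))) st cl) ≡ [] → st ≡ [] → Balanced f k
    scan-nothing zero f st cl e s j ()
    scan-nothing (suc k) f st cl e s with cell D i (f 0) in ea | cell D (suc i) (f 0) in eb
    ... | true | true = balanced-suc (λ (p , _) → bool-absurd ea p) (scan-nothing k (f ∘ suc) st cl e s)
    ... | true | false = balanced-plus (ea , eb)
    ... | false | false = balanced-suc (λ (_ , q) → bool-absurd q eb) (scan-nothing k (f ∘ suc) st cl e s)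
    scan-nothing (suc k) f [] cl e refl | false | true with scan-none (concat (L.map syms (L.applyUpTo (f ∘ suc) k))) [] (f 0 ∷ cl) e
    ... | ()

    -- The unmatched closing brackets are stacked with the most recent on top. If `c₀` was on top
    -- before this segment, nothing in the segment stayed unmatched; with no pending opening bracket
    -- the segment is then balanced. Otherwise `c₀` comes from the segment itself.
    scan-just : ∀ k f st cl c₀ rest → proj₂ (scan (concat (L.map syms (L.applyUpTo f k))) st cl) ≡ c₀ ∷ rest →
      (cl ≡ c₀ ∷ rest × (st ≡ [] → Balanced f k)) ⊎ Last f k c₀
    scan-just zero f st cl c₀ rest e = inj₁ (e , λ _ j ())
    scan-just (suc k) f st cl c₀ rest e with cell D i (f 0) in ea | cell D (suc i) (f 0) in eb
    ... | true | true with scan-just k (f ∘ suc) st cl c₀ rest e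
    ...   | inj₁ (p , h) = inj₁ (p , λ s → balanced-suc (λ (p , _) → bool-absurd ea p) (h s))
    ...   | inj₂ h = inj₂ (last-suc h)
    scan-just (suc k) f st cl c₀ rest e | false | false with scan-just k (f ∘ suc) st cl c₀ rest e
    ...   | inj₁ (p , h) = inj₁ (p , λ s → balanced-suc (λ (_ , q) → bool-absurd q eb) (h s))
    ...   | inj₂ h = inj₂ (last-suc h)
    scan-just (suc k) f st cl c₀ rest e | true | false with scan-just k (f ∘ suc) (f 0 ∷ st) cl c₀ rest e
    ...   | inj₁ (p , h) = inj₁ (p , λ s → balanced-plus (ea , eb))
    ...   | inj₂ h = inj₂ (last-suc h)
    scan-just (suc k) f [] cl c₀ rest e | false | true with scan-just k (f ∘ suc) [] (f 0 ∷ cl) c₀ rest e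
    ...   | inj₁ (refl , h) = inj₂ (balanced-last (ea , eb) (h refl))
    ...   | inj₂ h = inj₂ (last-suc h)
    scan-just (suc k) f (x ∷ st) cl c₀ rest e | false | true with scan-just k (f ∘ suc) st cl c₀ rest e
    ...   | inj₁ (p , h) = inj₁ (p , λ ())
    ...   | inj₂ h = inj₂ (last-suc h)

    eK-nothing : eK i D ≡ nothing → Balanced id m
    eK-nothing e with proj₂ (scan (kSyms i D) [] []) in eq
    ... | [] = scan-nothing m id [] [] eq refl

    eK-just : ∀ {D'} → eK i D ≡ just D' → Σ ℕ λ c₀ → Last id m c₀ × D' ≡ shift D (suc i) c₀ i
    eK-just e with proj₂ (scan (kSyms i D) [] []) in eq
    eK-just refl | c₀ ∷ rest with scan-just m id [] [] c₀ rest eq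
    ... | inj₂ h = c₀ , h , refl

  module _ (D : Diagram n m) (nw : Northwest D) where
    private
      o : Orth m (columns D)
      o = orth m (columns D) nw (columns-rows D)

    KD⇒S : ∀ {T} → KD D T → S idF (prog o) (columns T)
    KD⇒S p = S-reach o idF (contains o id id-levels) (KD⇒reach p)

    S⇒KD : ∀ {T} → S idF (prog o) (columns T) → KD D T
    S⇒KD {T} s = reach⇒KD (S⇒Reach o (columns-supp D) (columns T) (columns-supp T) (columns-rows T) s)

    -- An `e_i` moves one cell past others that may block a Kohnert move, so the claim is not
    -- checked by moves but transported through `S`, where it is `raise-at`.
    KD-closed : ∀ i → suc i < n → ∀ {T T'} → KD D T → eK i T ≡ just T' → KD D T'
    KD-closed i li {T} p e with eK-just i T e
    ... | c₀ , (.c₀ , lc , refl , (fi , ti) , h) , refl =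
      S⇒KD (raise-at i li idF (prog o) (columns T) _ c₀ (KD⇒S p) (subst (c₀ <_) (sym (prog-width o)) lc)
        (shift-other T (suc i) c₀ i li (<⇒≤ li) lc (λ ())) eq (λ c l → h c (subst (c <_) (prog-width o) l)))
      where
      eq : columns (shift T (suc i) c₀ i) c₀ ≗ dn i (columns T c₀)
      eq x with near i x
      ... | low refl = trans (shift-to T (suc i) c₀ i li (<⇒≤ li) lc (λ ()))
                        (sym (trans (dn-low i (columns T c₀)) (cong₂ _∨_ fi ti)))
      ... | high refl = trans (shift-from T (suc i) c₀ i li (<⇒≤ li) lc (λ ()))
                        (sym (trans (dn-high i (columns T c₀)) (cong₂ _∧_ fi ti)))
      ... | far p q = trans (shift-rest T (suc i) c₀ i li (<⇒≤ li) lc (λ ()) x q p) (sym (dn-far i (columns T c₀) p q))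

  row-swap : ∀ r (D : Diagram n m) → suc r < n → ∀ c → columns (swapRows r D) c ≗ sw r (columns D) c
  row-swap r D lr c x with x <? n
  ... | no l = trans (columns-rows (swapRows r D) c x (≮⇒≥ l))
      (sym (trans (cong (columns D c) (swap-far r (>⇒≢ (<-trans ≤-refl (<-≤-trans lr (≮⇒≥ l)))) (>⇒≢ (<-≤-trans lr (≮⇒≥ l)))))
        (columns-rows D c x (≮⇒≥ l))))
  ... | yes l = trans (cong (λ w → atV false w c) (atV-tab (V.replicate m false) g x l)) (go x)
    where
    g : ℕ → Vec Bool m
    g k = if k ≡ᵇ r then rowAt D (suc r) else if k ≡ᵇ suc r then rowAt D r else rowAt D k
    go : ∀ x → atV false (g x) c ≡ cell D (swapVal r x) c
    go x with x ≡ᵇ r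
    ... | true = refl
    ... | false with x ≡ᵇ suc r
    ...   | true = refl
    ...   | false = refl

  module _ (r : ℕ) (lr : suc r < n) (D : Diagram n m) (nw : Northwest D)
           (sub : ∀ c → cell D r c ≡ true → cell D (suc r) c ≡ true) where

    nw-swap : Northwest (swapRows r D)
    nw-swap i j k l ij kl a b = trans (row-swap r D lr k i) (NWf-swap r (columns D) nw sub i j k l ij kl
      (trans (sym (row-swap r D lr k j)) a) (trans (sym (row-swap r D lr l i)) b))

    private
      E : Diagram n m
      E = swapRows r D
      o : Orth m (columns E)
      o = orth m (columns E) nw-swap (columns-rows E)
      l : Levels (swapVal r ∘ id)
      l = swap-levels r lr id id-levels

    swap-reachable : KD D E
    swap-reachable = reach⇒KD (sweep r lr (columns D) (λ c l (_ , q) → bool-absurd q (columns-supp D c (suc r) l)) m 0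
        (columns E) refl cl (λ c _ → eq c) (λ c ()))
      where
      -- A cell of row `r` to the right of a lone cell in row `suc r` would contradict the northwest
      -- property.
      cl : ∀ c c' → 0 ≤ c → c < c' → Minus r (columns D c) → cell D r c' ∧ cell D (suc r) c' ≡ false
      cl c c' _ lt (f , t) with bool? (cell D r c')
      ... | inj₂ f' = cong (_∧ cell D (suc r) c') f'
      ... | inj₁ t' = ⊥-elim (bool-absurd (nw r (suc r) c c' ≤-refl lt t t') f)
      or : ∀ a b → (a ≡ true → b ≡ true) → a ∨ b ≡ b
      or true b h = sym (h refl)
      or false b h = refl
      an : ∀ a b → (a ≡ true → b ≡ true) → a ∧ b ≡ a
      an true b h = h refl
      an false b h = refl
      eq : ∀ c → columns E c ≗ dn r (columns D c)
      eq c x with near r x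
      ... | low refl = trans (row-swap r D lr c r) (trans (cong (columns D c) (swap-low r))
              (sym (trans (dn-low r (columns D c)) (or _ _ (sub c)))))
      ... | high refl = trans (row-swap r D lr c (suc r)) (trans (cong (columns D c) (swap-high r))
              (sym (trans (dn-high r (columns D c)) (an _ _ (sub c)))))
      ... | far p q = trans (row-swap r D lr c x) (trans (cong (columns D c) (swap-far r p q)) (sym (dn-far r (columns D c) p q)))

    -- Orthodontia of `E` serves for both diagrams: `D` arises from `E` by exchanging two rows, so
    -- by `contains` it lies in the set of `s_r`, and so does every `T` reachable from it. When
    -- `e_r` kills `T`, `lower-flag` replaces `s_r` by the identity.
    KD-highest : ∀ {T} → KD D T → eK r T ≡ nothing → KD E T
    KD-highest {T} p e = S⇒KD E nw-swap (S-mono {dnF r lr w} {idF} below (prog o) (columns T)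
        (lower-flag r lr w (prog o) (columns T) sT (λ c lc → eK-nothing r T e c (subst (c <_) (prog-width o) lc))))
      where
      w : Flag
      w = gflag (swapVal r ∘ id) l
      sT : S w (prog o) (columns T)
      sT = S-reach o w (S-cong w (prog o) (λ c _ x → trans (row-swap r D lr c (swapVal r x)) (cong (columns D c) (swap-swap r x)))
             (contains o (swapVal r ∘ id) l)) (KD⇒reach p)
      below : dnF r lr w ≤F idF
      below = dn-below-id r lr w (λ p h → ≗⇒≼ (λ x → swap-<ᵇ r x p (except-≢ (suc r) p h)))

-- The signature rule on reading words

module _ (i : ℕ) where
  -- occ (suc i) counts opening and occ i counts closing brackets.
  SufOK : List ℕ → Set
  SufOK w = ∀ s' s → w ≡ s' ++ s → occ (suc i) s ≤ occ i s

  PreOK : ℕ → List ℕ → Set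
  PreOK d w = ∀ s s' → w ≡ s ++ s' → occ i s ≤ d + occ (suc i) s

  data Letter (x : ℕ) : Set where
    open! : x ≡ suc i → Letter x
    close! : x ≡ i → Letter x
    other : (suc i ≡ᵇ x) ≡ false → (i ≡ᵇ x) ≡ false → (x ≡ᵇ suc i) ≡ false → (x ≡ᵇ i) ≡ false → Letter x

  letter : ∀ x → Letter x
  letter x with near i x
  ... | low e = close! e
  ... | high e = open! e
  ... | far p q = other (≢⇒≡ᵇ _ _ (q ∘ sym)) (≢⇒≡ᵇ _ _ (p ∘ sym)) (≢⇒≡ᵇ _ _ q) (≢⇒≡ᵇ _ _ p)

  sufOK-∷ : ∀ x w → occ (suc i) (x ∷ w) ≤ occ i (x ∷ w) → SufOK w → SufOK (x ∷ w)
  sufOK-∷ x w h k [] s refl = h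
  sufOK-∷ x w h k (y ∷ s') s e = k s' s (proj₂ (∷-injective e))

  sym-of : ℕ → ℕ → Sym
  sym-of p x = if x ≡ᵇ suc i then opn p else if x ≡ᵇ i then cls p else skip

  symsW : (ℕ → ℕ) → List ℕ → List Sym
  symsW f w = L.zipWith sym-of (L.applyUpTo f (length w)) w

  occ-open : ∀ w → occ (suc i) (suc i ∷ w) ≡ suc (occ (suc i) w)
  occ-open w rewrite ≡ᵇ-refl i = refl

  occ-open′ : ∀ w → occ i (suc i ∷ w) ≡ occ i w
  occ-open′ w rewrite ≢⇒≡ᵇ i (suc i) (λ ()) = refl

  occ-close : ∀ w → occ i (i ∷ w) ≡ suc (occ i w)
  occ-close w rewrite ≡ᵇ-refl i = refl

  occ-close′ : ∀ w → occ (suc i) (i ∷ w) ≡ occ (suc i) w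
  occ-close′ w rewrite suc-≡ᵇ i = refl

  -- The closing brackets of `w` suffice for its own opening brackets and for all those pending in
  -- `st`.
  Drained : List ℕ → List ℕ → Set
  Drained st w = occ (suc i) w + length st ≤ occ i w

  drained-open : ∀ p st w → Drained (p ∷ st) w → Drained st (suc i ∷ w)
  drained-open p st w h = subst₂ _≤_ (trans (+-suc _ _) (cong (_+ length st) (sym (occ-open w)))) (sym (occ-open′ w)) h

  drained-close : ∀ p st w → Drained st w → Drained (p ∷ st) (i ∷ w)
  drained-close p st w h = subst₂ _≤_ (trans (sym (+-suc _ _)) (cong (_+ suc (length st)) (sym (occ-close′ w)))) (sym (occ-close w)) (s≤s h)

  drained-close₀ : ∀ w → Drained [] w → Drained [] (i ∷ w)
  drained-close₀ w h = subst₂ _≤_ (cong (_+ 0) (sym (occ-close′ w))) (sym (occ-close w)) (m≤n⇒m≤1+n h)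

  drained-suf : ∀ x st w → Drained st (x ∷ w) → SufOK w → SufOK (x ∷ w)
  drained-suf x st w h k = sufOK-∷ x w (≤-trans (m≤m+n _ (length st)) h) k

  symsW-open : ∀ f w → symsW f (suc i ∷ w) ≡ opn (f 0) ∷ symsW (f ∘ suc) w
  symsW-open f w rewrite ≡ᵇ-refl i = refl

  symsW-close : ∀ f w → symsW f (i ∷ w) ≡ cls (f 0) ∷ symsW (f ∘ suc) w
  symsW-close f w rewrite ≢⇒≡ᵇ i (suc i) (λ ()) | ≡ᵇ-refl i = refl

  symsW-other : ∀ f x w → (x ≡ᵇ suc i) ≡ false → (x ≡ᵇ i) ≡ false → symsW f (x ∷ w) ≡ skip ∷ symsW (f ∘ suc) w
  symsW-other f x w c d rewrite c | d = refl

  drained-other : ∀ {x} st w → (suc i ≡ᵇ x) ≡ false → (i ≡ᵇ x) ≡ false → Drained st w → Drained st (x ∷ w)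
  drained-other st w a b h rewrite a | b = h

  unmatched : List Sym → List ℕ → List ℕ → List ℕ
  unmatched s st cl = proj₁ (scan s st cl)

  scan-drains : ∀ w f st cl → unmatched (symsW f w) st cl ≡ [] → Drained st w × SufOK w
  scan-drains [] f st cl refl = z≤n , λ { [] [] refl → z≤n }
  scan-drains (x ∷ w) f st cl e with letter x
  ... | other a b c d with scan-drains w (f ∘ suc) st cl (trans (cong (λ s → unmatched s st cl) (sym (symsW-other f x w c d))) e)
  ...   | h , k = drained-other st w a b h , drained-suf x st w (drained-other st w a b h) k
  scan-drains (x ∷ w) f st cl e | open! refl
    with scan-drains w (f ∘ suc) (f 0 ∷ st) cl (trans (cong (λ s → unmatched s st cl) (sym (symsW-open f w))) e)
  ... | h , k = drained-open (f 0) st w h , drained-suf (suc i) st w (drained-open (f 0) st w h) k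
  scan-drains (x ∷ w) f [] cl e | close! refl
    with scan-drains w (f ∘ suc) [] (f 0 ∷ cl) (trans (cong (λ s → unmatched s [] cl) (sym (symsW-close f w))) e)
  ... | h , k = drained-close₀ w h , drained-suf i [] w (drained-close₀ w h) k
  scan-drains (x ∷ w) f (p ∷ st) cl e | close! refl
    with scan-drains w (f ∘ suc) st cl (trans (cong (λ s → unmatched s (p ∷ st) cl) (sym (symsW-close f w))) e)
  ... | h , k = drained-close p st w h , drained-suf i (p ∷ st) w (drained-close p st w h) k

  -- The leftmost unmatched opening bracket, described without the scan: everything opened before it
  -- is closed before it, and after it no prefix closes more than it opens.
  record Split (f : ℕ → ℕ) (st w : List ℕ) (p : ℕ) : Set where
    constructor split
    field
      pre post : List ℕ
      word   : w ≡ pre ++ suc i ∷ post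
      pos    : p ≡ f (length pre)
      drain  : Drained st pre
      sufOK  : SufOK pre
      preOK  : PreOK 0 post

  split-skip : ∀ {f st st' w p} x → (∀ v → Drained st' v → Drained st (x ∷ v)) →
    Split (f ∘ suc) st' w p → Split f st (x ∷ w) p
  split-skip {st = st} x h (split pre post e q d s o) =
    split (x ∷ pre) post (cong (x ∷_) e) q (h pre d) (drained-suf x st pre (h pre d) s) o

  preOK-other : ∀ {d x w} → (suc i ≡ᵇ x) ≡ false → (i ≡ᵇ x) ≡ false → PreOK d w → PreOK d (x ∷ w)
  preOK-other a b h [] s' e = z≤n
  preOK-other a b h (y ∷ s) s' e with ∷-injective e
  ... | refl , e' rewrite a | b = h s s' e'

  preOK-open : ∀ {d w} → PreOK (suc d) w → PreOK d (suc i ∷ w)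
  preOK-open h [] s' e = z≤n
  preOK-open {d} h (y ∷ s) s' e with ∷-injective e
  ... | refl , e' rewrite occ-open s | occ-open′ s = subst (occ i s ≤_) (sym (+-suc d _)) (h s s' e')

  preOK-close : ∀ {d w} → PreOK d w → PreOK (suc d) (i ∷ w)
  preOK-close h [] s' e = z≤n
  preOK-close {d} h (y ∷ s) s' e with ∷-injective e
  ... | refl , e' rewrite occ-close s | occ-close′ s = s≤s (h s s' e')

  -- The leftmost unmatched bracket is the bottom of the final stack. If it was the bottom of `st`
  -- already, the rest of the word never removes more than the `length st ∸ 1` entries above it
  -- together with those newly opened.
  scan-last : ∀ w f st cl p → lastL (unmatched (symsW f w) st cl) ≡ just p →
    (lastL st ≡ just p × PreOK (length st ∸ 1) w) ⊎ Split f st w p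
  scan-last [] f st cl p e = inj₁ (e , λ { [] s' refl → z≤n })
  scan-last (x ∷ w) f st cl p e with letter x
  ... | other a b c d with scan-last w (f ∘ suc) st cl p (trans (cong (λ s → lastL (unmatched s st cl)) (sym (symsW-other f x w c d))) e)
  ...   | inj₁ (l , o) = inj₁ (l , preOK-other a b o)
  ...   | inj₂ s = inj₂ (split-skip x (λ v → drained-other st v a b) s)
  scan-last (x ∷ w) f st cl p e | open! refl
    with scan-last w (f ∘ suc) (f 0 ∷ st) cl p (trans (cong (λ s → lastL (unmatched s st cl)) (sym (symsW-open f w))) e)
  ... | inj₂ s = inj₂ (split-skip (suc i) (drained-open (f 0) st) s)
  scan-last (x ∷ w) f (y ∷ st) cl p e | open! refl | inj₁ (l , o) = inj₁ (l , preOK-open o)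
  scan-last (x ∷ w) f [] cl p e | open! refl | inj₁ (refl , o) =
    inj₂ (split [] w refl refl z≤n (λ { [] [] refl → z≤n }) o)
  scan-last (x ∷ w) f [] cl p e | close! refl
    with scan-last w (f ∘ suc) [] (f 0 ∷ cl) p (trans (cong (λ s → lastL (unmatched s [] cl)) (sym (symsW-close f w))) e)
  ... | inj₂ s = inj₂ (split-skip i drained-close₀ s)
  scan-last (x ∷ w) f (y ∷ []) cl p e | close! refl
    with scan-last w (f ∘ suc) [] cl p (trans (cong (λ s → lastL (unmatched s (y ∷ []) cl)) (sym (symsW-close f w))) e)
  ... | inj₂ s = inj₂ (split-skip i (drained-close y []) s)
  scan-last (x ∷ w) f (y ∷ z ∷ st) cl p e | close! refl
    with scan-last w (f ∘ suc) (z ∷ st) cl p (trans (cong (λ s → lastL (unmatched s (y ∷ z ∷ st) cl)) (sym (symsW-close f w))) e)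
  ... | inj₁ (l , o) = inj₁ (l , preOK-close o)
  ... | inj₂ s = inj₂ (split-skip i (drained-close y (z ∷ st)) s)

  updL-mid : ∀ (pre : List ℕ) x post y → updL (pre ++ x ∷ post) (length pre) y ≡ pre ++ y ∷ post
  updL-mid [] x post y = refl
  updL-mid (z ∷ pre) x post y = cong (z ∷_) (updL-mid pre x post y)

  lastL-nothing : ∀ (xs : List ℕ) → lastL xs ≡ nothing → xs ≡ []
  lastL-nothing [] e = refl
  lastL-nothing (x ∷ y ∷ ys) e with lastL-nothing (y ∷ ys) e
  ... | ()

  eB-nothing : ∀ {n} (T : Tab n) → eB i T ≡ nothing → SufOK (readWord T)
  eB-nothing T e with lastL (proj₁ (scan (tSyms i (readWord T)) [] [])) in eq
  ... | nothing = proj₂ (scan-drains (readWord T) id [] [] (lastL-nothing _ eq))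

  eB-just : ∀ {n} (T T' : Tab n) → eB i T ≡ just T' → Σ (List ℕ) λ pre → Σ (List ℕ) λ post →
    readWord T ≡ pre ++ suc i ∷ post × T' ≡ unread T (pre ++ i ∷ post) × SufOK pre × PreOK 0 post
  eB-just T T' e with lastL (proj₁ (scan (tSyms i (readWord T)) [] [])) in eq
  eB-just T T' refl | just p with scan-last (readWord T) id [] [] p eq
  ... | inj₂ (split pre post w refl _ s o) =
    pre , post , w , cong (unread T) (trans (cong (λ v → updL v (length pre) i) w) (updL-mid pre (suc i) post i)) , s , o

-- Rows of a tableau inside its reading word, and single raising steps

seg : (ℕ → List ℕ) → ℕ → ℕ → List ℕ
seg R a zero = []
seg R a (suc d) = R (a + d) ++ seg R a d

readWord-∷ : ∀ {n} r (T : Tab n) → readWord (r ∷ T) ≡ readWord T ++ r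
readWord-∷ r T = begin
  concat (V.toList (V.reverse (r ∷ T))) ≡⟨ cong (concat ∘ V.toList) (V.reverse-∷ r T) ⟩
  concat (V.toList (V.reverse T V.∷ʳ r)) ≡⟨ cong concat (V.toList-∷ʳ r (V.reverse T)) ⟩
  concat (V.toList (V.reverse T) ++ r ∷ []) ≡⟨ concat-++ (V.toList (V.reverse T)) (r ∷ []) ⟨
  readWord T ++ (r ++ []) ≡⟨ cong (readWord T ++_) (++-identityʳ r) ⟩
  readWord T ++ r ∎
  where open ≡-Reasoning

seg-shift : ∀ {n} r (T : Tab n) d → seg (atV [] (r ∷ T)) 0 (suc d) ≡ seg (atV [] T) 0 d ++ r
seg-shift r T zero = ++-identityʳ r
seg-shift r T (suc d) = trans (cong (atV [] T d ++_) (seg-shift r T d)) (sym (++-assoc (atV [] T d) _ r))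

readWord-seg : ∀ {n} (T : Tab n) → readWord T ≡ seg (atV [] T) 0 n
readWord-seg [] = refl
readWord-seg {suc n} (r ∷ T) = trans (readWord-∷ r T) (trans (cong (_++ r) (readWord-seg T)) (sym (seg-shift r T n)))

++-split : ∀ (u v pre : List ℕ) x post → u ++ v ≡ pre ++ x ∷ post →
  (Σ (List ℕ) λ B → u ≡ pre ++ x ∷ B × post ≡ B ++ v) ⊎ (Σ (List ℕ) λ pre' → pre ≡ u ++ pre' × v ≡ pre' ++ x ∷ post)
++-split [] v pre x post e = inj₂ (pre , refl , e)
++-split (y ∷ u) v [] x post e with ∷-injective e
... | refl , e' = inj₁ (u , refl , sym e')
++-split (y ∷ u) v (z ∷ pre) x post e with ∷-injective e
... | refl , e' with ++-split u v pre x post e'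
...   | inj₁ (B , p , q) = inj₁ (B , cong (z ∷_) p , q)
...   | inj₂ (pre' , p , q) = inj₂ (pre' , cong (z ∷_) p , q)

record Located (R : ℕ → List ℕ) (d : ℕ) (pre : List ℕ) (x : ℕ) (post : List ℕ) : Set where
  constructor located
  field
    k e  : ℕ
    A B  : List ℕ
    size : suc k + e ≡ d
    row  : R k ≡ A ++ x ∷ B
    preE  : pre ≡ seg R (suc k) e ++ A
    postE : post ≡ B ++ seg R 0 k

locate : ∀ R d pre x post → seg R 0 d ≡ pre ++ x ∷ post → Located R d pre x post
locate R zero [] x post ()
locate R zero (_ ∷ pre) x post ()
locate R (suc d) pre x post eq with ++-split (R d) (seg R 0 d) pre x post eq
... | inj₁ (B , p , q) = located d 0 pre B (+-identityʳ (suc d)) p refl q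
... | inj₂ (pre' , p , q) with locate R d pre' x post q
...   | located k e A B s r pe qe = located k (suc e) A B (trans (+-suc (suc k) e) (cong suc s)) r
        (trans p (trans (cong₂ _++_ (cong R (sym s)) pe) (sym (++-assoc (R (suc k + e)) (seg R (suc k) e) A)))) qe

seg-cong : ∀ R R' a d → (∀ j → a ≤ j → j < a + d → R j ≡ R' j) → seg R a d ≡ seg R' a d
seg-cong R R' a zero h = refl
seg-cong R R' a (suc d) h = cong₂ _++_ (h (a + d) (m≤m+n a d) (≤-reflexive (sym (+-suc a d))))
  (seg-cong R R' a d (λ j p q → h j p (<-≤-trans q (≤-trans (n≤1+n _) (≤-reflexive (sym (+-suc a d)))))))

seg-append : ∀ R a d e → seg R a (d + e) ≡ seg R (a + d) e ++ seg R a d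
seg-append R a d zero = cong (seg R a) (+-identityʳ d)
seg-append R a d (suc e) = trans (cong (seg R a) (+-suc d e)) (trans
  (cong₂ _++_ (cong R (sym (+-assoc a d e))) (seg-append R a d e)) (sym (++-assoc (R (a + d + e)) _ _)))

take-++ : ∀ (xs ys : List ℕ) → L.take (length xs) (xs ++ ys) ≡ xs
take-++ [] ys = refl
take-++ (x ∷ xs) ys = cong (x ∷_) (take-++ xs ys)

drop-++ : ∀ (xs ys : List ℕ) → L.drop (length xs) (xs ++ ys) ≡ ys
drop-++ [] ys = refl
drop-++ (x ∷ xs) ys = drop-++ xs ys

splitBy-concat : ∀ {k} (R : Vec (List ℕ) k) → splitBy (V.map length R) (concat (V.toList R)) ≡ R
splitBy-concat [] = refl
splitBy-concat (r ∷ R) = cong₂ _∷_ (take-++ r _) (trans (cong (splitBy (V.map length R)) (drop-++ r _)) (splitBy-concat R))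

unread-readWord : ∀ {n} (T T' : Tab n) → V.map length T ≡ V.map length T' → unread T (readWord T') ≡ T'
unread-readWord T T' e = begin
  V.reverse (splitBy (V.reverse (V.map length T)) (readWord T')) ≡⟨ cong (λ l → V.reverse (splitBy (V.reverse l) (readWord T'))) e ⟩
  V.reverse (splitBy (V.reverse (V.map length T')) (readWord T')) ≡⟨ cong (λ l → V.reverse (splitBy l (readWord T'))) (V.map-reverse length T') ⟨
  V.reverse (splitBy (V.map length (V.reverse T')) (readWord T')) ≡⟨ cong V.reverse (splitBy-concat (V.reverse T')) ⟩
  V.reverse (V.reverse T') ≡⟨ V.reverse-involutive T' ⟩
  T' ∎
  where open ≡-Reasoning

atV-map : ∀ {k} (T : Vec (List ℕ) k) j → atV 0 (V.map length T) j ≡ length (atV [] T j)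
atV-map [] j = refl
atV-map (r ∷ T) zero = refl
atV-map (r ∷ T) (suc j) = atV-map T j

record Step (i : ℕ) {n : ℕ} (T T' : Tab n) : Set where
  constructor mkStep
  field
    pre post : List ℕ
    loc   : Located (atV [] T) n pre (suc i) post
    sufOK : SufOK i pre
    preOK : PreOK i 0 post
    word  : readWord T ≡ pre ++ suc i ∷ post
    word' : readWord T' ≡ pre ++ i ∷ post
  open Located loc public
  field
    row'  : atV [] T' k ≡ A ++ i ∷ B
    rows' : ∀ j → j ≢ k → atV [] T' j ≡ atV [] T j

-- Replacing one letter changes no row length, so cutting the new word at the old lengths must give
-- `U`, the tableau with that one entry replaced.
eB-step : ∀ i {n} (T T' : Tab n) → eB i T ≡ just T' → Step i T T'
eB-step i {n} T T' eq with eB-just i T T' eq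
... | pre , post , w , refl , s , o with locate (atV [] T) n pre (suc i) post (trans (sym (readWord-seg T)) w)
...   | loc@(located k e A B sz r pe qe) = mkStep pre post loc s o w
          (trans (cong readWord U≡) wU) (trans (cong (λ t → atV [] t k) U≡) rowU)
          (λ j ne → trans (cong (λ t → atV [] t j) U≡) (rowsU j ne))
  where
  lk : k < n
  lk = subst (k <_) sz (m≤m+n (suc k) e)
  U : Tab n
  U = updV T k (λ _ → A ++ i ∷ B)
  rowU : atV [] U k ≡ A ++ i ∷ B
  rowU = atV-upd [] T k _ lk
  rowsU : ∀ j → j ≢ k → atV [] U j ≡ atV [] T j
  rowsU j ne = atV-upd-≢ [] T k _ j ne
  R = atV [] T
  R' = atV [] U
  wU : readWord U ≡ pre ++ i ∷ post
  wU = begin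
    readWord U ≡⟨ readWord-seg U ⟩
    seg R' 0 n ≡⟨ cong (seg R' 0) sz ⟨
    seg R' 0 (suc k + e) ≡⟨ seg-append R' 0 (suc k) e ⟩
    seg R' (suc k) e ++ (R' k ++ seg R' 0 k) ≡⟨ cong₂ _++_ (seg-cong R' R (suc k) e (λ j p _ → rowsU j (>⇒≢ p)))
        (cong₂ _++_ rowU (seg-cong R' R 0 k (λ j _ q → rowsU j (<⇒≢ q)))) ⟩
    seg R (suc k) e ++ ((A ++ i ∷ B) ++ seg R 0 k) ≡⟨ cong (seg R (suc k) e ++_) (++-assoc A (i ∷ B) (seg R 0 k)) ⟩
    seg R (suc k) e ++ (A ++ i ∷ (B ++ seg R 0 k)) ≡⟨ ++-assoc (seg R (suc k) e) A _ ⟨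
    (seg R (suc k) e ++ A) ++ i ∷ (B ++ seg R 0 k) ≡⟨ cong₂ (λ a b → a ++ i ∷ b) pe qe ⟨
    pre ++ i ∷ post ∎
    where open ≡-Reasoning
  lens : V.map length T ≡ V.map length U
  lens = atV-ext 0 _ _ (λ j _ → trans (atV-map T j) (trans (ln j) (sym (atV-map U j))))
    where
    ln : ∀ j → length (R j) ≡ length (R' j)
    ln j with j ≟ k
    ... | yes refl = trans (cong length r) (trans (length-++ A) (trans (sym (length-++ A)) (cong length (sym rowU))))
    ... | no ne = cong length (sym (rowsU j ne))
  U≡ : unread T (pre ++ i ∷ post) ≡ U
  U≡ = trans (cong (unread T) (sym wU)) (unread-readWord T U lens)

-- In the word of the result, the changed letter is the last unmatched closing bracket.
step-injective : ∀ i {n} (T₁ T₂ T' : Tab n) → V.map length T₁ ≡ V.map length T₂ →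
  Step i T₁ T' → Step i T₂ T' → T₁ ≡ T₂
step-injective i T₁ T₂ T' len s₁ s₂ = trans (sym (unread-readWord T₂ T₁ (sym len)))
    (trans (cong (unread T₂) words) (unread-readWord T₂ T₂ refl))
  where
  module S₁ = Step s₁
  module S₂ = Step s₂
  -- Suppose one changed letter stood right of the other, with `mid` in between. As a suffix of
  -- `pre'`, `mid` has at most as many `suc i` as `i`; as `mid ++ i ∷ []` is a prefix of `post`, it
  -- has more.
  conflict : ∀ pre post mid pre' → SufOK i pre' → PreOK i 0 post → ∀ post' →
    pre' ≡ pre ++ i ∷ mid → post ≡ mid ++ i ∷ post' → ⊥
  conflict pre post mid pre' so po post' e₁ e₂ = 1+n≰n (≤-trans
    (≤-trans (≤-reflexive (sym (trans (occ-++ mid) (trans (cong (occ i mid +_) (occ-close i [])) (+-comm _ 1)))))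
      (≤-trans (po (mid ++ i ∷ []) post' (trans e₂ (sym (++-assoc mid (i ∷ []) post'))))
        (≤-reflexive (trans (occ-++′ mid) (trans (cong (occ (suc i) mid +_) (occ-close′ i [])) (+-identityʳ _))))))
    (so (pre ++ i ∷ []) mid (trans e₁ (sym (++-assoc pre (i ∷ []) mid)))))
    where
    occ-++ : ∀ u {v} → occ i (u ++ v) ≡ occ i u + occ i v
    occ-++ [] = refl
    occ-++ (x ∷ u) with i ≡ᵇ x
    ... | true = cong suc (occ-++ u)
    ... | false = occ-++ u
    occ-++′ : ∀ u {v} → occ (suc i) (u ++ v) ≡ occ (suc i) u + occ (suc i) v
    occ-++′ [] = refl
    occ-++′ (x ∷ u) with suc i ≡ᵇ x
    ... | true = cong suc (occ-++′ u)
    ... | false = occ-++′ u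
  compare : ∀ (p q p' q' : List ℕ) → p ++ i ∷ q ≡ p' ++ i ∷ q' →
    (p ≡ p' × q ≡ q') ⊎ (Σ (List ℕ) λ mid → p' ≡ p ++ i ∷ mid × q ≡ mid ++ i ∷ q')
                      ⊎ (Σ (List ℕ) λ mid → p ≡ p' ++ i ∷ mid × q' ≡ mid ++ i ∷ q)
  compare [] q [] q' e = inj₁ (refl , proj₂ (∷-injective e))
  compare [] q (x ∷ p') q' e with ∷-injective e
  ... | refl , e' = inj₂ (inj₁ (p' , refl , e'))
  compare (x ∷ p) q [] q' e with ∷-injective e
  ... | refl , e' = inj₂ (inj₂ (p , refl , sym e'))
  compare (x ∷ p) q (y ∷ p') q' e with ∷-injective e
  ... | refl , e' with compare p q p' q' e'
  ...   | inj₁ (refl , refl) = inj₁ (refl , refl)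
  ...   | inj₂ (inj₁ (mid , refl , e₂)) = inj₂ (inj₁ (mid , refl , e₂))
  ...   | inj₂ (inj₂ (mid , refl , e₂)) = inj₂ (inj₂ (mid , refl , e₂))
  words : readWord T₁ ≡ readWord T₂
  words with compare S₁.pre S₁.post S₂.pre S₂.post (trans (sym S₁.word') S₂.word')
  ... | inj₁ (e₁ , e₂) = trans S₁.word (trans (cong₂ (λ a b → a ++ suc i ∷ b) e₁ e₂) (sym S₂.word))
  ... | inj₂ (inj₁ (mid , e₁ , e₂)) = ⊥-elim (conflict S₁.pre S₁.post mid S₂.pre S₂.sufOK S₁.preOK S₂.post e₁ e₂)
  ... | inj₂ (inj₂ (mid , e₁ , e₂)) = ⊥-elim (conflict S₂.pre S₂.post mid S₁.pre S₁.sufOK S₂.preOK S₁.post e₁ e₂)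

-- Signatures by columns

occ-++ : ∀ x u v → occ x (u ++ v) ≡ occ x u + occ x v
occ-++ x [] v = refl
occ-++ x (y ∷ u) v with x ≡ᵇ y
... | true = cong suc (occ-++ x u v)
... | false = occ-++ x u v

occ-none : ∀ x w → (∀ c → c < length w → at 0 w c ≢ x) → occ x w ≡ 0
occ-none x [] h = refl
occ-none x (y ∷ w) h rewrite ≢⇒≡ᵇ x y (h 0 (s≤s z≤n) ∘ sym) = occ-none x w (λ c l → h (suc c) (s≤s l))

occ-tail≤ : ∀ x y w → occ x w ≤ occ x (y ∷ w)
occ-tail≤ x y w with x ≡ᵇ y
... | true = n≤1+n _
... | false = ≤-refl

-- Letter counts of neighbouring rows are compared by matching positions. The offset `s` aligns the
-- part of a row right of a marked cell with a complete row.
occ-emb : ∀ a b s V W → (∀ c → c < length V → at 0 V c ≡ a → s + c < length W × at 0 W (s + c) ≡ b) → occ a V ≤ occ b W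
occ-emb a b (suc s) V [] h = ≤-reflexive (occ-none a V (λ c l e → n≮0 (proj₁ (h c l e))))
occ-emb a b (suc s) V (y ∷ W) h =
  ≤-trans (occ-emb a b s V W (λ c l e → ≤-pred (proj₁ (h c l e)) , proj₂ (h c l e))) (occ-tail≤ b y W)
occ-emb a b zero [] W h = z≤n
occ-emb a b zero (x ∷ V) [] h = ≤-reflexive (occ-none a (x ∷ V) (λ c l e → n≮0 (proj₁ (h c l e))))
occ-emb a b zero (x ∷ V) (y ∷ W) h with a ≟ x
... | no ne rewrite ≢⇒≡ᵇ a x ne =
    ≤-trans (occ-emb a b zero V W (λ c l e → ≤-pred (proj₁ (h (suc c) (s≤s l) e)) , proj₂ (h (suc c) (s≤s l) e))) (occ-tail≤ b y W)
... | yes refl with proj₂ (h 0 (s≤s z≤n) refl)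
...   | refl rewrite ≡ᵇ-refl a | ≡ᵇ-refl b =
    s≤s (occ-emb a b zero V W (λ c l e → ≤-pred (proj₁ (h (suc c) (s≤s l) e)) , proj₂ (h (suc c) (s≤s l) e)))

occ-emb-< : ∀ a b s V W c₁ → (∀ c → c < length V → at 0 V c ≡ a → s + c < length W × at 0 W (s + c) ≡ b) →
  s + c₁ < length W → at 0 W (s + c₁) ≡ b → ¬ (c₁ < length V × at 0 V c₁ ≡ a) → occ a V < occ b W
occ-emb-< a b (suc s) V (y ∷ W) c₁ h (s≤s l) e no' =
  ≤-trans (occ-emb-< a b s V W c₁ (λ c l e → ≤-pred (proj₁ (h c l e)) , proj₂ (h c l e)) l e no') (occ-tail≤ b y W)
occ-emb-< a b zero [] (y ∷ W) zero h l refl no' rewrite ≡ᵇ-refl y = s≤s z≤n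
occ-emb-< a b zero [] (y ∷ W) (suc c₁) h (s≤s l) e no' =
  ≤-trans (occ-emb-< a b zero [] W c₁ (λ c ()) l e (λ ())) (occ-tail≤ b y W)
occ-emb-< a b zero (x ∷ V) (y ∷ W) zero h l refl no'
  rewrite ≢⇒≡ᵇ a x (λ { refl → no' (s≤s z≤n , refl) }) | ≡ᵇ-refl y =
    s≤s (occ-emb a y zero V W (λ c l e → ≤-pred (proj₁ (h (suc c) (s≤s l) e)) , proj₂ (h (suc c) (s≤s l) e)))
occ-emb-< a b zero (x ∷ V) (y ∷ W) (suc c₁) h (s≤s l) e no' with a ≟ x
... | no ne rewrite ≢⇒≡ᵇ a x ne =
    ≤-trans (occ-emb-< a b zero V W c₁ (λ c l e → ≤-pred (proj₁ (h (suc c) (s≤s l) e)) , proj₂ (h (suc c) (s≤s l) e)) l e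
      (λ (p , q) → no' (s≤s p , q))) (occ-tail≤ b y W)
... | yes refl with proj₂ (h 0 (s≤s z≤n) refl)
...   | refl rewrite ≡ᵇ-refl a | ≡ᵇ-refl b =
    s≤s (occ-emb-< a b zero V W c₁ (λ c l e → ≤-pred (proj₁ (h (suc c) (s≤s l) e)) , proj₂ (h (suc c) (s≤s l) e)) l e
      (λ (p , q) → no' (s≤s p , q)))

at-++ˡ : ∀ (A B : List ℕ) c → c < length A → at 0 (A ++ B) c ≡ at 0 A c
at-++ˡ (x ∷ A) B zero l = refl
at-++ˡ (x ∷ A) B (suc c) (s≤s l) = at-++ˡ A B c l

at-++ʳ : ∀ (A B : List ℕ) c → at 0 (A ++ B) (length A + c) ≡ at 0 B c
at-++ʳ [] B c = refl
at-++ʳ (x ∷ A) B c = at-++ʳ A B c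

at-mid : ∀ (A B : List ℕ) x → at 0 (A ++ x ∷ B) (length A) ≡ x
at-mid [] B x = refl
at-mid (y ∷ A) B x = at-mid A B x

at-mid-≢ : ∀ (A B : List ℕ) x y c → c ≢ length A → at 0 (A ++ x ∷ B) c ≡ at 0 (A ++ y ∷ B) c
at-mid-≢ [] B x y zero ne = ⊥-elim (ne refl)
at-mid-≢ [] B x y (suc c) ne = refl
at-mid-≢ (z ∷ A) B x y zero ne = refl
at-mid-≢ (z ∷ A) B x y (suc c) ne = at-mid-≢ A B x y c (ne ∘ cong suc)

length-mid : ∀ (A B : List ℕ) x y → length (A ++ x ∷ B) ≡ length (A ++ y ∷ B)
length-mid A B x y = trans (length-++ A) (sym (length-++ A))

Sorted : List ℕ → Set
Sorted w = ∀ c c' → c ≤ c' → c' < length w → at 0 w c ≤ at 0 w c'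

linked⇒sorted : ∀ {w} → Linked _≤_ w → Sorted w
linked⇒sorted {[]} l c c' p ()
linked⇒sorted {x ∷ []} l zero zero p q = ≤-refl
linked⇒sorted {x ∷ []} l c (suc c') p (s≤s ())
linked⇒sorted {x ∷ y ∷ w} (h ∷ l) zero zero p q = ≤-refl
linked⇒sorted {x ∷ y ∷ w} (h ∷ l) zero (suc c') p (s≤s q) = ≤-trans h (linked⇒sorted l 0 c' z≤n q)
linked⇒sorted {x ∷ y ∷ w} (h ∷ l) (suc c) (suc c') (s≤s p) (s≤s q) = linked⇒sorted l c c' p q

sorted⇒linked : ∀ {w} → (∀ c → suc c < length w → at 0 w c ≤ at 0 w (suc c)) → Linked _≤_ w
sorted⇒linked {[]} h = []
sorted⇒linked {x ∷ []} h = [-]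
sorted⇒linked {x ∷ y ∷ w} h = h 0 (s≤s (s≤s z≤n)) ∷ sorted⇒linked (λ c l → h (suc c) (s≤s l))

cut : ∀ i w → Sorted w → Σ (List ℕ) λ U → Σ (List ℕ) λ V → w ≡ U ++ V ×
  (∀ c → c < length U → at 0 U c ≤ i) × (∀ c → c < length V → i < at 0 V c)
cut i [] s = [] , [] , refl , (λ c ()) , (λ c ())
cut i (x ∷ w) s with x ≤? i
... | no g = [] , x ∷ w , refl , (λ c ()) , (λ c l → <-≤-trans (≰⇒> g) (s 0 c z≤n l))
... | yes l with cut i w (λ c c' p q → s (suc c) (suc c') (s≤s p) (s≤s q))
...   | U , V , refl , hu , hv = x ∷ U , V , refl , (λ { zero _ → l ; (suc c) (s≤s q) → hu c q }) , hv

anyB : ℕ → (ℕ → Bool) → Bool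
anyB zero f = false
anyB (suc N) f = f N ∨ anyB N f

anyB-intro : ∀ N f k → k < N → f k ≡ true → anyB N f ≡ true
anyB-intro (suc N) f k l h with m≤n⇒m<n∨m≡n (≤-pred l)
... | inj₂ refl = cong (_∨ anyB N f) h
... | inj₁ l' = trans (cong (f N ∨_) (anyB-intro N f k l' h)) (Bool.∨-zeroʳ (f N))

anyB-elim : ∀ N f → anyB N f ≡ true → Σ ℕ λ k → k < N × f k ≡ true
anyB-elim (suc N) f h with bool? (f N)
... | inj₁ t = N , ≤-refl , t
... | inj₂ t with anyB-elim N f (trans (sym (cong (_∨ anyB N f) t)) h)
...   | k , l , e = k , m<n⇒m<1+n l , e

seg-compare : ∀ a b R R' k k' d → (∀ j → j < d → occ a (R (k + j)) ≤ occ b (R' (k' + j))) →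
  occ a (seg R k d) ≤ occ b (seg R' k' d)
seg-compare a b R R' k k' zero h = z≤n
seg-compare a b R R' k k' (suc d) h = subst₂ _≤_ (sym (occ-++ a (R (k + d)) _)) (sym (occ-++ b (R' (k' + d)) _))
  (+-mono-≤ (h d ≤-refl) (seg-compare a b R R' k k' d (λ j l → h j (m<n⇒m<1+n l))))

occ-seg-low : ∀ x R a d → occ x (seg R a (suc d)) ≡ occ x (seg R (suc a) d) + occ x (R a)
occ-seg-low x R a zero = trans (occ-++ x (R (a + 0)) []) (trans (+-identityʳ _) (cong (occ x ∘ R) (+-identityʳ a)))
occ-seg-low x R a (suc d) = begin
  occ x (R (a + suc d) ++ seg R a (suc d)) ≡⟨ occ-++ x (R (a + suc d)) _ ⟩
  occ x (R (a + suc d)) + occ x (seg R a (suc d)) ≡⟨ cong₂ _+_ (cong (occ x ∘ R) (+-suc a d)) (occ-seg-low x R a d) ⟩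
  occ x (R (suc a + d)) + (occ x (seg R (suc a) d) + occ x (R a)) ≡⟨ +-assoc (occ x (R (suc a + d))) _ _ ⟨
  occ x (R (suc a + d)) + occ x (seg R (suc a) d) + occ x (R a) ≡⟨ cong (_+ occ x (R a)) (occ-++ x (R (suc a + d)) _) ⟨
  occ x (seg R (suc a) (suc d)) + occ x (R a) ∎
  where open ≡-Reasoning

record Semistandard (R : ℕ → List ℕ) : Set where
  field
    len  : ∀ k → length (R (suc k)) ≤ length (R k)
    rows : ∀ k → Sorted (R k)
    cols : ∀ k c → c < length (R (suc k)) → at 0 (R k) c < at 0 (R (suc k)) c

module Column (R : ℕ → List ℕ) (ss : Semistandard R) (n : ℕ) (empty : ∀ k → n ≤ k → R k ≡ []) where
  open Semistandard ss

  ent : ℕ → ℕ → ℕ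
  ent k c = at 0 (R k) c

  E : ℕ → ℕ → ℕ → Set
  E k c x = c < length (R k) × ent k c ≡ x

  colset : ℕ → ISet
  colset c x = anyB n (λ k → (c <ᵇ length (R k)) ∧ (x ≡ᵇ ent k c))

  E⇒row< : ∀ {k c x} → E k c x → k < n
  E⇒row< {k} (l , _) with k <? n
  ... | yes p = p
  ... | no p = ⊥-elim (n≮0 (subst (_ <_) (cong length (empty k (≮⇒≥ p))) l))

  E⇒colset : ∀ {k c x} → E k c x → colset c x ≡ true
  E⇒colset {k} {c} {x} (l , e) = anyB-intro n _ k (E⇒row< (l , e))
    (cong₂ _∧_ (<ᵇ-true c (length (R k)) l) (trans (cong (x ≡ᵇ_) e) (≡ᵇ-refl x)))

  colset⇒E : ∀ {c x} → colset c x ≡ true → Σ ℕ λ k → E k c x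
  colset⇒E {c} {x} h with anyB-elim n _ h
  ... | k , _ , e with c <ᵇ length (R k) in l
  ...   | true = k , <ᵇ-true⁻ c _ l , sym (≡ᵇ-true x _ e)

  colset-false : ∀ {k c x} → colset c x ≡ false → ¬ E k c x
  colset-false f e = bool-absurd (E⇒colset e) f

  len* : ∀ {j k} → j ≤ k → length (R k) ≤ length (R j)
  len* {j} {zero} z≤n = ≤-refl
  len* {j} {suc k} l with m≤n⇒m<n∨m≡n l
  ... | inj₂ refl = ≤-refl
  ... | inj₁ (s≤s l') = ≤-trans (len k) (len* l')

  cols* : ∀ {j k c} → j < k → c < length (R k) → ent j c < ent k c
  cols* {j} {suc k} {c} (s≤s l) lc with m≤n⇒m<n∨m≡n l
  ... | inj₂ refl = cols j c lc
  ... | inj₁ l' = <-trans (cols* l' (<-≤-trans lc (len k))) (cols k c lc)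

  cols≤ : ∀ {j k c} → j ≤ k → c < length (R k) → ent j c ≤ ent k c
  cols≤ l lc with m≤n⇒m<n∨m≡n l
  ... | inj₂ refl = ≤-refl
  ... | inj₁ l' = <⇒≤ (cols* l' lc)

  E-unique : ∀ {j k c x} → E j c x → E k c x → j ≡ k
  E-unique {j} {k} (l , e) (l' , e') with <-cmp j k
  ... | tri≈ _ p _ = p
  ... | tri< p _ _ = ⊥-elim (<-irrefl (trans e (sym e')) (cols* p l'))
  ... | tri> _ _ p = ⊥-elim (<-irrefl (trans e' (sym e)) (cols* p l))

  next-row : ∀ {j k c x} → E j c x → E k c (suc x) → k ≡ suc j
  next-row {j} {k} {c} {x} (l , e) (l' , e') with <-cmp k (suc j)
  ... | tri≈ _ p _ = p
  ... | tri< (s≤s p) _ _ = ⊥-elim (1+n≰n (subst₂ _≤_ e' e (cols≤ p l)))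
  ... | tri> _ _ p = ⊥-elim (1+n≰n (≤-trans (s≤s (subst (_< ent (suc j) c) e (cols* ≤-refl (<-≤-trans l' (len* (<⇒≤ p))))))
                      (subst (ent (suc j) c <_) e' (cols* p l'))))

  module _ (i : ℕ) where

    -- Bracket conditions hold for words cut anywhere, so a sorted row may be cut after its last
    -- letter not exceeding `i`: one part carries all its `i`, the other all its `suc i`.
    upper : ∀ k → Σ (List ℕ) λ U → Σ (List ℕ) λ V → R k ≡ U ++ V ×
      occ i U ≡ occ i (R k) × occ (suc i) U ≡ 0 × occ (suc i) V ≡ occ (suc i) (R k) × occ i V ≡ 0
    upper k with cut i (R k) (rows k)
    ... | U , V , e , hu , hv = U , V , e ,
      trans (sym (+-identityʳ _)) (trans (cong (occ i U +_) (sym v0)) (trans (sym (occ-++ i U V)) (cong (occ i) (sym e)))) ,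
      u0 , trans (cong (_+ occ (suc i) V) (sym u0)) (trans (sym (occ-++ (suc i) U V)) (cong (occ (suc i)) (sym e))) , v0
      where
      u0 : occ (suc i) U ≡ 0
      u0 = occ-none (suc i) U (λ c l p → 1+n≰n (subst (_≤ i) p (hu c l)))
      v0 : occ i V ≡ 0
      v0 = occ-none i V (λ c l p → <-irrefl (sym p) (hv c l))

    -- Left of the next single column with i + 1, every i of the rows k .. k + d has an i + 1 below it.
    left-excess : ∀ k d c₁ V → E (k + suc d) c₁ (suc i) → ¬ (colset c₁ i ≡ true) →
      (∀ j c → k ≤ j → j < k + suc d → c₁ < c → E j c i → colset c (suc i) ≡ true) →
      occ (suc i) V ≡ occ (suc i) (R (k + suc d)) →
      occ i (seg R k (suc d)) < occ (suc i) (V ++ seg R (suc k) d)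
    left-excess k d c₁ V e₁ no₁ h v = subst₂ _<_ (sym (occ-++ i (R (k + d)) _)) (sym (trans (occ-++ (suc i) V _) (cong (_+ _) v)))
      (+-mono-<-≤ top (seg-compare i (suc i) R R k (suc k) d (λ j l →
        occ-emb i (suc i) 0 (R (k + j)) (R (suc k + j)) (λ c lc ec → below (k + j) c (m≤m+n k j) (+-monoʳ-< k (m<n⇒m<1+n l)) (lc , ec)))))
      where
      below : ∀ j c → k ≤ j → j < k + suc d → E j c i → E (suc j) c (suc i)
      below j c kj jk ej with colset⇒E (h j c kj jk c₁<c ej)
        where
        c₁<c : c₁ < c
        c₁<c with c₁ <? c
        ... | yes l = l
        ... | no l = ⊥-elim (<⇒≱ small (subst (_≤ ent j c₁) (proj₂ ej) (rows j c c₁ (≮⇒≥ l) c₁j)))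
          where
          c₁j : c₁ < length (R j)
          c₁j = <-≤-trans (proj₁ e₁) (len* (<⇒≤ jk))
          small : ent j c₁ < i
          small = ≤∧≢⇒< (≤-pred (subst (ent j c₁ <_) (proj₂ e₁) (cols* jk (proj₁ e₁)))) (λ p → no₁ (E⇒colset (c₁j , p)))
      ... | k₂ , e₂ = subst (λ k → E k c (suc i)) (next-row ej e₂) e₂
      e₁' : E (suc (k + d)) c₁ (suc i)
      e₁' = subst (λ k → E k c₁ (suc i)) (+-suc k d) e₁
      top : occ i (R (k + d)) < occ (suc i) (R (k + suc d))
      top = subst (λ j → occ i (R (k + d)) < occ (suc i) (R j)) (sym (+-suc k d))
        (occ-emb-< i (suc i) 0 (R (k + d)) (R (suc (k + d))) c₁
          (λ c lc ec → below (k + d) c (m≤m+n k d) (+-monoʳ-< k ≤-refl) (lc , ec))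
          (proj₁ e₁') (proj₂ e₁') (λ e → no₁ (E⇒colset e)))

    V-excess : ∀ k V c₁ → E k c₁ (suc i) → occ (suc i) V ≡ occ (suc i) (R k) → 0 < occ (suc i) V
    V-excess k V c₁ (l , e) v = subst (0 <_) (sym v) (occ-emb-< (suc i) (suc i) 0 [] (R k) c₁ (λ c ()) l e (λ ()))

    -- The mirror image; B is the part of row k₁ + d + 1 right of the column s.
    right-excess : ∀ k₁ d c₁ s B → E k₁ c₁ i → s ≤ c₁ → ¬ (colset c₁ (suc i) ≡ true) →
      (∀ c → c < length B → at 0 B c ≡ suc i → E (k₁ + d) (s + c) i) →
      (∀ c → s + c ≡ c₁ → ¬ (c < length B × at 0 B c ≡ suc i)) →
      (∀ j c → k₁ ≤ j → j < k₁ + d → E (suc j) c (suc i) → E j c i) →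
      occ (suc i) B + occ (suc i) (seg R (suc k₁) d) < occ i (seg R (suc k₁) d) + occ i (R k₁)
    right-excess k₁ zero c₁ s B (l , e) sc no₁ hB hB' h = subst₂ _<_ (sym (+-identityʳ _)) refl
      (occ-emb-< (suc i) i s B (R k₁) (c₁ ∸ s)
        (λ c lc ec → subst (λ k → E k (s + c) i) (+-identityʳ k₁) (hB c lc ec))
        (subst (_< length (R k₁)) (sym eq) l) (trans (cong (ent k₁) eq) e) (hB' (c₁ ∸ s) eq))
      where
      eq : s + (c₁ ∸ s) ≡ c₁
      eq = m+[n∸m]≡n sc
    right-excess k₁ (suc d) c₁ s B (l , e) sc no₁ hB hB' h = subst₂ _<_
      (trans (+-assoc (occ (suc i) B) (occ (suc i) (seg R (suc (suc k₁)) d)) (occ (suc i) (R (suc k₁)))) (cong (occ (suc i) B +_) (sym (occ-seg-low (suc i) R (suc k₁) d))))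
      (cong (_+ occ i (R k₁)) (sym (occ-++ i (R (suc k₁ + d)) (seg R (suc k₁) d))))
      (+-mono-≤-< (+-mono-≤
          (occ-emb (suc i) i s B (R (suc k₁ + d)) (λ c lc ec → subst (λ k → E k (s + c) i) (+-suc k₁ d) (hB c lc ec)))
          (seg-compare (suc i) i R R (suc (suc k₁)) (suc k₁) d (λ j lj →
            occ-emb (suc i) i 0 (R (suc (suc k₁) + j)) (R (suc k₁ + j)) (λ c lc ec →
              h (suc k₁ + j) c (≤-trans (n≤1+n k₁) (m≤m+n (suc k₁) j)) (subst (suc k₁ + j <_) (sym (+-suc k₁ d)) (+-monoʳ-< (suc k₁) lj)) (lc , ec)))))
          (occ-emb-< (suc i) i 0 (R (suc k₁)) (R k₁) c₁ (λ c lc ec → h k₁ c ≤-refl (m<m+n k₁ (s≤s z≤n)) (lc , ec)) l e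
            (λ e' → no₁ (E⇒colset e'))))

    find-plus : ∀ N c₁ → (Σ ℕ λ c → c₁ < c × c < N × Plus i (colset c)) ⊎
      (∀ c → c₁ < c → c < N → colset c i ≡ true → colset c (suc i) ≡ true)
    find-plus zero c₁ = inj₂ (λ c _ ())
    find-plus (suc N) c₁ with find-plus N c₁
    ... | inj₁ (c , p , q , pl) = inj₁ (c , p , m<n⇒m<1+n q , pl)
    ... | inj₂ h with c₁ <? N | plus? i (colset N)
    ...   | yes l | yes pl = inj₁ (N , l , ≤-refl , pl)
    ...   | no g | _ = inj₂ (λ c p q → [ h c p , (λ e → ⊥-elim (g (subst (c₁ <_) e p))) ]′ (m≤n⇒m<n∨m≡n (≤-pred q)))
    ...   | yes _ | no np = inj₂ (λ c p q t → [ (λ l → h c p l t) , (λ { refl → here t }) ]′ (m≤n⇒m<n∨m≡n (≤-pred q)))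
      where
      here : colset N i ≡ true → colset N (suc i) ≡ true
      here t with bool? (colset N (suc i))
      ... | inj₁ t' = t'
      ... | inj₂ f = ⊥-elim (np (t , f))

    find-minus : ∀ N c₁ → (Σ ℕ λ c → c₁ < c × c < N × Minus i (colset c)) ⊎
      (∀ c → c₁ < c → c < N → colset c (suc i) ≡ true → colset c i ≡ true)
    find-minus zero c₁ = inj₂ (λ c _ ())
    find-minus (suc N) c₁ with find-minus N c₁
    ... | inj₁ (c , p , q , mi) = inj₁ (c , p , m<n⇒m<1+n q , mi)
    ... | inj₂ h with c₁ <? N | minus? i (colset N)
    ...   | yes l | yes mi = inj₁ (N , l , ≤-refl , mi)
    ...   | no g | _ = inj₂ (λ c p q → [ h c p , (λ e → ⊥-elim (g (subst (c₁ <_) e p))) ]′ (m≤n⇒m<n∨m≡n (≤-pred q)))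
    ...   | yes _ | no nm = inj₂ (λ c p q t → [ (λ l → h c p l t) , (λ { refl → here t }) ]′ (m≤n⇒m<n∨m≡n (≤-pred q)))
      where
      here : colset N (suc i) ≡ true → colset N i ≡ true
      here t with bool? (colset N i)
      ... | inj₁ t' = t'
      ... | inj₂ f = ⊥-elim (nm (f , t))

    -- Let `suc i` be unmatched in column `c₁` at row `k₁`. Every `i` in a higher row lies right of
    -- `c₁`. If no column there is plus, each such `i` has a `suc i` directly below, and the `suc i`
    -- in column `c₁` is extra; the word from the `suc i` of row `k₁` on then opens more than it
    -- closes.
    none-left : SufOK i (seg R 0 n) → ∀ c₁ → Minus i (colset c₁) → Σ ℕ λ c → c₁ < c × Plus i (colset c)
    none-left ok c₁ (f , t) with colset⇒E t
    ... | k₁ , e₁ with find-plus (length (R 0)) c₁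
    ...   | inj₁ (c , l , _ , pl) = c , l , pl
    ...   | inj₂ h = ⊥-elim (contra k₁ e₁)
      where
      noPlus : ∀ j c → c₁ < c → E j c i → colset c (suc i) ≡ true
      noPlus j c l e = h c l (<-≤-trans (proj₁ e) (len* z≤n)) (E⇒colset e)
      contra : ∀ k₁ → E k₁ c₁ (suc i) → ⊥
      contra k₁ e₁ with upper k₁
      ... | U , V , eU , _ , _ , v , v0 = go k₁ e₁ v suf
        where
        lk : k₁ < n
        lk = E⇒row< e₁
        word : seg R 0 n ≡ (seg R (suc k₁) (n ∸ suc k₁) ++ U) ++ (V ++ seg R 0 k₁)
        word = begin
          seg R 0 n ≡⟨ cong (seg R 0) (m+[n∸m]≡n lk) ⟨
          seg R 0 (suc k₁ + (n ∸ suc k₁)) ≡⟨ seg-append R 0 (suc k₁) (n ∸ suc k₁) ⟩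
          seg R (suc k₁) (n ∸ suc k₁) ++ (R k₁ ++ seg R 0 k₁) ≡⟨ cong (λ r → seg R (suc k₁) (n ∸ suc k₁) ++ (r ++ seg R 0 k₁)) eU ⟩
          seg R (suc k₁) (n ∸ suc k₁) ++ ((U ++ V) ++ seg R 0 k₁) ≡⟨ cong (seg R (suc k₁) (n ∸ suc k₁) ++_) (++-assoc U V _) ⟩
          seg R (suc k₁) (n ∸ suc k₁) ++ (U ++ (V ++ seg R 0 k₁)) ≡⟨ ++-assoc (seg R (suc k₁) (n ∸ suc k₁)) U _ ⟨
          (seg R (suc k₁) (n ∸ suc k₁) ++ U) ++ (V ++ seg R 0 k₁) ∎
          where open ≡-Reasoning
        suf : occ (suc i) V + occ (suc i) (seg R 0 k₁) ≤ occ i (seg R 0 k₁)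
        suf = subst₂ _≤_ (occ-++ (suc i) V (seg R 0 k₁)) (trans (occ-++ i V (seg R 0 k₁)) (cong (_+ occ i (seg R 0 k₁)) v0))
          (ok (seg R (suc k₁) (n ∸ suc k₁) ++ U) (V ++ seg R 0 k₁) word)
        go : ∀ k₁ → E k₁ c₁ (suc i) → occ (suc i) V ≡ occ (suc i) (R k₁) →
          occ (suc i) V + occ (suc i) (seg R 0 k₁) ≤ occ i (seg R 0 k₁) → ⊥
        go zero e₁ v s = n≮0 (≤-trans (V-excess 0 V c₁ e₁ v) (≤-trans (m≤m+n _ _) s))
        go (suc d) e₁ v s = 1+n≰n (≤-trans (left-excess 0 d c₁ V e₁ (λ t → bool-absurd t f)
            (λ j c _ _ → noPlus j c) v)
          (≤-trans (≤-reflexive (occ-++ (suc i) V _)) (≤-trans (+-monoʳ-≤ (occ (suc i) V)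
            (≤-trans (m≤m+n _ _) (≤-reflexive (sym (occ-seg-low (suc i) R 0 d))))) s)))

    module _ (k e : ℕ) (A B : List ℕ) (size : suc k + e ≡ n) (rowE : R k ≡ A ++ suc i ∷ B)
             (so : SufOK i (seg R (suc k) e ++ A)) (po : PreOK i 0 (B ++ seg R 0 k)) where

      c₀ : ℕ
      c₀ = length A

      Ek : E k c₀ (suc i)
      Ek = subst (c₀ <_) (sym (trans (cong length rowE) (trans (length-++ A) (+-suc c₀ (length B))))) (s≤s (m≤m+n c₀ (length B))) ,
           trans (cong (λ r → at 0 r c₀) rowE) (at-mid A B (suc i))

      A-ent : ∀ c → c < c₀ → at 0 A c ≡ ent k c
      A-ent c l = sym (trans (cong (λ r → at 0 r c) rowE) (at-++ˡ A (suc i ∷ B) c l))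

      B-ent : ∀ c → c < length B → suc c₀ + c < length (R k) × at 0 B c ≡ ent k (suc c₀ + c)
      B-ent c l = subst₂ _<_ (+-suc c₀ c) (sym (trans (cong length rowE) (length-++ A))) (+-monoʳ-< c₀ (s≤s l)) ,
        sym (trans (cong (λ r → at 0 r (suc c₀ + c)) rowE)
          (trans (cong (at 0 (A ++ suc i ∷ B)) (sym (+-suc c₀ c))) (at-++ʳ A (suc i ∷ B) (suc c))))

      -- As `A` is sorted, a `suc i` in it would start a suffix of the preceding word that contains
      -- no `i`, so it would be an unmatched bracket further left.
      first-in-row : ∀ c → c < c₀ → ent k c ≢ suc i
      first-in-row c l p with cut i A sA
        where
        sA : Sorted A
        sA c c' q r = subst₂ _≤_ (sym (A-ent c (≤-<-trans q r))) (sym (A-ent c' r)) (rows k c c' q (<-trans r (proj₁ Ek)))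
      ... | U , V , eA , hu , hv = n≮0 (≤-trans pos (≤-reflexive zeroA))
        where
        v0 : occ i V ≡ 0
        v0 = occ-none i V (λ c l p → <-irrefl (sym p) (hv c l))
        u0 : occ (suc i) U ≡ 0
        u0 = occ-none (suc i) U (λ c l p → 1+n≰n (subst (_≤ i) p (hu c l)))
        v1 : occ (suc i) V ≡ 0
        v1 = n≤0⇒n≡0 (≤-trans (so (seg R (suc k) e ++ U) V
               (trans (cong (seg R (suc k) e ++_) eA) (sym (++-assoc (seg R (suc k) e) U V)))) (≤-reflexive v0))
        zeroA : occ (suc i) A ≡ 0
        zeroA = trans (cong (occ (suc i)) eA) (trans (occ-++ (suc i) U V) (cong₂ _+_ u0 v1))
        pos : 0 < occ (suc i) A
        pos = occ-emb-< (suc i) (suc i) 0 [] A c (λ c ()) l (trans (A-ent c l) p) (λ ())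

      -- An `i` above the marked entry would force an `i` above every `suc i` of `B` as well. The
      -- `i` of row `j` would then outnumber the `suc i` read after the marked one and close its
      -- bracket.
      no-i : ∀ j → ¬ E j c₀ i
      no-i j ej with next-row ej Ek
      ... | refl with upper j
      ...   | U , V , eU , u , u0 , v , v0 = 1+n≰n (≤-trans emb (≤-trans (m≤n+m _ (occ i B)) bound))
        where
        bound : occ i B + occ i (R j) ≤ occ (suc i) B
        bound = subst₂ _≤_ (trans (occ-++ i B U) (cong (occ i B +_) u))
          (trans (occ-++ (suc i) B U) (trans (cong (occ (suc i) B +_) u0) (+-identityʳ _)))
          (po (B ++ U) (V ++ seg R 0 j) (trans (cong (B ++_) (trans (cong (_++ seg R 0 j) eU) (++-assoc U V (seg R 0 j))))
            (sym (++-assoc B U (V ++ seg R 0 j)))))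
        emb : suc (occ (suc i) B) ≤ occ i (R j)
        emb = subst (_≤ occ i (R j)) (occ-open i B) (occ-emb (suc i) i c₀ (suc i ∷ B) (R j) h)
          where
          h : ∀ c → c < length (suc i ∷ B) → at 0 (suc i ∷ B) c ≡ suc i → c₀ + c < length (R j) × ent j (c₀ + c) ≡ i
          h zero l p = subst (λ c → c < length (R j) × ent j c ≡ i) (sym (+-identityʳ c₀)) ej
          h (suc c) (s≤s l) p = subst (λ c → c < length (R j) × ent j c ≡ i) (sym (+-suc c₀ c))
            (lj , ≤-antisym (≤-pred (subst (ent j (suc c₀ + c) <_) (trans (sym (proj₂ (B-ent c l))) p) (cols j _ (proj₁ (B-ent c l)))))
              (subst (_≤ ent j (suc c₀ + c)) (proj₂ ej) (rows j c₀ (suc c₀ + c) (≤-trans (n≤1+n c₀) (m≤m+n (suc c₀) c)) lj)))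
            where
            lj : suc c₀ + c < length (R j)
            lj = <-≤-trans (proj₁ (B-ent c l)) (len j)

      is-minus : Minus i (colset c₀)
      is-minus = low-false , E⇒colset Ek
        where
        low-false : colset c₀ i ≡ false
        low-false with bool? (colset c₀ i)
        ... | inj₂ f = f
        ... | inj₁ t = ⊥-elim (no-i _ (proj₂ (colset⇒E t)))

      -- The `suc i` of column `c₁` lies in a row below `k`, since row `k` has none before `c₀`.
      -- With no plus column in between, each `i` in the rows from `k` down to it has a `suc i`
      -- below, and the word before the marked letter would leave a bracket open.
      plus-left : ∀ c₁ → c₁ < c₀ → Minus i (colset c₁) → Σ ℕ λ c → c₁ < c × c < c₀ × Plus i (colset c)
      plus-left c₁ l₁ (f , t) with colset⇒E t
      ... | k₁ , e₁ with find-plus c₀ c₁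
      ...   | inj₁ found = found
      plus-left c₁ l₁ (f , t) | k₁ , e₁ | inj₂ h with <-cmp k₁ k
      ... | tri< l _ _ = ⊥-elim (<-irrefl refl (<-≤-trans (subst₂ _<_ (proj₂ e₁) refl (cols* l lk)) (subst (ent k c₁ ≤_) (proj₂ Ek) (rows k c₁ c₀ (<⇒≤ l₁) (proj₁ Ek)))))
        where
        lk : c₁ < length (R k)
        lk = <-trans l₁ (proj₁ Ek)
      ... | tri≈ _ refl _ = ⊥-elim (first-in-row c₁ l₁ (proj₂ e₁))
      ... | tri> _ _ l = ⊥-elim (contra (k₁ ∸ suc k) (subst (λ k → E k c₁ (suc i)) (sym (trans (+-suc k _) (m+[n∸m]≡n l))) e₁))
        where
        noPlus : ∀ j c → k ≤ j → c₁ < c → E j c i → colset c (suc i) ≡ true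
        noPlus j c kj l e with c <? c₀
        ... | yes lc = h c l lc (E⇒colset e)
        ... | no g = ⊥-elim (1+n≰n (subst₂ _≤_ (proj₂ Ek) (proj₂ e)
                (≤-trans (cols≤ kj (≤-<-trans (≮⇒≥ g) (proj₁ e))) (rows j c₀ c (≮⇒≥ g) (proj₁ e)))))
        contra : ∀ d → E (k + suc d) c₁ (suc i) → ⊥
        contra d e₁ with upper (k + suc d)
        ... | U , V , eU , _ , _ , v , v0 = 1+n≰n (≤-trans
            (left-excess k d c₁ V e₁ (λ t → bool-absurd t f) (λ j c kj _ → noPlus j c kj) v)
            (≤-trans (≤-reflexive (occ-++ (suc i) V _)) (≤-trans (+-monoʳ-≤ (occ (suc i) V) (m≤m+n _ (occ (suc i) A)))
              (≤-trans suf (≤-trans (+-monoʳ-≤ (occ i (seg R (suc k) d)) A≤) (≤-reflexive (sym (occ-seg-low i R k d))))))))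
          where
          A≤ : occ i A ≤ occ i (R k)
          A≤ = ≤-trans (m≤m+n (occ i A) (occ i (suc i ∷ B))) (≤-reflexive (trans (sym (occ-++ i A (suc i ∷ B))) (cong (occ i) (sym rowE))))
          lde : suc d ≤ e
          lde = +-cancelˡ-≤ (suc k) (suc d) e (subst (suc (k + suc d) ≤_) (sym size) (E⇒row< e₁))
          e₂ = e ∸ suc d
          word : seg R (suc k) e ++ A ≡ (seg R (suc k + suc d) e₂ ++ U) ++ (V ++ (seg R (suc k) d ++ A))
          word = begin
            seg R (suc k) e ++ A ≡⟨ cong (λ x → seg R (suc k) x ++ A) (m+[n∸m]≡n lde) ⟨
            seg R (suc k) (suc d + e₂) ++ A ≡⟨ cong (_++ A) (seg-append R (suc k) (suc d) e₂) ⟩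
            (W ++ (R (suc k + d) ++ seg R (suc k) d)) ++ A ≡⟨ cong (λ x → (W ++ (x ++ seg R (suc k) d)) ++ A) (trans (cong R (sym (+-suc k d))) eU) ⟩
            (W ++ ((U ++ V) ++ seg R (suc k) d)) ++ A ≡⟨ ++-assoc W _ A ⟩
            W ++ (((U ++ V) ++ seg R (suc k) d) ++ A) ≡⟨ cong (W ++_) (++-assoc (U ++ V) _ A) ⟩
            W ++ ((U ++ V) ++ (seg R (suc k) d ++ A)) ≡⟨ cong (W ++_) (++-assoc U V _) ⟩
            W ++ (U ++ (V ++ (seg R (suc k) d ++ A))) ≡⟨ ++-assoc W U _ ⟨
            (W ++ U) ++ (V ++ (seg R (suc k) d ++ A)) ∎
            where
            open ≡-Reasoning
            W = seg R (suc k + suc d) e₂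
          suf : occ (suc i) V + (occ (suc i) (seg R (suc k) d) + occ (suc i) A) ≤ occ i (seg R (suc k) d) + occ i A
          suf = subst₂ _≤_ (trans (occ-++ (suc i) V (seg R (suc k) d ++ A)) (cong (occ (suc i) V +_) (occ-++ (suc i) (seg R (suc k) d) A)))
            (trans (occ-++ i V (seg R (suc k) d ++ A)) (trans (cong (_+ occ i (seg R (suc k) d ++ A)) v0) (occ-++ i (seg R (suc k) d) A)))
            (so (seg R (suc k + suc d) e₂ ++ U) (V ++ (seg R (suc k) d ++ A)) word)

      -- The `i` of column `c₁` lies in a row `k₁` above `k`. With no minus column in between, each
      -- `suc i` read between the marked letter and the `i` of row `k₁` has an `i` above, and the
      -- `i` of column `c₁` is extra: a prefix of the word after the marked letter would close too
      -- much.
      minus-right : ∀ c₁ → c₀ < c₁ → Plus i (colset c₁) → Σ ℕ λ c → c₀ < c × c < c₁ × Minus i (colset c)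
      minus-right c₁ l₁ (t , f) with colset⇒E t
      ... | k₁ , e₁ with find-minus c₁ c₀
      ...   | inj₁ found = found
      minus-right c₁ l₁ (t , f) | k₁ , e₁ | inj₂ h with k₁ <? k
      ... | no g = ⊥-elim (1+n≰n (subst₂ _≤_ (proj₂ Ek) (proj₂ e₁)
                (≤-trans (rows k c₀ c₁ (<⇒≤ l₁) (<-≤-trans (proj₁ e₁) (len* (≮⇒≥ g)))) (cols≤ (≮⇒≥ g) (proj₁ e₁)))))
      ... | yes l = ⊥-elim (contra (k ∸ suc k₁) (m+[n∸m]≡n l))
        where
        above : ∀ j c → k₁ ≤ j → suc j < k ⊎ c₀ < c → suc j ≤ k → E (suc j) c (suc i) → E j c i
        above j c kj alt jk ej with colset⇒E (h c (c₀<c alt) c<c₁ (E⇒colset ej))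
          where
          c<c₁ : c < c₁
          c<c₁ with c <? c₁
          ... | yes p = p
          ... | no g = ⊥-elim (colset-false f (lj , ≤-antisym
                (subst (ent (suc j) c₁ ≤_) (proj₂ ej) (rows (suc j) c₁ c (≮⇒≥ g) (proj₁ ej)))
                (subst (_< ent (suc j) c₁) (proj₂ e₁) (cols* (s≤s kj) lj))))
            where
            lj : c₁ < length (R (suc j))
            lj = ≤-<-trans (≮⇒≥ g) (proj₁ ej)
          c₀<c : suc j < k ⊎ c₀ < c → c₀ < c
          c₀<c (inj₂ p) = p
          c₀<c (inj₁ p) with c₀ <? c
          ... | yes q = q
          ... | no g = ⊥-elim (<-irrefl (proj₂ ej) (≤-<-trans
                (rows (suc j) c c₀ (≮⇒≥ g) (<-≤-trans (proj₁ Ek) (len* (<⇒≤ p))))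
                (subst (ent (suc j) c₀ <_) (proj₂ Ek) (cols* p (proj₁ Ek)))))
        ... | k₂ , e₂ with next-row e₂ ej
        ...   | refl = e₂
        contra : ∀ d → suc k₁ + d ≡ k → ⊥
        contra d eqk with upper k₁
        ... | U , V , eU , u , u0 , _ , _ = 1+n≰n (≤-trans excess (≤-trans (m≤n+m _ (occ i B)) bound))
          where
          bound : occ i B + (occ i (seg R (suc k₁) d) + occ i (R k₁)) ≤ occ (suc i) B + occ (suc i) (seg R (suc k₁) d)
          bound = subst₂ _≤_
            (trans (occ-++ i B (seg R (suc k₁) d ++ U)) (cong (occ i B +_) (trans (occ-++ i (seg R (suc k₁) d) U) (cong (occ i (seg R (suc k₁) d) +_) u))))
            (trans (occ-++ (suc i) B (seg R (suc k₁) d ++ U)) (cong (occ (suc i) B +_) (trans (occ-++ (suc i) (seg R (suc k₁) d) U)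
              (trans (cong (occ (suc i) (seg R (suc k₁) d) +_) u0) (+-identityʳ _)))))
            (po (B ++ (seg R (suc k₁) d ++ U)) (V ++ seg R 0 k₁) word)
            where
            word : B ++ seg R 0 k ≡ (B ++ (seg R (suc k₁) d ++ U)) ++ (V ++ seg R 0 k₁)
            word = trans (cong (B ++_) (trans (trans (cong (seg R 0) (sym eqk)) (seg-append R 0 (suc k₁) d))
              (trans (cong (seg R (suc k₁) d ++_) (trans (cong (_++ seg R 0 k₁) eU) (++-assoc U V (seg R 0 k₁))))
                (sym (++-assoc (seg R (suc k₁) d) U (V ++ seg R 0 k₁)))))) (sym (++-assoc B (seg R (suc k₁) d ++ U) (V ++ seg R 0 k₁)))
          excess : occ (suc i) B + occ (suc i) (seg R (suc k₁) d) < occ i (seg R (suc k₁) d) + occ i (R k₁)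
          excess = right-excess k₁ d c₁ (suc c₀) B e₁ l₁ (λ t' → bool-absurd t' f)
            (λ c lc ec → above (k₁ + d) (suc c₀ + c) (m≤m+n k₁ d) (inj₂ (s≤s (m≤m+n c₀ c))) (≤-reflexive eqk)
              (subst (λ k → E k (suc c₀ + c) (suc i)) (sym eqk) (proj₁ (B-ent c lc) , trans (sym (proj₂ (B-ent c lc))) ec)))
            (λ c ec (lc , p) → colset-false f (subst (λ c → E k c (suc i)) ec (proj₁ (B-ent c lc) , trans (sym (proj₂ (B-ent c lc))) p)))
            (λ j c kj jl → above j c kj (inj₁ (subst (suc j <_) eqk (s≤s jl))) (subst (suc j ≤_) eqk (s≤s (<⇒≤ jl))))

-- Tableaux of a fixed shape as defining chains

module Tableaux (n : ℕ) where
  open Flags n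
  open Orthodontia n using (below-id; idF)

  all-at : ∀ {P : ℕ → Set} {w} → All P w → ∀ c → c < length w → P (at 0 w c)
  all-at (p ∷ a) zero l = p
  all-at (p ∷ a) (suc c) (s≤s l) = all-at a c l

  at-all : ∀ {P : ℕ → Set} w → (∀ c → c < length w → P (at 0 w c)) → All P w
  at-all [] h = []
  at-all (x ∷ w) h = h 0 (s≤s z≤n) ∷ at-all w (λ c l → h (suc c) (s≤s l))

  list-ext : ∀ (u v : List ℕ) → length u ≡ length v → (∀ c → c < length u → at 0 u c ≡ at 0 v c) → u ≡ v
  list-ext [] [] e h = refl
  list-ext (x ∷ u) (y ∷ v) e h = cong₂ _∷_ (h 0 (s≤s z≤n)) (list-ext u v (suc-injective e) (λ c l → h (suc c) (s≤s l)))

  at-replicate : ∀ l x c → c < l → at 0 (replicate l x) c ≡ x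
  at-replicate (suc l) x zero p = refl
  at-replicate (suc l) x (suc c) (s≤s p) = at-replicate l x c p

  anyB-cong : ∀ N f g → (∀ k → f k ≡ g k) → anyB N f ≡ anyB N g
  anyB-cong zero f g h = refl
  anyB-cong (suc N) f g h = cong₂ _∨_ (h N) (anyB-cong N f g h)

  colsetR : (ℕ → List ℕ) → ℕ → ISet
  colsetR R c x = anyB n (λ k → (c <ᵇ length (R k)) ∧ (x ≡ᵇ at 0 (R k) c))

  rv : ℕ → ℕ → ℕ
  rv L j = L ∸ suc j

  rv< : ∀ L j → j < L → rv L j < L
  rv< (suc L) j l = s≤s (m∸n≤m L j)

  rv-rv : ∀ L j → j < L → rv L (rv L j) ≡ j
  rv-rv (suc L) j (s≤s l) = m∸[m∸n]≡n l

  rv-anti : ∀ L a b → a < b → b < L → rv L b < rv L a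
  rv-anti L a b ab bL = ∸-monoʳ-< (s≤s ab) bL

  rcols : ℕ → (ℕ → ISet) → ℕ → ISet
  rcols zero cs j x = false
  rcols (suc L) cs zero = cs L
  rcols (suc L) cs (suc j) = rcols L cs j

  rcols-in : ∀ L cs j → j < L → rcols L cs j ≡ cs (rv L j)
  rcols-in (suc L) cs zero l = refl
  rcols-in (suc L) cs (suc j) (s≤s l) = rcols-in L cs j l

  rcols-out : ∀ L cs j → L ≤ j → rcols L cs j ≗ (λ _ → false)
  rcols-out zero cs j l x = refl
  rcols-out (suc L) cs (suc j) (s≤s l) = rcols-out L cs j l

  module Shape (λ′ : Vec ℕ n) (par : IsPartition λ′) where

    part : ℕ → ℕ
    part = atV 0 λ′

    L₀ : ℕ
    L₀ = part 0

    part-suc : ∀ k → part (suc k) ≤ part k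
    part-suc k with suc k <? n
    ... | yes l = par k l
    ... | no l = subst (_≤ part k) (sym (atV-out 0 λ′ (suc k) (≮⇒≥ l))) z≤n

    part-mono : ∀ {j k} → j ≤ k → part k ≤ part j
    part-mono {j} {zero} z≤n = ≤-refl
    part-mono {j} {suc k} l with m≤n⇒m<n∨m≡n l
    ... | inj₂ refl = ≤-refl
    ... | inj₁ (s≤s l') = ≤-trans (part-suc k) (part-mono l')

    part-row< : ∀ k c → c < part k → k < n
    part-row< k c l with k <? n
    ... | yes p = p
    ... | no p = ⊥-elim (n≮0 (subst (c <_) (atV-out 0 λ′ k (≮⇒≥ p)) l))

    -- The conjugate partition.
    ht : ℕ → ℕ
    ht c = cnt (λ k → c <ᵇ part k) n

    ht≤ : ∀ c → ht c ≤ n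
    ht≤ c = cnt-≤ _ n

    <ht : ∀ k c → c < part k → k < ht c
    <ht k c l = subst (_≤ ht c) (cnt-all X (suc k) (λ x p → <ᵇ-true c (part x) (<-≤-trans l (part-mono (≤-pred p)))))
        (cnt-mono X (part-row< k c l))
      where
      X : ISet
      X k = c <ᵇ part k

    ht< : ∀ k c → k < ht c → c < part k
    ht< k c l with c <? part k
    ... | yes p = p
    ... | no p = ⊥-elim (<⇒≱ l (cnt-none (λ k → c <ᵇ part k) k n
            (λ x q _ → <ᵇ-false c (part x) (≤-trans (part-mono q) (≮⇒≥ p)))))

    -- The levels that are column heights of λ′.
    Q : ℕ → Bool
    Q p = part p <ᵇ part (p ∸ 1)

    Q-ht : ∀ c → c < L₀ → Q (ht c) ≡ true
    Q-ht c l = go (ht c) refl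
      where
      go : ∀ h → ht c ≡ h → Q h ≡ true
      go zero e = ⊥-elim (n≮0 (subst (0 <_) e (<ht 0 c l)))
      go (suc h) e = <ᵇ-true _ _ (≤-<-trans (≮⇒≥ (λ p → <-irrefl (sym e) (<ht (suc h) c p))) (ht< h c (subst (h <_) (sym e) ≤-refl)))

    ht-Q : ∀ p → Q (suc p) ≡ true → ht (part (suc p)) ≡ suc p
    ht-Q p q = ≤-antisym (≮⇒≥ (λ l → <-irrefl refl (ht< (suc p) (part (suc p)) l))) (<ht p (part (suc p)) (<ᵇ-true⁻ _ _ q))

    tprog : ℕ → Prog
    tprog zero = nil
    tprog (suc L) = col Q (ht L) (tprog L)

    tprog-width : ∀ L → width (tprog L) ≡ L
    tprog-width zero = refl
    tprog-width (suc L) = cong suc (tprog-width L)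

    TS : Flag → Tab n → Set
    TS w T = S w (tprog L₀) (rcols L₀ (colsetR (atV [] T)))

    ssyt-ss : ∀ T → SSYT λ′ T → Semistandard (atV [] T)
    ssyt-ss T (le , bd , li , st) = record
      { len = λ k → subst₂ _≤_ (sym (le (suc k))) (sym (le k)) (part-suc k)
      ; rows = λ k → linked⇒sorted (li k)
      ; cols = λ k c l → st k c (part-row< (suc k) c (subst (c <_) (le (suc k)) l)) l }

    module Col (T : Tab n) (ssyt : SSYT λ′ T) = Column (atV [] T) (ssyt-ss T ssyt) n (λ k l → atV-out [] T k l)

    module Stepped (i : ℕ) (T T' : Tab n) (ssyt : SSYT λ′ T) (s : Step i T T') where
      open Step s
      private
        R = atV [] T
        R' = atV [] T'
        module C = Col T ssyt
        so : SufOK i (seg R (suc k) e ++ A)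
        so = subst (SufOK i) preE sufOK
        po : PreOK i 0 (B ++ seg R 0 k)
        po = subst (PreOK i 0) postE preOK
      c₀ : ℕ
      c₀ = length A
      Ek : C.E k c₀ (suc i)
      Ek = C.Ek i k e A B size row so po
      is-minus : Minus i (C.colset c₀)
      is-minus = C.is-minus i k e A B size row so po
      plus-left = C.plus-left i k e A B size row so po
      minus-right = C.minus-right i k e A B size row so po

      i<n : suc i < n
      i<n = subst (_< n) (proj₂ Ek) (all-at (proj₁ (proj₂ ssyt) k) c₀ (proj₁ Ek))

      len' : ∀ j → length (R' j) ≡ length (R j)
      len' j with j ≟ k
      ... | yes refl = trans (cong length row') (trans (length-mid A B i (suc i)) (cong length (sym row)))
      ... | no ne = cong length (rows' j ne)

      ent-k : at 0 (R' k) c₀ ≡ i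
      ent-k = trans (cong (λ r → at 0 r c₀) row') (at-mid A B i)

      ent' : ∀ j c → j ≢ k ⊎ c ≢ c₀ → at 0 (R' j) c ≡ at 0 (R j) c
      ent' j c h with j ≟ k
      ... | no ne = cong (λ r → at 0 r c) (rows' j ne)
      ent' j c (inj₁ ne) | yes e = ⊥-elim (ne e)
      ent' j c (inj₂ ne) | yes refl = trans (cong (λ r → at 0 r c) row')
        (trans (at-mid-≢ A B i (suc i) c ne) (cong (λ r → at 0 r c) (sym row)))

      ent≤ : ∀ j c → at 0 (R' j) c ≤ at 0 (R j) c
      ent≤ j c with j ≟ k | c ≟ c₀
      ... | no ne | _ = ≤-reflexive (ent' j c (inj₁ ne))
      ... | yes _ | no ne = ≤-reflexive (ent' j c (inj₂ ne))
      ... | yes refl | yes refl = ≤-trans (≤-reflexive ent-k) (≤-trans (n≤1+n i) (≤-reflexive (sym (proj₂ Ek))))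

      ssyt' : SSYT λ′ T'
      ssyt' = (λ j → trans (len' j) (proj₁ ssyt j)) ,
        (λ j → at-all (R' j) (λ c l → ≤-<-trans (ent≤ j c) (all-at (proj₁ (proj₂ ssyt) j) c (subst (c <_) (len' j) l)))) ,
        (λ j → sorted⇒linked (row-mono j)) , col-strict
        where
        row-mono : ∀ j c → suc c < length (R' j) → at 0 (R' j) c ≤ at 0 (R' j) (suc c)
        row-mono j c l with Semistandard.rows (ssyt-ss T ssyt) j c (suc c) (n≤1+n c) (subst (suc c <_) (len' j) l) | j ≟ k | suc c ≟ c₀
        ... | h | no ne | _ = ≤-trans (ent≤ j c) (≤-trans h (≤-reflexive (sym (ent' j (suc c) (inj₁ ne)))))
        ... | h | yes _ | no ne = ≤-trans (ent≤ j c) (≤-trans h (≤-reflexive (sym (ent' j (suc c) (inj₂ ne)))))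
        ... | h | yes refl | yes p = ≤-trans (≤-reflexive (ent' j c (inj₂ (λ q → 1+n≢n (trans p (sym q))))))
              (≤-trans (≤-pred (≤∧≢⇒< (subst (at 0 (R j) c ≤_) (trans (cong (at 0 (R j)) p) (proj₂ Ek)) h)
                (C.first-in-row i k e A B size row so po c (subst (c <_) p ≤-refl))))
                (≤-reflexive (sym (trans (cong (at 0 (R' j)) p) ent-k))))
        col-strict : ∀ j c → suc j < n → c < length (R' (suc j)) → at 0 (R' j) c < at 0 (R' (suc j)) c
        col-strict j c lj l with proj₂ (proj₂ (proj₂ ssyt)) j c lj (subst (c <_) (len' (suc j)) l) | suc j ≟ k | c ≟ c₀
        ... | h | no ne | _ = ≤-<-trans (ent≤ j c) (<-≤-trans h (≤-reflexive (sym (ent' (suc j) c (inj₁ ne)))))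
        ... | h | yes _ | no ne = ≤-<-trans (ent≤ j c) (<-≤-trans h (≤-reflexive (sym (ent' (suc j) c (inj₂ ne)))))
        ... | h | yes refl | yes refl = ≤-<-trans (ent≤ j c) (subst (at 0 (R j) c <_) (sym ent-k)
              (≤∧≢⇒< (≤-pred (subst (at 0 (R j) c <_) (proj₂ Ek) h))
                (λ p → C.no-i i k e A B size row so po j (<-≤-trans (proj₁ Ek) (Semistandard.len (ssyt-ss T ssyt) j) , p))))

      module C' = Col T' ssyt'

      col-other : ∀ c → c ≢ c₀ → colsetR R' c ≗ colsetR R c
      col-other c ne x = anyB-cong n _ _ (λ j → cong₂ _∧_ (cong (c <ᵇ_) (len' j)) (cong (x ≡ᵇ_) (ent' j c (inj₂ ne))))

      col-at : colsetR R' c₀ ≗ dn i (colsetR R c₀)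
      col-at x with near i x
      ... | low refl = trans (C'.E⇒colset (subst (c₀ <_) (sym (len' k)) (proj₁ Ek) , ent-k))
              (sym (trans (dn-low i (colsetR R c₀)) (trans (cong (colsetR R c₀ i ∨_) (proj₂ is-minus)) (Bool.∨-zeroʳ _))))
      ... | high refl = trans not-there (sym (trans (dn-high i (colsetR R c₀)) (cong (_∧ colsetR R c₀ (suc i)) (proj₁ is-minus))))
        where
        not-there : colsetR R' c₀ (suc i) ≡ false
        not-there with bool? (colsetR R' c₀ (suc i))
        ... | inj₂ f = f
        ... | inj₁ t with C'.colset⇒E t
        ...   | j , l , p with j ≟ k
        ...     | yes refl = ⊥-elim (1+n≢n (trans (sym p) ent-k))
        ...     | no ne = ⊥-elim (ne (C.E-unique (subst (c₀ <_) (len' j) l , trans (sym (ent' j c₀ (inj₁ ne))) p) Ek))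
      ... | far a b = trans (bool-iff to from) (sym (dn-far i (colsetR R c₀) a b))
        where
        to : colsetR R' c₀ x ≡ true → colsetR R c₀ x ≡ true
        to t with C'.colset⇒E t
        ... | j , l , p with j ≟ k
        ...   | yes refl = ⊥-elim (a (trans (sym p) ent-k))
        ...   | no ne = C.E⇒colset (subst (c₀ <_) (len' j) l , trans (sym (ent' j c₀ (inj₁ ne))) p)
        from : colsetR R c₀ x ≡ true → colsetR R' c₀ x ≡ true
        from t with C.colset⇒E t
        ... | j , l , p with j ≟ k
        ...   | yes refl = ⊥-elim (b (trans (sym p) (proj₂ Ek)))
        ...   | no ne = C'.E⇒colset (subst (c₀ <_) (sym (len' j)) l , trans (ent' j c₀ (inj₁ ne)) p)

      col-back : colsetR R c₀ ≗ up i (colsetR R' c₀)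
      col-back x = sym (trans (up-cong i col-at x) (trans (up-dn i (colsetR R c₀) x)
        (up-fix i (colsetR R c₀) (λ (p , _) → bool-absurd p (proj₁ is-minus)) x)))

      c₀<L : c₀ < L₀
      c₀<L = <-≤-trans (proj₁ Ek) (≤-trans (≤-reflexive (proj₁ ssyt k)) (part-mono z≤n))

      j₀ : ℕ
      j₀ = rv L₀ c₀

      j₀-in : ∀ (cs : ℕ → ISet) → rcols L₀ cs j₀ ≡ cs c₀
      j₀-in cs = trans (rcols-in L₀ cs j₀ (rv< L₀ c₀ c₀<L)) (cong cs (rv-rv L₀ c₀ c₀<L))

      others : ∀ j → j ≢ j₀ → rcols L₀ (colsetR R') j ≗ rcols L₀ (colsetR R) j
      others j ne x with j <? L₀
      ... | no l = trans (rcols-out L₀ (colsetR R') j (≮⇒≥ l) x) (sym (rcols-out L₀ (colsetR R) j (≮⇒≥ l) x))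
      ... | yes l rewrite rcols-in L₀ (colsetR R') j l | rcols-in L₀ (colsetR R) j l =
            col-other (rv L₀ j) (λ p → ne (trans (sym (rv-rv L₀ j l)) (cong (rv L₀) p))) x

      -- Chains read the columns from the right, with `c₀` at place `j₀`. Thus `plus-left`, about
      -- columns left of `c₀`, is the condition of `raise-at` on later columns; in the same way
      -- `minus-right` gives that of `lower-at` in `TS-lower`.
      TS-raise : ∀ w → TS w T → TS w T'
      TS-raise w t = raise-at i i<n w (tprog L₀) _ _ j₀ t (subst (j₀ <_) (sym (tprog-width L₀)) (rv< L₀ c₀ c₀<L)) others
          (λ x → trans (cong (λ X → X x) (j₀-in (colsetR R'))) (trans (col-at x) (cong (λ X → dn i X x) (sym (j₀-in (colsetR R))))))
          cond
        where
        cond : ∀ j → j < width (tprog L₀) → j₀ < j → Minus i (rcols L₀ (colsetR R) j) →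
          Σ ℕ λ j₁ → j₀ < j₁ × j₁ < j × Plus i (rcols L₀ (colsetR R) j₁)
        cond j lw l mi with subst (j <_) (tprog-width L₀) lw
        ... | lj with plus-left (rv L₀ j) (subst (rv L₀ j <_) (rv-rv L₀ c₀ c₀<L) (rv-anti L₀ j₀ j l lj))
                        (subst (Minus i) (rcols-in L₀ (colsetR R) j lj) mi)
        ...   | c , p , q , pl = rv L₀ c , rv-anti L₀ c c₀ q c₀<L ,
                subst (rv L₀ c <_) (rv-rv L₀ j lj) (rv-anti L₀ (rv L₀ j) c p (<-trans q c₀<L)) ,
                subst (Plus i) (sym (trans (rcols-in L₀ (colsetR R) (rv L₀ c) (rv< L₀ c (<-trans q c₀<L)))
                  (cong (colsetR R) (rv-rv L₀ c (<-trans q c₀<L))))) pl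

      TS-lower : ∀ w → TS w T' → TS (upF i i<n w) T
      TS-lower w t = lower-at i i<n w (tprog L₀) _ _ j₀ t (subst (j₀ <_) (sym (tprog-width L₀)) (rv< L₀ c₀ c₀<L))
          (λ j ne x → sym (others j ne x))
          (λ x → trans (cong (λ X → X x) (j₀-in (colsetR R))) (trans (col-back x) (cong (λ X → up i X x) (sym (j₀-in (colsetR R'))))))
          cond
        where
        cond : ∀ j → j < j₀ → Plus i (rcols L₀ (colsetR R') j) →
          Σ ℕ λ j₁ → j < j₁ × j₁ < j₀ × Minus i (rcols L₀ (colsetR R') j₁)
        cond j l pl = pick (minus-right (rv L₀ j) c₀<c (trans (sym (eqc i)) (proj₁ pl) , trans (sym (eqc (suc i))) (proj₂ pl)))
          where
          lj : j < L₀
          lj = <-trans l (rv< L₀ c₀ c₀<L)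
          c₀<c : c₀ < rv L₀ j
          c₀<c = subst (_< rv L₀ j) (rv-rv L₀ c₀ c₀<L) (rv-anti L₀ j j₀ l (rv< L₀ c₀ c₀<L))
          eqc : rcols L₀ (colsetR R') j ≗ colsetR R (rv L₀ j)
          eqc x = trans (cong (λ X → X x) (rcols-in L₀ (colsetR R') j lj)) (col-other (rv L₀ j) (>⇒≢ c₀<c) x)
          pick : (Σ ℕ λ c → c₀ < c × c < rv L₀ j × Minus i (colsetR R c)) →
            Σ ℕ λ j₁ → j < j₁ × j₁ < j₀ × Minus i (rcols L₀ (colsetR R') j₁)
          pick (c , p , q , mi) = rv L₀ c , subst (_< rv L₀ c) (rv-rv L₀ j lj) (rv-anti L₀ c (rv L₀ j) q (rv< L₀ j lj)) ,
              rv-anti L₀ c₀ c p cL , (trans (eq' i) (proj₁ mi) , trans (eq' (suc i)) (proj₂ mi))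
            where
            cL : c < L₀
            cL = <-trans q (rv< L₀ j lj)
            eq' : rcols L₀ (colsetR R') (rv L₀ c) ≗ colsetR R c
            eq' x = trans (cong (λ X → X x) (trans (rcols-in L₀ (colsetR R') (rv L₀ c) (rv< L₀ c cL)) (cong (colsetR R') (rv-rv L₀ c cL))))
                      (col-other c (>⇒≢ p) x)

    eB-ssyt : ∀ i T T' → SSYT λ′ T → eB i T ≡ just T' → SSYT λ′ T'
    eB-ssyt i T T' ss e = Stepped.ssyt' i T T' ss (eB-step i T T' e)

    same-shape : ∀ T T' → SSYT λ′ T → SSYT λ′ T' → V.map length T ≡ V.map length T'
    same-shape T T' s s' = atV-ext 0 _ _ (λ j _ → trans (atV-map T j) (trans (proj₁ s j) (sym (trans (atV-map T' j) (proj₁ s' j)))))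

    eB-injective : ∀ i T₁ T₂ T' → SSYT λ′ T₁ → SSYT λ′ T₂ → eB i T₁ ≡ just T' → eB i T₂ ≡ just T' → T₁ ≡ T₂
    eB-injective i T₁ T₂ T' s₁ s₂ e₁ e₂ =
      step-injective i T₁ T₂ T' (same-shape T₁ T₂ s₁ s₂) (eB-step i T₁ T' e₁) (eB-step i T₂ T' e₂)

    TS-max : ∀ i (l : suc i < n) w T → SSYT λ′ T → eB i T ≡ nothing → TS w T → TS (dnF i l w) T
    TS-max i l w T ss e t = lower-flag i l w (tprog L₀) _ t cond
      where
      R = atV [] T
      module C = Col T ss
      cond : ∀ j → j < width (tprog L₀) → Minus i (rcols L₀ (colsetR R) j) → Σ ℕ λ j₁ → j₁ < j × Plus i (rcols L₀ (colsetR R) j₁)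
      cond j lw mi with subst (j <_) (tprog-width L₀) lw
      ... | lj with C.none-left i (subst (SufOK i) (readWord-seg T) (eB-nothing i T e)) (rv L₀ j) (subst (Minus i) (rcols-in L₀ (colsetR R) j lj) mi)
      ...   | c , p , pl = rv L₀ c , subst (rv L₀ c <_) (rv-rv L₀ j lj) (rv-anti L₀ (rv L₀ j) c p cL) ,
              subst (Plus i) (sym (trans (rcols-in L₀ (colsetR R) (rv L₀ c) (rv< L₀ c cL)) (cong (colsetR R) (rv-rv L₀ c cL)))) pl
        where
        cL : c < L₀
        cL with C.colset⇒E {c} {i} (proj₁ pl)
        ... | k , lk , _ = <-≤-trans lk (≤-trans (≤-reflexive (proj₁ ss k)) (part-mono z≤n))

    hw-row : ∀ k → k < n → atV [] (hw λ′) k ≡ replicate (part k) k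
    hw-row k l = go λ′ id k l
      where
      go : ∀ {p} (v : Vec ℕ p) (f : ℕ → ℕ) k → k < p →
        atV [] (V.tabulate (λ j → replicate (V.lookup v j) (f (toℕ j)))) k ≡ replicate (atV 0 v k) (f k)
      go (x ∷ v) f zero l = refl
      go (x ∷ v) f (suc k) (s≤s l) = go v (f ∘ suc) k l

    hw-len : ∀ k → length (atV [] (hw λ′) k) ≡ part k
    hw-len k with k <? n
    ... | yes l = trans (cong length (hw-row k l)) (length-replicate (part k))
    ... | no l = trans (cong length (atV-out [] (hw λ′) k (≮⇒≥ l))) (sym (atV-out 0 λ′ k (≮⇒≥ l)))

    hw-ent : ∀ k c → c < length (atV [] (hw λ′) k) → at 0 (atV [] (hw λ′) k) c ≡ k
    hw-ent k c l = trans (cong (λ r → at 0 r c) (hw-row k (part-row< k c l'))) (at-replicate (part k) k c l')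
      where
      l' : c < part k
      l' = subst (c <_) (hw-len k) l

    hw-ssyt : SSYT λ′ (hw λ′)
    hw-ssyt = hw-len , (λ k → at-all _ (λ c l → subst (_< n) (sym (hw-ent k c l)) (part-row< k c (subst (c <_) (hw-len k) l)))) ,
      (λ k → sorted⇒linked (λ c l → ≤-reflexive (trans (hw-ent k c (<⇒≤ l)) (sym (hw-ent k (suc c) l))))) ,
      (λ k c _ l → subst₂ _<_ (sym (hw-ent k c (subst (c <_) (sym (hw-len k)) (<-≤-trans (subst (c <_) (hw-len (suc k)) l) (part-suc k)))))
        (sym (hw-ent (suc k) c l)) ≤-refl)

    -- No brackets are counted: a step would put `i` into row `suc i` directly under another `i`,
    -- whereas a raising step preserves semistandardness.
    hw-nothing : ∀ i → eB i (hw λ′) ≡ nothing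
    hw-nothing i with eB i (hw λ′) in eq
    ... | nothing = refl
    ... | just T' = ⊥-elim (<-irrefl refl bad)
      where
      open Step (eB-step i (hw λ′) T' eq)
      open Stepped i (hw λ′) T' hw-ssyt (eB-step i (hw λ′) T' eq)
      k≡ : k ≡ suc i
      k≡ = trans (sym (hw-ent k c₀ (proj₁ Ek))) (proj₂ Ek)
      ss' = proj₂ (proj₂ (proj₂ ssyt'))
      l' : c₀ < length (atV [] T' (suc i))
      l' = subst (λ k → c₀ < length (atV [] T' k)) k≡ (subst (c₀ <_) (sym (len' k)) (proj₁ Ek))
      li : c₀ < length (atV [] (hw λ′) i)
      li = <-≤-trans (proj₁ Ek) (subst (λ k → length (atV [] (hw λ′) k) ≤ length (atV [] (hw λ′) i)) (sym k≡)
             (Semistandard.len (ssyt-ss (hw λ′) hw-ssyt) i))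
      bad : i < i
      bad = subst₂ _<_ (trans (ent' i c₀ (inj₁ (λ p → 1+n≢n (sym (trans p k≡))))) (hw-ent i c₀ li))
              (trans (cong (λ k → at 0 (atV [] T' k) c₀) (sym k≡)) ent-k) (ss' i c₀ i<n l')

    TS-hw : TS idF (hw λ′)
    TS-hw = go L₀
      where
      module C = Col (hw λ′) hw-ssyt
      R = atV [] (hw λ′)
      go : ∀ L → S idF (tprog L) (rcols L (colsetR R))
      go zero = tt
      go (suc L) = idF , (λ p _ q → ≤-refl) , (λ x → bool-iff to from) , go L
        where
        to : ∀ {x} → colsetR R L x ≡ true → (x <ᵇ ht L) ≡ true
        to {x} t with C.colset⇒E t
        ... | k , l , e = <ᵇ-true x (ht L) (subst (_< ht L) (trans (sym (hw-ent k L l)) e) (<ht k L (subst (L <_) (hw-len k) l)))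
        from : ∀ {x} → (x <ᵇ ht L) ≡ true → colsetR R L x ≡ true
        from {x} t = C.E⇒colset (l , hw-ent x L l)
          where
          l : L < length (R x)
          l = subst (L <_) (sym (hw-len x)) (ht< x L (<ᵇ-true⁻ x (ht L) t))

    TS-column : ∀ w T → TS w T → ∀ c → c < L₀ → Σ Flag λ v → v ≤[ Q ] w × colsetR (atV [] T) c ≗ lv v (ht c)
    TS-column w T t = go L₀ w t
      where
      go : ∀ L w → S w (tprog L) (rcols L (colsetR (atV [] T))) → ∀ c → c < L → Σ Flag λ v → v ≤[ Q ] w × colsetR (atV [] T) c ≗ lv v (ht c)
      go (suc L) w (v , o , e , s) c l with m≤n⇒m<n∨m≡n (≤-pred l)
      ... | inj₂ refl = v , o , e
      ... | inj₁ l' with go L v s c l'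
      ...   | v' , o' , e' = v' , ≤[]-trans {v'} {v} {w} o' o , e'

    -- Below the identity flag each column is an initial segment, and strictly increasing columns
    -- leave only one way of writing it.
    TS-id : ∀ T → SSYT λ′ T → TS idF T → T ≡ hw λ′
    TS-id T ss t = atV-ext [] T (hw λ′) (λ k lk → list-ext (R k) _ (trans (proj₁ ss k) (sym (hw-len k)))
        (λ c l → trans (entries k c l) (sym (hw-ent k c (subst (c <_) (trans (proj₁ ss k) (sym (hw-len k))) l)))))
      where
      R = atV [] T
      module C = Col T ss
      entries : ∀ k c → c < length (R k) → at 0 (R k) c ≡ k
      entries k c = <-rec (λ k → c < length (R k) → at 0 (R k) c ≡ k) step k
        where
        step : ∀ k → (∀ {j} → j < k → c < length (R j) → at 0 (R j) c ≡ j) → c < length (R k) → at 0 (R k) c ≡ k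
        step k ih l with TS-column idF T t c (<-≤-trans l (≤-trans (≤-reflexive (proj₁ ss k)) (part-mono z≤n)))
        ... | v , o , e with C.colset⇒E (trans (e k) (trans (below-id v (ht c) (ht≤ c) (o (ht c) (Q-ht c cL)) k k<n) (<ᵇ-true k (ht c) kh)))
          where
          l' : c < part k
          l' = subst (c <_) (proj₁ ss k) l
          cL : c < L₀
          cL = <-≤-trans l' (part-mono z≤n)
          k<n : k < n
          k<n = part-row< k c l'
          kh : k < ht c
          kh = <ht k c l'
        ...   | j , lj , p with <-cmp j k
        ...     | tri≈ _ refl _ = p
        ...     | tri< q _ _ = ⊥-elim (<-irrefl (trans (sym (ih q lj)) p) q)
        ...     | tri> _ _ q = ⊥-elim (<-irrefl refl (<-≤-trans (subst (at 0 (R k) c <_) p (C.cols* q lj)) (k≤ k l)))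
          where
          k≤ : ∀ k → c < length (R k) → k ≤ at 0 (R k) c
          k≤ zero l = z≤n
          k≤ (suc k) l = ≤-<-trans (k≤ k (<-≤-trans l (C.len* (n≤1+n k)))) (C.cols* ≤-refl l)

-- Permutations as flags, inversions, reduced words and the Bruhat order

module Permutations (n : ℕ) where
  open Flags n
  open Orthodontia n using (below-id; swap-low; swap-high; swap-far; swap-swap; swap-<)

  insert : ℕ → ISet → ISet
  insert y X x = (x ≡ᵇ y) ∨ X x

  cnt-insert : ∀ y X q → X y ≡ false → cnt (insert y X) q ≡ bit (y <ᵇ q) + cnt X q
  cnt-insert y X zero f = refl
  cnt-insert y X (suc q) f with <-cmp y q
  ... | tri< l ne _ rewrite ≢⇒≡ᵇ q y (ne ∘ sym) | cnt-insert y X q f | <ᵇ-true y q l | <ᵇ-true y (suc q) (m<n⇒m<1+n l) =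
      +-suc (bit (X q)) (cnt X q)
  ... | tri≈ _ refl _ rewrite ≡ᵇ-refl y | cnt-insert y X y f | <ᵇ-false y y ≤-refl | <ᵇ-true y (suc y) ≤-refl | f = refl
  ... | tri> _ ne l rewrite ≢⇒≡ᵇ q y (ne ∘ sym) | cnt-insert y X q f | <ᵇ-false y q (<⇒≤ l) | <ᵇ-false y (suc q) l = refl

  cnt-insert≤ : ∀ y X q → cnt (insert y X) q ≤ suc (cnt X q)
  cnt-insert≤ y X q with bool? (X y)
  ... | inj₂ f = ≤-trans (≤-reflexive (cnt-insert y X q f)) (+-monoˡ-≤ (cnt X q) (bit≤1 (y <ᵇ q)))
  ... | inj₁ t = ≤-trans (cnt-⊑ same q) (n≤1+n _)
    where
    same : insert y X ⊑ X
    same x h with bool? (x ≡ᵇ y)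
    ... | inj₁ e = subst (λ z → X z ≡ true) (sym (≡ᵇ-true x y e)) t
    ... | inj₂ e = trans (cong (_∨ X x) (sym e)) h

  mem : (ℕ → ℕ) → ℕ → ISet
  mem f zero x = false
  mem f (suc p) = insert (f p) (mem f p)

  cnt-mem≤ : ∀ f p q → cnt (mem f p) q ≤ p
  cnt-mem≤ f zero q = cnt-none _ 0 q (λ _ _ _ → refl)
  cnt-mem≤ f (suc p) q = ≤-trans (cnt-insert≤ (f p) (mem f p) q) (s≤s (cnt-mem≤ f p q))

  mem-intro : ∀ f p k → k < p → mem f p (f k) ≡ true
  mem-intro f (suc p) k l with m≤n⇒m<n∨m≡n (≤-pred l)
  ... | inj₂ refl = cong (_∨ mem f p (f p)) (≡ᵇ-refl (f p))
  ... | inj₁ l' = trans (cong ((f k ≡ᵇ f p) ∨_) (mem-intro f p k l')) (Bool.∨-zeroʳ _)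

  mem-elim : ∀ f p x → mem f p x ≡ true → Σ ℕ λ k → k < p × f k ≡ x
  mem-elim f (suc p) x h with bool? (x ≡ᵇ f p)
  ... | inj₁ t = p , ≤-refl , sym (≡ᵇ-true x (f p) t)
  ... | inj₂ e with mem-elim f p x (trans (sym (cong (_∨ mem f p x) e)) h)
  ...   | k , l , q = k , m<n⇒m<1+n l , q

  mem-cong : ∀ f g p → (∀ k → k < p → f k ≡ g k) → mem f p ≗ mem g p
  mem-cong f g zero h x = refl
  mem-cong f g (suc p) h x = cong₂ _∨_ (cong (x ≡ᵇ_) (h p ≤-refl)) (mem-cong f g p (λ k l → h k (m<n⇒m<1+n l)) x)

  swap-≡ᵇ : ∀ i x y → (x ≡ᵇ swapVal i y) ≡ (swapVal i x ≡ᵇ y)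
  swap-≡ᵇ i x y = bool-iff
    (λ h → subst (λ z → (swapVal i x ≡ᵇ z) ≡ true) (trans (cong (swapVal i) (≡ᵇ-true x (swapVal i y) h)) (swap-swap i y)) (≡ᵇ-refl (swapVal i x)))
    (λ h → subst (λ z → (x ≡ᵇ z) ≡ true) (trans (sym (swap-swap i x)) (cong (swapVal i) (≡ᵇ-true (swapVal i x) y h))) (≡ᵇ-refl x))

  mem-swap : ∀ i f p x → mem (swapVal i ∘ f) p x ≡ mem f p (swapVal i x)
  mem-swap i f zero x = refl
  mem-swap i f (suc p) x = cong₂ _∨_ (swap-≡ᵇ i x (f p)) (mem-swap i f p x)

  ar : Perm n → ℕ → ℕ
  ar w = atV 0 w

  fresh : ∀ w → IsPerm n w → ∀ p → p < n → mem (ar w) p (ar w p) ≡ false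
  fresh w (_ , inj) p l with bool? (mem (ar w) p (ar w p))
  ... | inj₂ f = f
  ... | inj₁ t with mem-elim (ar w) p (ar w p) t
  ...   | k , lk , e = ⊥-elim (<-irrefl (inj k p (<-trans lk l) l e) lk)

  mem-card : ∀ w → IsPerm n w → ∀ p → p ≤ n → cnt (mem (ar w) p) n ≡ p
  mem-card w ip zero l = n≤0⇒n≡0 (cnt-none _ 0 n (λ _ _ _ → refl))
  mem-card w ip (suc p) l = trans (cnt-insert (ar w p) (mem (ar w) p) n (fresh w ip p l))
    (cong₂ _+_ (cong bit (<ᵇ-true _ _ (proj₁ ip p l))) (mem-card w ip p (<⇒≤ l)))

  pflag : ∀ w → IsPerm n w → Flag
  pflag w ip = flag (mem (ar w)) (λ p x h → trans (cong ((x ≡ᵇ ar w p) ∨_) h) (Bool.∨-zeroʳ _)) (mem-card w ip)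

  _≤n_ : Flag → Flag → Set
  v ≤n w = ∀ p → p ≤ n → lv v p ≼ lv w p

  mem-full : ∀ w → IsPerm n w → ∀ x → mem (ar w) n x ≡ (x <ᵇ n)
  mem-full w ip x with x <? n
  ... | yes l = trans (cnt-full (mem (ar w) n) n (≤-reflexive (sym (mem-card w ip n ≤-refl))) x l) (sym (<ᵇ-true x n l))
  ... | no l = trans outside (sym (<ᵇ-false x n (≮⇒≥ l)))
    where
    outside : mem (ar w) n x ≡ false
    outside with bool? (mem (ar w) n x)
    ... | inj₂ f = f
    ... | inj₁ t with mem-elim (ar w) n x t
    ...   | k , lk , e = ⊥-elim (l (subst (_< n) e (proj₁ ip k lk)))

  position : ∀ w → IsPerm n w → ∀ x → x < n → Σ ℕ λ k → k < n × ar w k ≡ x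
  position w ip x l = mem-elim (ar w) n x (trans (mem-full w ip x) (<ᵇ-true x n l))

  s∙ : ℕ → Perm n → Perm n
  s∙ i w = V.map (swapVal i) w

  atV-map′ : ∀ {m} (f : ℕ → ℕ) (w : Vec ℕ m) k → k < m → atV 0 (V.map f w) k ≡ f (atV 0 w k)
  atV-map′ f (x ∷ w) zero l = refl
  atV-map′ f (x ∷ w) (suc k) (s≤s l) = atV-map′ f w k l

  s∙-at : ∀ i w k → k < n → ar (s∙ i w) k ≡ swapVal i (ar w k)
  s∙-at i w k l = atV-map′ (swapVal i) w k l

  swap<n : ∀ i {x} → suc i < n → x < n → swapVal i x < n
  swap<n i {x} li l with near i x
  ... | low refl = subst (_< n) (sym (swap-low i)) li
  ... | high refl = subst (_< n) (sym (swap-high i)) (<⇒≤ li)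
  ... | far a b = subst (_< n) (sym (swap-far i a b)) l

  swap-inj : ∀ i x y → swapVal i x ≡ swapVal i y → x ≡ y
  swap-inj i x y e = trans (sym (swap-swap i x)) (trans (cong (swapVal i) e) (swap-swap i y))

  s∙-perm : ∀ i w → suc i < n → IsPerm n w → IsPerm n (s∙ i w)
  s∙-perm i w li (b , inj) = (λ k l → subst (_< n) (sym (s∙-at i w k l)) (swap<n i li (b k l))) ,
    (λ k l lk ll e → inj k l lk ll (swap-inj i _ _ (trans (sym (s∙-at i w k lk)) (trans e (s∙-at i w l ll)))))

  s∙-s∙ : ∀ i w → s∙ i (s∙ i w) ≡ w
  s∙-s∙ i w = go w
    where
    go : ∀ {m} (w : Vec ℕ m) → V.map (swapVal i) (V.map (swapVal i) w) ≡ w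
    go [] = refl
    go (x ∷ w) = cong₂ _∷_ (swap-swap i x) (go w)

  s∙-mem : ∀ i w p → p ≤ n → ∀ x → mem (ar (s∙ i w)) p x ≡ mem (ar w) p (swapVal i x)
  s∙-mem i w p l x = trans (mem-cong (ar (s∙ i w)) (swapVal i ∘ ar w) p (λ k lk → s∙-at i w k (<-≤-trans lk l)) x) (mem-swap i (ar w) p x)

  -- The value `i` stands before, respectively after, `suc i` in one-line notation; so left
  -- multiplication by `s_i` lengthens, respectively shortens. Stated on levels, this makes `s_i`
  -- act there as `up i` or `dn i`.
  Asc Desc : ℕ → Perm n → Set
  Asc i w = ∀ p → p ≤ n → ¬ Minus i (mem (ar w) p)
  Desc i w = ∀ p → p ≤ n → ¬ Plus i (mem (ar w) p)

  asc-or-desc : ∀ i w → IsPerm n w → Asc i w ⊎ Desc i w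
  asc-or-desc i w ip = search n
      (λ h → inj₂ h) (λ p pl → inj₁ (λ q _ mi → plus-no-minus i (pflag w ip) p pl q mi))
    where
    search : ∀ N {A : Set} → ((∀ p → p ≤ N → ¬ Plus i (mem (ar w) p)) → A) → (∀ p → Plus i (mem (ar w) p) → A) → A
    search zero f g = f (λ { zero z≤n (() , _) })
    search (suc N) f g with plus? i (mem (ar w) (suc N))
    ... | yes pl = g (suc N) pl
    ... | no npl = search N (λ h → f (λ p l → [ (λ l' → h p (≤-pred l')) , (λ e → subst (λ p → ¬ Plus i (mem (ar w) p)) (sym e) npl) ]′ (m≤n⇒m<n∨m≡n l))) g

  asc-mem : ∀ i w → Asc i w → ∀ p → p ≤ n → mem (ar (s∙ i w)) p ≗ up i (mem (ar w) p)
  asc-mem i w as p l x with near i x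
  ... | low refl = trans (s∙-mem i w p l i) (trans (cong (mem (ar w) p) (swap-low i))
          (sym (trans (up-low i (mem (ar w) p)) (∧-fix _ _ (as p l)))))
  ... | high refl = trans (s∙-mem i w p l (suc i)) (trans (cong (mem (ar w) p) (swap-high i))
          (sym (trans (up-high i (mem (ar w) p)) (∨-fix _ _ (as p l)))))
  ... | far a b = trans (s∙-mem i w p l x) (trans (cong (mem (ar w) p) (swap-far i a b)) (sym (up-far i (mem (ar w) p) a b)))

  desc-mem : ∀ i w → Desc i w → ∀ p → p ≤ n → mem (ar (s∙ i w)) p ≗ dn i (mem (ar w) p)
  desc-mem i w de p l x with near i x
  ... | low refl = trans (s∙-mem i w p l i) (trans (cong (mem (ar w) p) (swap-low i))
          (sym (trans (dn-low i (mem (ar w) p)) (∨-fix′ _ _ (de p l)))))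
  ... | high refl = trans (s∙-mem i w p l (suc i)) (trans (cong (mem (ar w) p) (swap-high i))
          (sym (trans (dn-high i (mem (ar w) p)) (∧-fix′ _ _ (de p l)))))
  ... | far a b = trans (s∙-mem i w p l x) (trans (cong (mem (ar w) p) (swap-far i a b)) (sym (dn-far i (mem (ar w) p) a b)))

  desc-asc : ∀ i w → Desc i w → Asc i (s∙ i w)
  desc-asc i w de p l (f , t) = de p l
    ( trans (sym (trans (s∙-mem i w p l (suc i)) (cong (mem (ar w) p) (swap-high i)))) t
    , trans (sym (trans (s∙-mem i w p l i) (cong (mem (ar w) p) (swap-low i)))) f)

  Σ< : (ℕ → ℕ) → ℕ → ℕ
  Σ< f m = sum (L.applyUpTo f m)

  Σ<-cong : ∀ f g m → (∀ x → x < m → f x ≡ g x) → Σ< f m ≡ Σ< g m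
  Σ<-cong f g zero h = refl
  Σ<-cong f g (suc m) h = cong₂ _+_ (h 0 (s≤s z≤n)) (Σ<-cong (f ∘ suc) (g ∘ suc) m (λ x l → h (suc x) (s≤s l)))

  Σ<-bump : ∀ f g m P → P < m → (∀ x → x < m → x ≢ P → g x ≡ f x) → g P ≡ suc (f P) → Σ< g m ≡ suc (Σ< f m)
  Σ<-bump f g (suc m) zero l h e = cong₂ _+_ e (Σ<-cong (g ∘ suc) (f ∘ suc) m (λ x lx → h (suc x) (s≤s lx) (λ ())))
  Σ<-bump f g (suc m) (suc P) (s≤s l) h e = trans
    (cong₂ _+_ (h 0 (s≤s z≤n) (λ ())) (Σ<-bump (f ∘ suc) (g ∘ suc) m P l (λ x lx ne → h (suc x) (s≤s lx) (ne ∘ suc-injective)) e))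
    (+-suc (f 0) _)

  drop-applyUpTo : ∀ (f : ℕ → ℕ) k m → L.drop k (L.applyUpTo f m) ≡ L.applyUpTo (λ x → f (k + x)) (m ∸ k)
  drop-applyUpTo f zero m = refl
  drop-applyUpTo f (suc k) zero = refl
  drop-applyUpTo f (suc k) (suc m) = drop-applyUpTo (f ∘ suc) k m

  pair : (ℕ → ℕ) → ℕ → ℕ → ℕ
  pair f p q = if f q <ᵇ f p then 1 else 0

  invsF : (ℕ → ℕ) → ℕ
  invsF f = Σ< (λ p → Σ< (λ x → pair f p (suc p + x)) (n ∸ suc p)) n

  invs-Σ : ∀ w → invs w ≡ invsF (ar w)
  invs-Σ w = trans (cong sum (map-applyUpTo id (λ p → sum (L.map (pair (ar w) p) (L.drop (suc p) (L.upTo n)))) n)) (Σ<-cong _ _ n (λ p _ → cong sum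
    (trans (cong (L.map (pair (ar w) p)) (drop-applyUpTo id (suc p) n)) (map-applyUpTo (λ x → suc p + x) (pair (ar w) p) (n ∸ suc p)))))

  swap-pair : ∀ i a b → ¬ (a ≡ i × b ≡ suc i) → ¬ (a ≡ suc i × b ≡ i) → (swapVal i a <ᵇ swapVal i b) ≡ (a <ᵇ b)
  swap-pair i a b h k = bool-iff to from
    where
    to : (swapVal i a <ᵇ swapVal i b) ≡ true → (a <ᵇ b) ≡ true
    to t with swap-< i (swapVal i a) (swapVal i b) (<ᵇ-true⁻ (swapVal i a) (swapVal i b) t)
    ... | inj₁ l = <ᵇ-true a b (subst₂ _<_ (swap-swap i a) (swap-swap i b) l)
    ... | inj₂ (p , q) = ⊥-elim (k (trans (sym (swap-swap i a)) (trans (cong (swapVal i) p) (swap-low i)) ,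
                                    trans (sym (swap-swap i b)) (trans (cong (swapVal i) q) (swap-high i))))
    from : (a <ᵇ b) ≡ true → (swapVal i a <ᵇ swapVal i b) ≡ true
    from t with swap-< i a b (<ᵇ-true⁻ a b t)
    ... | inj₁ l = <ᵇ-true (swapVal i a) (swapVal i b) l
    ... | inj₂ e = ⊥-elim (h e)

  -- Exchanging the values `i` and `suc i`, at positions `P < K`, affects no comparison but that of
  -- these two positions, which becomes an inversion.
  invs-asc : ∀ i w → suc i < n → IsPerm n w → Asc i w → invs (s∙ i w) ≡ suc (invs w)
  invs-asc i w li ip@(_ , inj) as with position w ip i (<⇒≤ li) | position w ip (suc i) li
  ... | P , lP , eP | K , lK , eK = trans (invs-Σ (s∙ i w)) (trans
      (Σ<-bump (λ p → Σ< (λ x → pair (ar w) p (suc p + x)) (n ∸ suc p)) (λ p → Σ< (λ x → pair (ar (s∙ i w)) p (suc p + x)) (n ∸ suc p)) n P lP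
        (λ p lp ne → Σ<-cong _ _ (n ∸ suc p) (λ x lx → same p (suc p + x) lp (bound p x lp lx) (s≤s (m≤m+n p x)) (λ (e , _) → ne e)))
        (Σ<-bump _ _ (n ∸ suc P) (K ∸ suc P) (∸-monoˡ-< lK PK)
          (λ x lx ne → same P (suc P + x) lP (bound P x lP lx) (s≤s (m≤m+n P x))
            (λ (_ , e) → ne (trans (sym (m+n∸m≡n (suc P) x)) (cong (_∸ suc P) e))))
          top))
      (cong suc (sym (invs-Σ w))))
    where
    bound : ∀ p x → p < n → x < n ∸ suc p → suc p + x < n
    bound p x lp lx = subst (suc p + x <_) (m+[n∸m]≡n lp) (+-monoʳ-< (suc p) lx)
    PK : P < K
    PK with <-cmp P K
    ... | tri< l _ _ = l
    ... | tri≈ _ refl _ = ⊥-elim (1+n≢n (trans (sym eK) eP))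
    ... | tri> _ _ l = ⊥-elim (as (suc K) lK (not-i , subst (λ x → mem (ar w) (suc K) x ≡ true) eK (mem-intro (ar w) (suc K) K ≤-refl)))
      where
      not-i : mem (ar w) (suc K) i ≡ false
      not-i with bool? (mem (ar w) (suc K) i)
      ... | inj₂ f = f
      ... | inj₁ t with mem-elim (ar w) (suc K) i t
      ...   | k , lk , e = ⊥-elim (<⇒≱ l (subst (_≤ K) (inj k P (<-≤-trans lk lK) lP (trans e (sym eP))) (≤-pred lk)))
    same : ∀ p q → p < n → q < n → p < q → ¬ (p ≡ P × q ≡ K) → pair (ar (s∙ i w)) p q ≡ pair (ar w) p q
    same p q lp lq pq ne rewrite s∙-at i w p lp | s∙-at i w q lq = cong (λ b → if b then 1 else 0)
      (swap-pair i (ar w q) (ar w p)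
        (λ (a , b) → <-asym pq (subst₂ _<_ (inj P q lP lq (trans eP (sym a))) (inj K p lK lp (trans eK (sym b))) PK))
        (λ (a , b) → ne (inj p P lp lP (trans b (sym eP)) , inj q K lq lK (trans a (sym eK)))))
    top : pair (ar (s∙ i w)) P (suc P + (K ∸ suc P)) ≡ suc (pair (ar w) P (suc P + (K ∸ suc P)))
    top rewrite m+[n∸m]≡n PK | s∙-at i w P lP | s∙-at i w K lK | eP | eK | swap-low i | swap-high i
      | <ᵇ-true i (suc i) ≤-refl | <ᵇ-false (suc i) i (n≤1+n i) = refl

  invs-desc : ∀ i w → suc i < n → IsPerm n w → Desc i w → invs w ≡ suc (invs (s∙ i w))
  invs-desc i w li ip de = trans (cong invs (sym (s∙-s∙ i w))) (invs-asc i (s∙ i w) li (s∙-perm i w li ip) (desc-asc i w de))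

  id-at : ∀ k → k < n → ar (idPerm n) k ≡ k
  id-at k l = atV-tab 0 id k l

  id-perm : IsPerm n (idPerm n)
  id-perm = (λ k l → subst (_< n) (sym (id-at k l)) l) , (λ k l lk ll e → trans (sym (id-at k lk)) (trans e (id-at l ll)))

  id-mem : ∀ p → p ≤ n → mem (ar (idPerm n)) p ≗ (_<ᵇ p)
  id-mem p l x = trans (mem-cong _ id p (λ k lk → id-at k (<-≤-trans lk l)) x) (bool-iff
    (λ t → let (k , lk , e) = mem-elim id p x t in <ᵇ-true x p (subst (_< p) e lk))
    (λ t → mem-intro id p x (<ᵇ-true⁻ x p t)))

  invs-id : invs (idPerm n) ≡ 0
  invs-id = trans (invs-Σ (idPerm n)) (zeros _ n (λ p lp → zeros _ (n ∸ suc p) (λ x lx → none p x lp lx)))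
    where
    zeros : ∀ f m → (∀ x → x < m → f x ≡ 0) → Σ< f m ≡ 0
    zeros f zero h = refl
    zeros f (suc m) h = cong₂ _+_ (h 0 (s≤s z≤n)) (zeros (f ∘ suc) m (λ x l → h (suc x) (s≤s l)))
    none : ∀ p x → p < n → x < n ∸ suc p → pair (ar (idPerm n)) p (suc p + x) ≡ 0
    none p x lp lx rewrite id-at p lp | id-at (suc p + x) (subst (suc p + x <_) (m+[n∸m]≡n lp) (+-monoʳ-< (suc p) lx))
      | <ᵇ-false (suc p + x) p (≤-trans (n≤1+n p) (m≤m+n (suc p) x)) = refl

  initial⇒id : ∀ w → IsPerm n w → (∀ p → p ≤ n → ∀ x → x < n → mem (ar w) p x ≡ (x <ᵇ p)) → w ≡ idPerm n
  initial⇒id w ip h = atV-ext 0 w (idPerm n) (λ k l → trans (≤-antisym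
      (≤-pred (<ᵇ-true⁻ (ar w k) (suc k) (trans (sym (h (suc k) l (ar w k) (proj₁ ip k l))) (mem-intro (ar w) (suc k) k ≤-refl))))
      (<ᵇ-false⁻ (ar w k) k (trans (sym (h k (<⇒≤ l) (ar w k) (proj₁ ip k l))) (fresh w ip k l))))
    (sym (id-at k l)))

  all-asc⇒id : ∀ w → IsPerm n w → (∀ i → suc i < n → Asc i w) → w ≡ idPerm n
  all-asc⇒id w ip h = initial⇒id w ip (λ p lp → init p lp)
    where
    closed : ∀ p → p ≤ n → ∀ x y → x ≤ y → y < n → mem (ar w) p y ≡ true → mem (ar w) p x ≡ true
    closed p lp x zero z≤n ly t = t
    closed p lp x (suc y) l ly t with m≤n⇒m<n∨m≡n l
    ... | inj₂ refl = t
    ... | inj₁ l' with bool? (mem (ar w) p y)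
    ...   | inj₁ t' = closed p lp x y (≤-pred l') (<⇒≤ ly) t'
    ...   | inj₂ f = ⊥-elim (h y ly p lp (f , t))
    init : ∀ p → p ≤ n → ∀ x → x < n → mem (ar w) p x ≡ (x <ᵇ p)
    init p lp x lx with bool? (mem (ar w) p x) | x <? p
    ... | inj₁ t | yes l = trans t (sym (<ᵇ-true x p l))
    ... | inj₂ f | no l = trans f (sym (<ᵇ-false x p (≮⇒≥ l)))
    ... | inj₁ t | no l = ⊥-elim (l (≤-trans (≤-reflexive (sym (cnt-all _ (suc x) (λ y ly → closed p lp y x (≤-pred ly) lx t))))
            (≤-trans (cnt-mono (mem (ar w) p) lx) (≤-reflexive (mem-card w ip p lp)))))
    ... | inj₂ f | yes l = ⊥-elim (<⇒≱ l (≤-trans (≤-reflexive (sym (mem-card w ip p lp))) (cnt-none _ x n above)))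
      where
      above : ∀ y → x ≤ y → y < n → mem (ar w) p y ≡ false
      above y l ly with bool? (mem (ar w) p y)
      ... | inj₂ f' = f'
      ... | inj₁ t = ⊥-elim (bool-absurd (closed p lp x y l ly t) f)

  find-desc : ∀ w → IsPerm n w → (∀ i → suc i < n → Asc i w) ⊎ (Σ ℕ λ i → suc i < n × Desc i w)
  find-desc w ip = go n
    where
    go : ∀ N → (∀ i → suc i < N → Asc i w) ⊎ (Σ ℕ λ i → suc i < n × Desc i w)
    go zero = inj₁ (λ i ())
    go (suc N) with go N
    ... | inj₂ d = inj₂ d
    go (suc zero) | inj₁ a = inj₁ (λ { i (s≤s ()) })
    go (suc (suc N)) | inj₁ a with suc N <? n | asc-or-desc N w ip
    ... | yes l | inj₂ d = inj₂ (N , l , d)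
    ... | _ | inj₁ as = inj₁ (λ i l → [ (λ l' → a i (≤-pred l')) , (λ e → subst (λ i → Asc i w) (sym (suc-injective (suc-injective e))) as) ]′ (m≤n⇒m<n∨m≡n l))
    -- The value `suc N` is then at least `n` and occurs at no level, so `N` counts as an ascent.
    ... | no g | inj₂ d = inj₁ (λ i l p lp mi → out i l p lp mi)
      where
      out : ∀ i → suc i < suc (suc N) → Asc i w
      out i l with m≤n⇒m<n∨m≡n l
      ... | inj₁ l' = a i (≤-pred l')
      ... | inj₂ refl = λ p lp (_ , t) → let (k , lk , e) = mem-elim (ar w) p (suc N) t in
              g (subst (_< n) e (proj₁ ip k (<-≤-trans lk lp)))

  prodW-perm : ∀ a → All (λ i → suc i < n) a → IsPerm n (prodW n a)
  prodW-perm [] [] = id-perm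
  prodW-perm (i ∷ a) (l ∷ h) = s∙-perm i (prodW n a) l (prodW-perm a h)

  invs-prodW : ∀ a → All (λ i → suc i < n) a → invs (prodW n a) ≤ length a
  invs-prodW [] [] = ≤-reflexive invs-id
  invs-prodW (i ∷ a) (l ∷ h) with asc-or-desc i (prodW n a) (prodW-perm a h)
  ... | inj₁ as = ≤-trans (≤-reflexive (invs-asc i (prodW n a) l (prodW-perm a h) as)) (s≤s (invs-prodW a h))
  ... | inj₂ de = ≤-trans (≤-trans (n≤1+n _) (≤-reflexive (sym (invs-desc i (prodW n a) l (prodW-perm a h) de)))) (m≤n⇒m≤1+n (invs-prodW a h))

  -- At a descent the tail would have one inversion more than the whole product, hence more than its
  -- own length allows.
  reduced-tail : ∀ i a v → Reduced n (i ∷ a) v → Reduced n a (prodW n a) × Asc i (prodW n a)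
  reduced-tail i a v (l ∷ h , refl , len) with asc-or-desc i (prodW n a) (prodW-perm a h)
  ... | inj₁ as = (h , refl , suc-injective (trans len (invs-asc i (prodW n a) l (prodW-perm a h) as))) , as
  ... | inj₂ de = ⊥-elim (1+n≰n (≤-trans (n≤1+n _) (≤-trans (s≤s (≤-reflexive len))
          (≤-trans (≤-reflexive (sym (invs-desc i (prodW n a) l (prodW-perm a h) de))) (invs-prodW a h)))))

  reduced-cons : ∀ i a v → suc i < n → IsPerm n v → Desc i v → Reduced n a (s∙ i v) → Reduced n (i ∷ a) v
  reduced-cons i a v l ip de (h , e , len) = l ∷ h , trans (cong (s∙ i) e) (s∙-s∙ i v) ,
    trans (cong suc len) (sym (invs-desc i v l ip de))

  reduced-nil : Reduced n [] (idPerm n)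
  reduced-nil = [] , refl , sym invs-id

  reduced-word : ∀ w → IsPerm n w → Σ (List ℕ) λ a → Reduced n a w
  reduced-word w ip = go (invs w) w ip refl
    where
    go : ∀ N w → IsPerm n w → invs w ≡ N → Σ (List ℕ) λ a → Reduced n a w
    go N w ip e with find-desc w ip
    ... | inj₁ h = [] , subst (Reduced n []) (sym (all-asc⇒id w ip h)) reduced-nil
    go zero w ip e | inj₂ (i , l , de) = ⊥-elim (0≢1+n (trans (sym e) (invs-desc i w l ip de)))
    go (suc N) w ip e | inj₂ (i , l , de) with go N (s∙ i w) (s∙-perm i w l ip) (suc-injective (trans (sym (invs-desc i w l ip de)) e))
    ... | a , r = i ∷ a , reduced-cons i a w l ip de r

  -- The rank description of the Bruhat order implies the subword property, by lifting along left descents of v.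
  rank⇒bruhat : ∀ u v (iu : IsPerm n u) (iv : IsPerm n v) → pflag u iu ≤n pflag v iv → Bruhat n u v
  rank⇒bruhat u v iu iv h = go (invs v) u v iu iv refl h
    where
    go : ∀ N u v (iu : IsPerm n u) (iv : IsPerm n v) → invs v ≡ N → pflag u iu ≤n pflag v iv → Bruhat n u v
    go N u v iu iv e h with find-desc v iv
    ... | inj₁ as = [] , [] , subst (Reduced n []) (sym v≡) reduced-nil , [] , subst (Reduced n []) (sym u≡) reduced-nil
      where
      v≡ : v ≡ idPerm n
      v≡ = all-asc⇒id v iv as
      u≡ : u ≡ idPerm n
      u≡ = initial⇒id u iu (λ p lp x lx → below-id (pflag u iu) p lp
        (≼-trans {mem (ar u) p} {mem (ar v) p} {_<ᵇ p} (h p lp)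
          (≗⇒≼ (λ y → trans (cong (λ v → mem (ar v) p y) v≡) (id-mem p lp y)))) x lx)
    go zero u v iu iv e h | inj₂ (i , l , de) = ⊥-elim (0≢1+n (trans (sym e) (invs-desc i v l iv de)))
    go (suc N) u v iu iv e h | inj₂ (i , l , de) with asc-or-desc i u iu
    ... | inj₁ as with go N u (s∙ i v) iu (s∙-perm i v l iv) (suc-injective (trans (sym (invs-desc i v l iv de)) e))
            (λ p lp → ≼-trans {mem (ar u) p} {dn i (mem (ar v) p)} {mem (ar (s∙ i v)) p}
              (≼-trans {mem (ar u) p} {dn i (mem (ar u) p)} {dn i (mem (ar v) p)}
                (≗⇒≼ (λ x → sym (dn-fix i (mem (ar u) p) (as p lp) x))) (dn-≼ i {mem (ar u) p} {mem (ar v) p} (h p lp)))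
              (≗⇒≼ (λ x → sym (desc-mem i v de p lp x))))
    ...   | a , b , ra , s , rb = i ∷ a , b , reduced-cons i a v l iv de ra , i ∷ʳ s , rb
    go (suc N) u v iu iv e h | inj₂ (i , l , de) | inj₂ de'
      with go N (s∙ i u) (s∙ i v) (s∙-perm i u l iu) (s∙-perm i v l iv) (suc-injective (trans (sym (invs-desc i v l iv de)) e))
            (λ p lp → ≼-trans {mem (ar (s∙ i u)) p} {dn i (mem (ar v) p)} {mem (ar (s∙ i v)) p}
              (≼-trans {mem (ar (s∙ i u)) p} {dn i (mem (ar u) p)} {dn i (mem (ar v) p)}
                (≗⇒≼ (desc-mem i u de' p lp)) (dn-≼ i {mem (ar u) p} {mem (ar v) p} (h p lp)))
              (≗⇒≼ (λ x → sym (desc-mem i v de p lp x))))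
    ... | a , b , ra , s , rb = i ∷ a , i ∷ b , reduced-cons i a v l iv de ra , refl ∷ s , reduced-cons i b u l iu de' rb

  subword-full : ∀ {a b : List ℕ} → b ⊆ a → length a ≤ length b → b ≡ a
  subword-full [] l = refl
  subword-full (y ∷ʳ s) l = ⊥-elim (1+n≰n (≤-trans l (sub-len s)))
    where
    sub-len : ∀ {a b : List ℕ} → b ⊆ a → length b ≤ length a
    sub-len [] = z≤n
    sub-len (y ∷ʳ s) = m≤n⇒m≤1+n (sub-len s)
    sub-len (e ∷ s) = s≤s (sub-len s)
  subword-full (refl ∷ s) (s≤s l) = cong (_ ∷_) (subword-full s l)

-- Demazure crystals as chains, and Bruhat order from inclusions

module Demazure (n : ℕ) where
  open Flags n
  open Orthodontia n using (idF; cnt-initial; cnt-initial-past; swap-low; swap-far; swap-high)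
  open Tableaux n
  open Permutations n

  eBpow-suc : ∀ i k (T : Tab n) → eBpow i (suc k) T ≡ M._>>=_ (eB i T) (eBpow i k)
  eBpow-suc i zero T with eB i T
  ... | nothing = refl
  ... | just _ = refl
  eBpow-suc i (suc k) T = trans (cong (λ m → M._>>=_ m (eB i)) (eBpow-suc i k T)) (assoc (eB i T))
    where
    assoc : ∀ m → M._>>=_ (M._>>=_ m (eBpow i k)) (eB i) ≡ M._>>=_ m (eBpow i (suc k))
    assoc nothing = refl
    assoc (just _) = refl

  module Crystal (λ′ : Vec ℕ n) (par : IsPartition λ′) where
    open Shape λ′ par

    Q≤n : ∀ p → Q p ≡ true → p ≤ n
    Q≤n zero h = z≤n
    Q≤n (suc p) h = part-row< p (part (suc p)) (<ᵇ-true⁻ _ _ h)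

    TS-mono : ∀ v w T → v ≤[ Q ] w → TS v T → TS w T
    TS-mono v w T h t = go L₀ t
      where
      go : ∀ L {T} → S v (tprog L) T → S w (tprog L) T
      go zero s = tt
      go (suc L) (v' , o , e , s) = v' , ≤[]-trans {v'} {v} {w} o h , e , s

    ≤n⇒≤Q : ∀ {v w} → v ≤n w → v ≤[ Q ] w
    ≤n⇒≤Q h p q = h p (Q≤n p q)

    -- Descending a whole string enlarges the flag only once, because `up i` is idempotent.
    lower-string : ∀ i (l : suc i < n) w k b x → SSYT λ′ b → eBpow i k b ≡ just x → TS w x → TS (upF i l w) b
    lower-string i l w zero b .b ss refl t = TS-mono w (upF i l w) b (λ p _ → up-inc i (lv w p)) t
    lower-string i l w (suc k) b x ss e t = go (eB i b) refl (trans (sym (eBpow-suc i k b)) e)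
      where
      go : ∀ m → eB i b ≡ m → M._>>=_ m (eBpow i k) ≡ just x → TS (upF i l w) b
      go (just b₁) eb e' = TS-mono (upF i i<n (upF i l w)) (upF i l w) b
          (λ p _ → ≗⇒≼ (up-up i (lv w p)))
          (TS-lower (upF i l w) (lower-string i l w k b₁ x ssyt' e' t))
        where open Stepped i b b₁ ss (eB-step i b b₁ eb)

    -- Each raising step consumes one letter `suc i`, so `N` bounds the climb. Raising stays under
    -- `w`, and at the top, where `e_i` vanishes, the flag itself may be lowered.
    top-of-string : ∀ i (l : suc i < n) w N b → occ (suc i) (readWord b) ≤ N → SSYT λ′ b → TS w b →
      Σ ℕ λ k → Σ (Tab n) λ x → eBpow i k b ≡ just x × SSYT λ′ x × TS (dnF i l w) x
    top-of-string i l w N b oc ss t = go (eB i b) refl N oc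
      where
      go : ∀ m → eB i b ≡ m → ∀ N → occ (suc i) (readWord b) ≤ N →
        Σ ℕ λ k → Σ (Tab n) λ x → eBpow i k b ≡ just x × SSYT λ′ x × TS (dnF i l w) x
      go nothing eb N oc = 0 , b , refl , ss , TS-max i l w b ss eb t
      go (just b₁) eb N oc = use N oc
        where
        st = eB-step i b b₁ eb
        open Step st using (pre; post; word; word')
        open Stepped i b b₁ ss st
        drop1 : occ (suc i) (readWord b) ≡ suc (occ (suc i) (readWord b₁))
        drop1 = begin
          occ (suc i) (readWord b) ≡⟨ cong (occ (suc i)) word ⟩
          occ (suc i) (pre ++ suc i ∷ post) ≡⟨ occ-++ (suc i) pre (suc i ∷ post) ⟩
          occ (suc i) pre + occ (suc i) (suc i ∷ post) ≡⟨ cong (occ (suc i) pre +_) (occ-open i post) ⟩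
          occ (suc i) pre + suc (occ (suc i) post) ≡⟨ +-suc _ _ ⟩
          suc (occ (suc i) pre + occ (suc i) post) ≡⟨ cong (λ z → suc (occ (suc i) pre + z)) (occ-close′ i post) ⟨
          suc (occ (suc i) pre + occ (suc i) (i ∷ post)) ≡⟨ cong suc (occ-++ (suc i) pre (i ∷ post)) ⟨
          suc (occ (suc i) (pre ++ i ∷ post)) ≡⟨ cong (suc ∘ occ (suc i)) word' ⟨
          suc (occ (suc i) (readWord b₁)) ∎
          where open ≡-Reasoning
        use : ∀ N → occ (suc i) (readWord b) ≤ N → Σ ℕ λ k → Σ (Tab n) λ x → eBpow i k b ≡ just x × SSYT λ′ x × TS (dnF i l w) x
        use zero oc = ⊥-elim (n≮0 (≤-trans (≤-reflexive (sym drop1)) oc))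
        use (suc N) oc with top-of-string i l w N b₁ (≤-pred (≤-trans (≤-reflexive (sym drop1)) oc)) ssyt' (TS-raise w t)
        ... | k , x , e , sx , tx = suc k , x , trans (eBpow-suc i k b) (trans (cong (λ m → M._>>=_ m (eBpow i k)) eb) e) , sx , tx

    DemW-ssyt : ∀ a b → DemW λ′ a b → SSYT λ′ b
    DemW-ssyt [] b refl = hw-ssyt
    DemW-ssyt (i ∷ a) b (s , _) = s

    DemW⇒TS : ∀ a v b → Reduced n a v → (ip : IsPerm n (prodW n a)) → DemW λ′ a b → TS (pflag (prodW n a) ip) b
    DemW⇒TS [] v b r ip refl = TS-mono idF (pflag (idPerm n) ip) (hw λ′)
      (≤n⇒≤Q {idF} {pflag (idPerm n) ip} (λ p l → ≗⇒≼ (λ x → sym (id-mem p l x)))) TS-hw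
    DemW⇒TS (i ∷ a) v b r@(l ∷ al , _) ip (s , k , x , e , d) with reduced-tail i a v r
    ... | r' , as = TS-mono (upF i l w) (pflag (prodW n (i ∷ a)) ip) b
          (≤n⇒≤Q {upF i l w} {pflag (prodW n (i ∷ a)) ip} (λ p lp → ≗⇒≼ (λ y → sym (asc-mem i (prodW n a) as p lp y))))
          (lower-string i l w k b x s e (DemW⇒TS a (prodW n a) x r' ip' d))
      where
      ip' = prodW-perm a al
      w = pflag (prodW n a) ip'

    -- The top of the `i`-string lies under `dn i` of the flag of `s_i w`, where `w` is the product
    -- of the tail. As `w` has an ascent at `i`, this is again the flag of `w`, at every level.
    TS⇒DemW : ∀ a v b → Reduced n a v → (ip : IsPerm n (prodW n a)) → SSYT λ′ b → TS (pflag (prodW n a) ip) b → DemW λ′ a b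
    TS⇒DemW [] v b r ip s t = TS-id b s (TS-mono (pflag (idPerm n) ip) idF b
      (≤n⇒≤Q {pflag (idPerm n) ip} {idF} (λ p l → ≗⇒≼ (id-mem p l))) t)
    TS⇒DemW (i ∷ a) v b r@(l ∷ al , _) ip s t with reduced-tail i a v r
    ... | r' , as with top-of-string i l (pflag (prodW n (i ∷ a)) ip) (occ (suc i) (readWord b)) b ≤-refl s t
    ...   | k , x , e , sx , tx = s , k , x , e , TS⇒DemW a (prodW n a) x r' ip' sx
            (TS-mono (dnF i l (pflag (prodW n (i ∷ a)) ip)) (pflag (prodW n a) ip') x
              (≤n⇒≤Q {dnF i l (pflag (prodW n (i ∷ a)) ip)} {pflag (prodW n a) ip'} (λ p lp → ≗⇒≼ (λ y →
                trans (dn-cong i (asc-mem i (prodW n a) as p lp) y)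
                  (trans (dn-up i (mem (ar (prodW n a)) p) y) (dn-fix i (mem (ar (prodW n a)) p) (as p lp) y))))) tx)
      where
      ip' = prodW-perm a al

    Dem⇒TS : ∀ w (ip : IsPerm n w) b → Dem λ′ w b → SSYT λ′ b × TS (pflag w ip) b
    Dem⇒TS w ip b (a , r@(_ , refl , _) , d) = DemW-ssyt a b d , DemW⇒TS a w b r ip d

    TS⇒Dem : ∀ w (ip : IsPerm n w) b → SSYT λ′ b → TS (pflag w ip) b → Dem λ′ w b
    TS⇒Dem w ip b s t with reduced-word w ip
    ... | a , r@(_ , refl , _) = a , r , TS⇒DemW a w b r ip s t

    Dem-hw : ∀ w → IsPerm n w → Dem λ′ w (hw λ′)
    Dem-hw w ip = TS⇒Dem w ip (hw λ′) hw-ssyt (TS-mono idF (pflag w ip) (hw λ′)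
      (≤n⇒≤Q {idF} {pflag w ip} (λ p l → le p)) TS-hw)
      where
      le : ∀ p → (_<ᵇ p) ≼ mem (ar w) p
      le p q with q ≤? p
      ... | yes qp = ≤-trans (cnt-≤ (mem (ar w) p) q) (≤-reflexive (sym (cnt-initial p q qp)))
      ... | no g = ≤-trans (cnt-mem≤ (ar w) p q) (≤-reflexive (sym (cnt-initial-past p q (<⇒≤ (≰⇒> g)))))

    -- The k-th smallest element of X, or 0 if X has no k + 1 elements below N.
    nth : ISet → ℕ → ℕ → ℕ
    nth X k zero = 0
    nth X k (suc N) = if X N ∧ (cnt X N ≡ᵇ k) then N else nth X k N

    nth-spec : ∀ X k N → k < cnt X N → X (nth X k N) ≡ true × cnt X (nth X k N) ≡ k × nth X k N < N
    nth-spec X k (suc N) l with X N in e | cnt X N ≟ k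
    ... | true | yes p rewrite p | ≡ᵇ-refl k = e , p , ≤-refl
    ... | true | no ne rewrite ≢⇒≡ᵇ (cnt X N) k ne = let (a , b , c) = nth-spec X k N (≤∧≢⇒< (≤-pred l) (ne ∘ sym)) in a , b , m<n⇒m<1+n c
    ... | false | _ = let (a , b , c) = nth-spec X k N l in a , b , m<n⇒m<1+n c

    cnt-strict : ∀ X x y → X x ≡ true → x < y → cnt X x < cnt X y
    cnt-strict X x y t l = ≤-trans (≤-reflexive (sym (cong (λ b → bit b + cnt X x) t))) (cnt-mono X l)

    nth-⊑ : ∀ X Y k → X ⊑ Y → k < cnt X n → nth Y k n ≤ nth X k n
    nth-⊑ X Y k h l with nth-spec X k n l | nth-spec Y k n (<-≤-trans l (cnt-⊑ h n))
    ... | a , b , c | a' , b' , c' = ≮⇒≥ (λ lt → 1+n≰n (subst₂ _≤_ (cong suc b) b'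
          (≤-trans (cnt-strict X _ _ a lt) (cnt-⊑ h (nth Y k n)))))

    -- The tableau whose columns are the sorted sets of the first entries of u: it has extremal weight.
    module Key (u : Perm n) (iu : IsPerm n u) where
      col-of : ℕ → ISet
      col-of c = mem (ar u) (ht c)

      size-of : ∀ c → cnt (col-of c) n ≡ ht c
      size-of c = mem-card u iu (ht c) (ht≤ c)

      key-row : ℕ → List ℕ
      key-row k = L.applyUpTo (λ c → nth (col-of c) k n) (part k)

      key : Tab n
      key = V.tabulate (key-row ∘ toℕ)

      key-at : ∀ k → k < n → atV [] key k ≡ key-row k
      key-at k l = atV-tab [] key-row k l

      key-len : ∀ k → length (atV [] key k) ≡ part k
      key-len k with k <? n
      ... | yes l = trans (cong length (key-at k l)) (length-applyUpTo _ (part k))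
      ... | no l = trans (cong length (atV-out [] key k (≮⇒≥ l))) (sym (atV-out 0 λ′ k (≮⇒≥ l)))

      at-applyUpTo : ∀ (f : ℕ → ℕ) m c → c < m → at 0 (L.applyUpTo f m) c ≡ f c
      at-applyUpTo f (suc m) zero l = refl
      at-applyUpTo f (suc m) (suc c) (s≤s l) = at-applyUpTo (f ∘ suc) m c l

      key-ent : ∀ k c → c < part k → at 0 (atV [] key k) c ≡ nth (col-of c) k n
      key-ent k c l = trans (cong (λ r → at 0 r c) (key-at k (part-row< k c l))) (at-applyUpTo _ (part k) c l)

      spec : ∀ k c → c < part k → col-of c (nth (col-of c) k n) ≡ true × cnt (col-of c) (nth (col-of c) k n) ≡ k × nth (col-of c) k n < n
      spec k c l = nth-spec (col-of c) k n (subst (k <_) (sym (size-of c)) (<ht k c l))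

      ht-anti : ∀ c → ht (suc c) ≤ ht c
      ht-anti c = cnt-⊑ (λ k t → <ᵇ-true c (part k) (<⇒≤ (<ᵇ-true⁻ (suc c) (part k) t))) n

      key-ssyt : SSYT λ′ key
      key-ssyt = key-len ,
        (λ k → at-all _ (λ c l → subst (_< n) (sym (key-ent k c (len→ k l))) (proj₂ (proj₂ (spec k c (len→ k l)))))) ,
        (λ k → sorted⇒linked (λ c l → subst₂ _≤_ (sym (key-ent k c (<⇒≤ (len→ k l)))) (sym (key-ent k (suc c) (len→ k l)))
          (nth-⊑ (col-of (suc c)) (col-of c) k (mono* (pflag u iu) (ht-anti c))
            (subst (k <_) (sym (size-of (suc c))) (<ht k (suc c) (len→ k l)))))) ,
        (λ k c _ l → subst₂ _<_ (sym (key-ent k c (<-≤-trans (len→ (suc k) l) (part-suc k)))) (sym (key-ent (suc k) c (len→ (suc k) l)))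
          (strict k c (len→ (suc k) l)))
        where
        len→ : ∀ k {c} → c < length (atV [] key k) → c < part k
        len→ k {c} l = subst (c <_) (key-len k) l
        strict : ∀ k c → c < part (suc k) → nth (col-of c) k n < nth (col-of c) (suc k) n
        strict k c l = ≰⇒> (λ g → 1+n≰n (subst₂ _≤_ (proj₁ (proj₂ (spec (suc k) c l)))
          (proj₁ (proj₂ (spec k c (<-≤-trans l (part-suc k))))) (cnt-mono (col-of c) g)))

      module K = Col key key-ssyt

      key-col : ∀ c → c < L₀ → colsetR (atV [] key) c ≗ col-of c
      key-col c lc x = bool-iff to from
        where
        to : colsetR (atV [] key) c x ≡ true → col-of c x ≡ true
        to t with K.colset⇒E t
        ... | k , l , e = subst (λ x → col-of c x ≡ true) (trans (sym (key-ent k c l')) e) (proj₁ (spec k c l'))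
          where
          l' : c < part k
          l' = subst (c <_) (key-len k) l
        from : col-of c x ≡ true → colsetR (atV [] key) c x ≡ true
        from t = K.E⇒colset (subst (c <_) (sym (key-len k)) l , trans (key-ent k c l) eq)
          where
          k = cnt (col-of c) x
          x<n : x < n
          x<n with mem-elim (ar u) (ht c) x t
          ... | j , lj , e = subst (_< n) e (proj₁ iu j (<-≤-trans lj (ht≤ c)))
          l : c < part k
          l = ht< k c (subst (k <_) (size-of c) (cnt-strict (col-of c) x n t x<n))
          eq : nth (col-of c) k n ≡ x
          eq with <-cmp (nth (col-of c) k n) x | spec k c l
          ... | tri≈ _ p _ | _ = p
          ... | tri< q _ _ | a , b , _ = ⊥-elim (<-irrefl b (cnt-strict (col-of c) _ x a q))
          ... | tri> _ _ q | a , b , _ = ⊥-elim (<-irrefl (sym b) (cnt-strict (col-of c) x _ t q))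

      key-TS : TS (pflag u iu) key
      key-TS = go L₀ ≤-refl
        where
        go : ∀ L → L ≤ L₀ → S (pflag u iu) (tprog L) (rcols L (colsetR (atV [] key)))
        go zero l = tt
        go (suc L) l = pflag u iu , (λ p _ q → ≤-refl) , key-col L l , go L (<⇒≤ l)

      -- In any chain below `v`, a column of height `p` is level `p` of a flag below `v`; for the
      -- key it is also level `p` of `u`. Every level in `Q` occurs as such a height.
      key-bound : ∀ v → TS v key → pflag u iu ≤[ Q ] v
      key-bound v t zero h = ⊥-elim (<-irrefl refl (<ᵇ-true⁻ L₀ L₀ h))
      key-bound v t (suc p) h with TS-column v key t (part (suc p)) (<-≤-trans (<ᵇ-true⁻ _ _ h) (part-mono z≤n))
      ... | v' , o , e = ≼-trans {mem (ar u) (suc p)} {lv v' (suc p)} {lv v (suc p)}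
            (≗⇒≼ (λ x → subst (λ h → mem (ar u) h x ≡ lv v' h x) (ht-Q p h)
              (trans (sym (key-col (part (suc p)) (<-≤-trans (<ᵇ-true⁻ _ _ h) (part-mono z≤n)) x)) (e x)))) (o (suc p) h)

    Dem-≤ : ∀ u v (iu : IsPerm n u) (iv : IsPerm n v) → (∀ b → Dem λ′ u b → Dem λ′ v b) → pflag u iu ≤[ Q ] pflag v iv
    Dem-≤ u v iu iv h = Key.key-bound u iu (pflag v iv) (proj₂ (Dem⇒TS v iv (Key.key u iu)
      (h _ (TS⇒Dem u iu _ (Key.key-ssyt u iu) (Key.key-TS u iu)))))

    -- Minimality of u forces u to increase between consecutive column heights: otherwise the perm u'
    -- obtained by exchanging two entries gives the same Demazure crystal and lies below u.
    minimal-increasing : ∀ u → IsPerm n u → MinimalFor λ′ u → ∀ j → suc j < n → Q (suc j) ≡ false → ar u j < ar u (suc j)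
    minimal-increasing u iu@(bd , inj) mn j lj nq with <-cmp (ar u j) (ar u (suc j))
    ... | tri< l _ _ = l
    ... | tri≈ _ e _ = ⊥-elim (1+n≢n (sym (inj j (suc j) (<⇒≤ lj) lj e)))
    ... | tri> _ _ g = ⊥-elim (<-irrefl (trans (sym (trans (at′ j (<⇒≤ lj)) (cong (ar u) (swap-low j)))) (cong (λ w → ar w j) u'≡u)) g)
      where
      u' : Perm n
      u' = V.tabulate (λ k → ar u (swapVal j (toℕ k)))
      at′ : ∀ k → k < n → ar u' k ≡ ar u (swapVal j k)
      at′ k l = atV-tab 0 (λ k → ar u (swapVal j k)) k l
      iu' : IsPerm n u'
      iu' = (λ k l → subst (_< n) (sym (at′ k l)) (bd _ (swap<n j lj l))) ,
            (λ k l lk ll e → swap-inj j k l (inj _ _ (swap<n j lj lk) (swap<n j lj ll) (trans (sym (at′ k lk)) (trans e (at′ l ll)))))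
      below : ∀ p → p ≤ j → mem (ar u') p ≗ mem (ar u) p
      below p l = mem-cong (ar u') (ar u) p (λ k lk → trans (at′ k (<-trans (<-≤-trans lk l) (<⇒≤ lj)))
        (cong (ar u) (swap-far j (<⇒≢ (<-≤-trans lk l)) (low≢ (<-≤-trans lk l)))))
      ins-swap : ∀ a b (X Y : ISet) → X ≗ Y → insert a (insert b X) ≗ insert b (insert a Y)
      ins-swap a b X Y h x rewrite h x with x ≡ᵇ a | x ≡ᵇ b
      ... | true | true = refl
      ... | true | false = refl
      ... | false | true = refl
      ... | false | false = refl
      above : ∀ d → suc (suc j) + d ≤ n → mem (ar u') (suc (suc j) + d) ≗ mem (ar u) (suc (suc j) + d)
      above zero l rewrite +-identityʳ j | at′ (suc j) lj | at′ j (<⇒≤ lj) | swap-low j | swap-high j =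
        ins-swap (ar u j) (ar u (suc j)) (mem (ar u') j) (mem (ar u) j) (below j ≤-refl)
      above (suc d) l x rewrite +-suc j d = cong₂ _∨_ (cong (x ≡ᵇ_) (trans (at′ _ l)
          (cong (ar u) (swap-far j (>⇒≢ (≤-trans (n≤1+n _) (s≤s (s≤s (m≤m+n j d))))) (>⇒≢ (s≤s (s≤s (m≤m+n j d))))))))
        (above d (<⇒≤ l) x)
      others : ∀ p → p ≤ n → p ≢ suc j → mem (ar u') p ≗ mem (ar u) p
      others p l ne with p ≤? j
      ... | yes q = below p q
      ... | no q = subst (λ p → mem (ar u') p ≗ mem (ar u) p) eq (above (p ∸ suc (suc j)) (≤-trans (≤-reflexive eq) l))
        where
        eq : suc (suc j) + (p ∸ suc (suc j)) ≡ p
        eq = m+[n∸m]≡n (≤∧≢⇒< (≰⇒> q) (ne ∘ sym))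
      at-level : mem (ar u') (suc j) ≼ mem (ar u) (suc j)
      at-level q = ≤-trans (≤-reflexive (cnt-insert (ar u j) (mem (ar u) j) q (fresh u iu j (<⇒≤ lj))))
        (≤-trans (+-monoˡ-≤ (cnt (mem (ar u) j) q) (bit-mono {ar u j <ᵇ q} {ar u (suc j) <ᵇ q}
          (λ t → <ᵇ-true (ar u (suc j)) q (<-trans g (<ᵇ-true⁻ (ar u j) q t)))))
        (≤-reflexive (sym (trans (cnt-cong same q) (cnt-insert (ar u (suc j)) (mem (ar u) j) q new)))))
        where
        same : mem (ar u') (suc j) ≗ insert (ar u (suc j)) (mem (ar u) j)
        same x = cong₂ _∨_ (cong (x ≡ᵇ_) (trans (at′ j (<⇒≤ lj)) (cong (ar u) (swap-low j)))) (below j ≤-refl x)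
        new : mem (ar u) j (ar u (suc j)) ≡ false
        new with bool? (mem (ar u) j (ar u (suc j)))
        ... | inj₂ f = f
        ... | inj₁ t = ⊥-elim (bool-absurd (trans (cong ((ar u (suc j) ≡ᵇ ar u j) ∨_) t) (Bool.∨-zeroʳ _)) (fresh u iu (suc j) lj))
      u'≤u : pflag u' iu' ≤n pflag u iu
      u'≤u p l with p ≟ suc j
      ... | yes refl = at-level
      ... | no ne = ≗⇒≼ (others p l ne)
      Q-≢ : ∀ p → Q p ≡ true → p ≢ suc j
      Q-≢ p h refl = bool-absurd h nq
      same-Dem : ∀ b → Dem λ′ u' b ⇔ Dem λ′ u b
      same-Dem b = mk⇔
        (λ d → let (s , t) = Dem⇒TS u' iu' b d in TS⇒Dem u iu b s (TS-mono (pflag u' iu') (pflag u iu) b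
          (λ p h → ≗⇒≼ (others p (Q≤n p h) (Q-≢ p h))) t))
        (λ d → let (s , t) = Dem⇒TS u iu b d in TS⇒Dem u' iu' b s (TS-mono (pflag u iu) (pflag u' iu') b
          (λ p h → ≗⇒≼ (λ x → sym (others p (Q≤n p h) (Q-≢ p h) x))) t))
      -- Since `u'` is below `u`, it has a reduced word inside one of `u`; minimality makes the two
      -- words equally long, so they coincide.
      u'≡u : u' ≡ u
      u'≡u with rank⇒bruhat u' u iu' iu u'≤u
      ... | a , b , (_ , ea , la) , s , (_ , eb , lb) = trans (sym eb) (trans (cong (prodW n)
            (subword-full s (≤-trans (≤-reflexive la) (≤-trans (mn u' iu' same-Dem) (≤-reflexive (sym lb)))))) ea)

    -- Fix `q`. Between two levels of `Q` the entries of `u` increase, so those below `q` come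
    -- first. From a level whose next entry is below `q`, go back: each entry passed adds one to the
    -- count of `u`, at most one to that of `v`. Otherwise go forward: the count of `u` stays
    -- constant, that of `v` can only grow. Either way a level of `Q`, or one of the trivial levels
    -- `0` and `n`, settles the inequality.
    increasing⇒≤ : ∀ u v (iu : IsPerm n u) (iv : IsPerm n v) →
      (∀ j → suc j < n → Q (suc j) ≡ false → ar u j < ar u (suc j)) →
      pflag u iu ≤[ Q ] pflag v iv → pflag u iu ≤n pflag v iv
    increasing⇒≤ u v iu iv inc h p lp q = claim p lp
      where
      C : ℕ → Set
      C p = cnt (mem (ar v) p) q ≤ cnt (mem (ar u) p) q
      step : ∀ w (iw : IsPerm n w) p → p < n → cnt (mem (ar w) (suc p)) q ≡ bit (ar w p <ᵇ q) + cnt (mem (ar w) p) q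
      step w iw p l = cnt-insert (ar w p) (mem (ar w) p) q (fresh w iw p l)
      ext : ∀ p → p < n → ar u p < q → C p → C (suc p)
      ext p l lt c = ≤-trans (≤-reflexive (step v iv p l)) (≤-trans (+-mono-≤ (bit≤1 (ar v p <ᵇ q)) c)
        (≤-reflexive (sym (trans (step u iu p l) (cong (λ b → bit b + cnt (mem (ar u) p) q) (<ᵇ-true (ar u p) q lt))))))
      down : ∀ p → p < n → ar u p < q → C (suc p)
      down zero l lt = ext zero l lt ≤-refl
      down (suc p) l lt with bool? (Q (suc p))
      ... | inj₁ t = ext (suc p) l lt (h (suc p) t q)
      ... | inj₂ f = ext (suc p) l lt (down p (<⇒≤ l) (<-trans (inc p l f) lt))
      up′ : ∀ d p → p + d ≡ n → q ≤ ar u p ⊎ p ≡ n → C p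
      up′ zero p e _ = subst C (trans (sym e) (+-identityʳ p))
        (≤-reflexive (cnt-cong (λ x → trans (mem-full v iv x) (sym (mem-full u iu x))) q))
      up′ (suc d) p e (inj₂ refl) = ⊥-elim (m+1+n≢m p e)
      up′ (suc d) p e (inj₁ g) = ≤-trans (≤-trans (m≤n+m _ (bit (ar v p <ᵇ q))) (≤-reflexive (sym (step v iv p l))))
          (≤-trans next (≤-reflexive (trans (step u iu p l) (cong (λ b → bit b + cnt (mem (ar u) p) q) (<ᵇ-false (ar u p) q g)))))
        where
        l : p < n
        l = subst (p <_) e (m<m+n p (s≤s z≤n))
        e' : suc p + d ≡ n
        e' = trans (sym (+-suc p d)) e
        next : C (suc p)
        next with suc p ≟ n
        ... | yes r = up′ d (suc p) e' (inj₂ r)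
        ... | no r with bool? (Q (suc p))
        ...   | inj₁ t = h (suc p) t q
        ...   | inj₂ f = up′ d (suc p) e' (inj₁ (≤-trans g (<⇒≤ (inc p (≤∧≢⇒< l r) f))))
      claim : ∀ p → p ≤ n → C p
      claim zero l = ≤-refl
      claim (suc p) l with suc p <? n
      ... | no g = up′ 0 (suc p) (trans (+-identityʳ _) (≤-antisym l (≮⇒≥ g))) (inj₂ (≤-antisym l (≮⇒≥ g)))
      ... | yes l' with ar u (suc p) <? q
      ...   | no g = up′ (n ∸ suc p) (suc p) (m+[n∸m]≡n l) (inj₁ (≮⇒≥ g))
      ...   | yes lt with bool? (Q (suc p))
      ...     | inj₁ t = h (suc p) t q
      ...     | inj₂ f = down p l (<-trans (inc p l' f) lt)

    Dem-⊆⇒Bruhat : ∀ u v → IsPerm n u → IsPerm n v → MinimalFor λ′ u → (∀ b → Dem λ′ u b → Dem λ′ v b) → Bruhat n u v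
    Dem-⊆⇒Bruhat u v iu iv mn h = rank⇒bruhat u v iu iv
      (increasing⇒≤ u v iu iv (minimal-increasing u iu mn) (Dem-≤ u v iu iv h))

-- Comparison of the two crystals

occ-replicate : ∀ x l → occ x (replicate l x) ≡ l
occ-replicate x zero = refl
occ-replicate x (suc l) rewrite ≡ᵇ-refl x = cong suc (occ-replicate x l)

occ-replicate-≢ : ∀ x y l → x ≢ y → occ x (replicate l y) ≡ 0
occ-replicate-≢ x y zero ne = refl
occ-replicate-≢ x y (suc l) ne rewrite ≢⇒≡ᵇ x y ne = occ-replicate-≢ x y l ne

wtB-hw : ∀ {n} (λ′ : Vec ℕ n) → wtB (hw λ′) ≡ λ′
wtB-hw {n} λ′ = atV-ext 0 _ λ′ (λ k l → trans (atV-tab 0 (λ k → sum (L.map (occ k) (V.toList (hw λ′)))) k l) (count λ′ id suc-id k l))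
  where
  suc-id : ∀ {x y} → id x ≡ id y → x ≡ y
  suc-id e = e
  rows : ∀ {p} → Vec ℕ p → (ℕ → ℕ) → Vec (List ℕ) p
  rows v f = V.tabulate (λ j → replicate (V.lookup v j) (f (toℕ j)))
  absent : ∀ {p} (v : Vec ℕ p) f x → (∀ j → x ≢ f j) → sum (L.map (occ x) (V.toList (rows v f))) ≡ 0
  absent [] f x h = refl
  absent (y ∷ v) f x h = cong₂ _+_ (occ-replicate-≢ x (f 0) y (h 0)) (absent v (f ∘ suc) x (h ∘ suc))
  count : ∀ {p} (v : Vec ℕ p) f → (∀ {x y} → f x ≡ f y → x ≡ y) → ∀ k → k < p →
    sum (L.map (occ (f k)) (V.toList (rows v f))) ≡ atV 0 v k
  count (y ∷ v) f inj zero l = trans (cong₂ _+_ (occ-replicate (f 0) y) (absent v (f ∘ suc) (f 0) (λ j e → 0≢1+n (inj e)))) (+-identityʳ y)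
  count (y ∷ v) f inj (suc k) (s≤s l) = cong₂ _+_ (occ-replicate-≢ (f (suc k)) (f 0) y (λ e → 0≢1+n (sym (inj e))))
    (count v (f ∘ suc) (suc-injective ∘ inj) k l)

DemW-highest : ∀ {n} (λ′ : Vec ℕ n) a b → All (λ i → suc i < n) a → (∀ i → suc i < n → eB i b ≡ nothing) → DemW λ′ a b → b ≡ hw λ′
DemW-highest λ′ [] b al h d = d
DemW-highest λ′ (i ∷ a) b (l ∷ al) h (s , zero , .b , refl , d) = DemW-highest λ′ a b al h d
DemW-highest {n} λ′ (i ∷ a) b (l ∷ al) h (s , suc k , x , e , d)
  with trans (sym e) (trans (Demazure.eBpow-suc n i k b) (cong (λ m → M._>>=_ m (eBpow i k)) (h i l)))
... | ()

map-nothing : ∀ {A B : Set} (f : A → B) m → M.map f m ≡ nothing → m ≡ nothing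
map-nothing f nothing e = refl

map-just : ∀ {A B : Set} (f : A → B) m {y} → M.map f m ≡ just y → Σ A λ x → m ≡ just x × f x ≡ y
map-just f (just x) refl = x , refl , refl

module Highest {n m : ℕ} {D : Diagram n m} {s : ℕ} {λs : Fin s → Vec ℕ n} {ws : Fin s → Perm n}
    (par : ∀ k → IsPartition (λs k)) (per : ∀ k → IsPerm n (ws k)) (K : KohnertDecomp D s λs ws) where
  open KohnertDecomp K

  IsHighest : Diagram n m → Set
  IsHighest T = ∀ i → suc i < n → eK i T ≡ nothing

  source : ∀ k → Σ (Diagram n m) λ T → KD D T × φ T ≡ (k , hw (λs k))
  source k = surj k (hw (λs k)) (Demazure.Crystal.Dem-hw n (λs k) (par k) (ws k) (per k))

  source-highest : ∀ k → IsHighest (proj₁ (source k))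
  source-highest k i l with source k
  ... | T , p , e = map-nothing φ (eK i T) (trans (comm i l T p)
        (cong (M.map (λ b → (proj₁ (φ T) , b))) (trans (cong (λ z → eB i (proj₂ z)) e) (Tableaux.Shape.hw-nothing n (λs k) (par k) i))))

  highest : ∀ T → KD D T → IsHighest T → φ T ≡ (proj₁ (φ T) , hw (λs (proj₁ (φ T))))
  highest T p h with into T p
  ... | a , (al , _) , d = cong (proj₁ (φ T) ,_) (DemW-highest (λs (proj₁ (φ T))) a (proj₂ (φ T)) al
        (λ i l → map-nothing (λ b → (proj₁ (φ T) , b)) (eB i (proj₂ (φ T)))
          (trans (sym (comm i l T p)) (cong (M.map φ) (h i l)))) d)

module Compare (n m : ℕ) (D : Diagram n m) (r : ℕ) (lr : suc r < n) (nw : Northwest D)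
    (sub : ∀ c → cell D r c ≡ true → cell D (suc r) c ≡ true)
    (s : ℕ) (μ : Fin s → Vec ℕ n) (u : Fin s → Perm n)
    (pμ : ∀ k → IsPartition (μ k)) (pu : ∀ k → IsPerm n (u k)) (KA : KohnertDecomp (swapRows r D) s μ u)
    (t : ℕ) (ν : Fin t → Vec ℕ n) (v : Fin t → Perm n)
    (pν : ∀ k → IsPartition (ν k)) (pv : ∀ k → IsPerm n (v k)) (KB : KohnertDecomp D t ν v) where
  module A = KohnertDecomp KA
  module B = KohnertDecomp KB
  module HA = Highest pμ pu KA
  module HB = Highest pν pv KB

  A⊆B : ∀ {T} → KD (swapRows r D) T → KD D T
  A⊆B p = swap-reachable r lr D nw sub ◅◅ p

  σ : Fin s → Fin t
  σ k = proj₁ (B.φ (proj₁ (HA.source k)))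

  τ : Fin t → Fin s
  τ j = proj₁ (A.φ (proj₁ (HB.source j)))

  KDA : ∀ k → KD (swapRows r D) (proj₁ (HA.source k))
  KDA k = proj₁ (proj₂ (HA.source k))

  -- The vanishing of `e_r` alone places a source of `KD(D)` in the smaller crystal. This is why no
  -- component of `D` is missed and `τ` can be defined.
  KDB : ∀ j → KD (swapRows r D) (proj₁ (HB.source j))
  KDB j = KD-highest r lr D nw sub (proj₁ (proj₂ (HB.source j))) (HB.source-highest j r lr)

  φB-source : ∀ k → B.φ (proj₁ (HA.source k)) ≡ (σ k , hw (ν (σ k)))
  φB-source k = HB.highest _ (A⊆B (KDA k)) (HA.source-highest k)

  φA-source : ∀ j → A.φ (proj₁ (HB.source j)) ≡ (τ j , hw (μ (τ j)))
  φA-source j = HA.highest _ (KDB j) (HB.source-highest j)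

  σ-τ : ∀ j → σ (τ j) ≡ j
  σ-τ j = trans (cong (proj₁ ∘ B.φ) (A.inj _ _ (KDA (τ j)) (KDB j) (trans (proj₂ (proj₂ (HA.source (τ j)))) (sym (φA-source j)))))
    (cong proj₁ (proj₂ (proj₂ (HB.source j))))

  τ-σ : ∀ k → τ (σ k) ≡ k
  τ-σ k = trans (cong (proj₁ ∘ A.φ) (B.inj _ _ (proj₁ (proj₂ (HB.source (σ k)))) (A⊆B (KDA k))
      (trans (proj₂ (proj₂ (HB.source (σ k)))) (sym (φB-source k)))))
    (cong proj₁ (proj₂ (proj₂ (HA.source k))))

  -- A source has the shape of its component as weight, and both decompositions preserve the weight
  -- of the same diagram.
  shape : ∀ k → μ k ≡ ν (σ k)
  shape k = trans (sym (wtB-hw (μ k))) (trans (cong (wtB ∘ proj₂) (sym (proj₂ (proj₂ (HA.source k)))))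
    (trans (sym (A.wt _ (KDA k))) (trans (B.wt _ (A⊆B (KDA k))) (trans (cong (wtB ∘ proj₂) (φB-source k)) (wtB-hw (ν (σ k)))))))

  -- By induction along a raising path to the source, as e_i is injective.
  same-tableau : ∀ k a b T → All (λ i → suc i < n) a → DemW (μ k) a b → KD (swapRows r D) T →
    A.φ T ≡ (k , b) → B.φ T ≡ (σ k , b)
  same-tableau k [] b T al refl p e = trans (cong B.φ (A.inj T _ p (KDA k) (trans e (sym (proj₂ (proj₂ (HA.source k)))))))
    (trans (φB-source k) (cong (λ l → σ k , hw l) (sym (shape k))))
  same-tableau k (i ∷ a) b T (l ∷ al) (ss , q , x , e , d) p eφ = along q b T ss e p eφ
    where
    along : ∀ q b T → SSYT (μ k) b → eBpow i q b ≡ just x → KD (swapRows r D) T → A.φ T ≡ (k , b) → B.φ T ≡ (σ k , b)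
    along zero b T ss refl p eφ = same-tableau k a b T al d p eφ
    along (suc q) b T ss e p eφ = go (eB i b) refl (trans (sym (Demazure.eBpow-suc n i q b)) e)
      where
      go : ∀ m → eB i b ≡ m → M._>>=_ m (eBpow i q) ≡ just x → B.φ T ≡ (σ k , b)
      go (just b₁) eb e' with map-just A.φ (eK i T) (trans (A.comm i l T p)
            (trans (cong (λ z → M.map (λ b → (proj₁ z , b)) (eB i (proj₂ z))) eφ) (cong (M.map (k ,_)) eb)))
      ... | T₁ , eT , eφ₁ with along q b₁ T₁ (Tableaux.Shape.eB-ssyt n (μ k) (pμ k) i b b₁ ss eb) e'
              (KD-closed (swapRows r D) (nw-swap r lr D nw sub) i l p eT) eφ₁
      ...   | ih with map-just (λ b → (proj₁ (B.φ T) , b)) (eB i (proj₂ (B.φ T)))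
              (trans (sym (B.comm i l T (A⊆B p))) (trans (cong (M.map B.φ) eT) (cong just ih)))
      ...     | b₁' , eb' , pr = cong₂ _,_ (cong proj₁ pr)
              (Tableaux.Shape.eB-injective n (μ k) (pμ k) i (proj₂ (B.φ T)) b b₁ ss' ss (trans eb' (cong (just ∘ proj₂) pr)) eb)
        where
        j : Fin t
        j = proj₁ (B.φ T)
        -- `e_i` is injective only among tableaux of one shape. The component of `T` in `D` is known
        -- to be `σ k` from the raised diagram, because `e_i` does not change components, and
        -- `shape` identifies its shape with `μ k`.
        ss' : SSYT (μ k) (proj₂ (B.φ T))
        ss' = subst (λ l → SSYT l (proj₂ (B.φ T))) (trans (cong ν (cong proj₁ pr)) (sym (shape k)))
          (proj₁ (Demazure.Crystal.Dem⇒TS n (ν j) (pν j) (v j) (pv j) (proj₂ (B.φ T)) (B.into T (A⊆B p))))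

  Dem-⊆ : ∀ k b → Dem (μ k) (u k) b → Dem (μ k) (v (σ k)) b
  Dem-⊆ k b d@(a , (al , _) , dw) with A.surj k b d
  ... | T , p , e = subst (λ l → Dem l (v (σ k)) b) (sym (shape k))
        (subst (λ z → Dem (ν (proj₁ z)) (v (proj₁ z)) (proj₂ z)) (same-tableau k a b T al dw p e) (B.into T (A⊆B p)))

theorem3p15 : (n m : ℕ) (D : Diagram n m) (r : ℕ) → suc r < n →
    Northwest D →
    (∀ c → cell D r c ≡ true → cell D (suc r) c ≡ true) →
    (s : ℕ) (μ : Fin s → Vec ℕ n) (u : Fin s → Perm n) →
    (∀ k → IsPartition (μ k)) → (∀ k → IsPerm n (u k)) → (∀ k → MinimalFor (μ k) (u k)) →
    KohnertDecomp (swapRows r D) s μ u →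
    (t : ℕ) (ν : Fin t → Vec ℕ n) (v : Fin t → Perm n) →
    (∀ k → IsPartition (ν k)) → (∀ k → IsPerm n (v k)) → (∀ k → MinimalFor (ν k) (v k)) →
    KohnertDecomp D t ν v →
    s ≡ t × Σ (Fin s ↔ Fin t) (λ σ →
    ∀ k → μ k ≡ ν (Inverse.to σ k) × Bruhat n (u k) (v (Inverse.to σ k)))
theorem3p15 n m D r lr nw sub s μ u pμ pu mu KA t ν v pν pv mv KB = ↔⇒≡ bij , bij , λ k → shape k ,
    Demazure.Crystal.Dem-⊆⇒Bruhat n (μ k) (pμ k) (u k) (v (σ k)) (pu k) (pv (σ k)) (mu k) (Dem-⊆ k)
  where
  open Compare n m D r lr nw sub s μ u pμ pu KA t ν v pν pv KB
  bij : Fin s ↔ Fin t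
  bij = mk↔ₛ′ σ τ σ-τ τ-σ
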